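{- Let $T=\{1243,2341,4123\}$ and let $F_T(x)=\sum_{n\ge0}|S_n(T)|x^n$. Then $$F_T(x)=\frac{1-9x+34x^2-70x^3+87x^4-65x^5+26x^6-5x^7}{(1-x)^7(1-2x)}+\frac{1}{1-x}\big(C(x)-1\big),$$ where $C(x)=\frac{1-\sqrt{1-4x}}{2x}$.
   Context: $S_n$ is the set of permutations of $[n]$ ($S_0$ contains the empty permutation). A permutation avoids a pattern $\tau$ if it has no subsequence order-isomorphic to $\tau$; $S_n(T)$ is the set of permutations in $S_n$ avoiding every pattern in $T$. $C(x)=\frac{1-\sqrt{1-4x}}{2x}=\sum_{n\ge0}\frac{1}{n+1}\binom{2n}{n}x^n$ is the Catalan generating function. -}

module Defs where

open import Data.Nat as ℕ using (ℕ; zero; suc; _^_)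
open import Data.Nat.Combinatorics using (_C_)
open import Data.Nat.DivMod using (_/_)
open import Data.Integer as ℤ using (ℤ; +_)
open import Data.Fin as Fin using (Fin; toℕ)
open import Data.Vec using (Vec; []; _∷_; lookup)
open import Data.List using (List; []; _∷_; upTo; map; foldr; length)
open import Data.List.Membership.Propositional using (_∈_)
open import Data.List.Relation.Unary.Unique.Propositional using (Unique)
open import Data.Product using (Σ; _×_)
open import Function.Definitions using (Injective)
open import Function.Bundles using (_⇔_)
open import Relation.Binary.PropositionalEquality using (_≡_)
open import Relation.Nullary using (¬_)

-- A permutation of [n] is a word of length n over Fin n (values 0..n-1,
-- i.e. shifted by one from [n]) in which each value occurs once.
IsPerm : ∀ {n} → Vec (Fin n) n → Set
IsPerm {n} σ = Injective _≡_ _≡_ (lookup σ)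

Contains : ∀ {n k} → Vec (Fin n) n → Vec ℕ k → Set
Contains {n} {k} σ τ =
  Σ (Fin k → Fin n) λ f →
    (∀ a b → a Fin.< b → f a Fin.< f b) ×
    (∀ a b → (toℕ (lookup σ (f a)) ℕ.< toℕ (lookup σ (f b))) ⇔ (lookup τ a ℕ.< lookup τ b))

Avoids : ∀ {n k} → Vec (Fin n) n → Vec ℕ k → Set
Avoids σ τ = ¬ Contains σ τ

p1243 p2341 p4123 : Vec ℕ 4
p1243 = 1 ∷ 2 ∷ 4 ∷ 3 ∷ []
p2341 = 2 ∷ 3 ∷ 4 ∷ 1 ∷ []
p4123 = 4 ∷ 1 ∷ 2 ∷ 3 ∷ []

InSnT : ∀ {n} → Vec (Fin n) n → Set
InSnT σ = IsPerm σ × Avoids σ p1243 × Avoids σ p2341 × Avoids σ p4123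

CardSnT : ℕ → ℕ → Set
CardSnT n m =
  Σ (List (Vec (Fin n) n)) λ L →
    Unique L × (∀ σ → (σ ∈ L) ⇔ InSnT σ) × (length L ≡ m)

Series : Set
Series = ℕ → ℤ

sumℤ : List ℤ → ℤ
sumℤ = foldr ℤ._+_ (+ 0)

_⊕_ : Series → Series → Series
(f ⊕ g) n = f n ℤ.+ g n

_⊛_ : Series → Series → Series
(f ⊛ g) n = sumℤ (map (λ k → f k ℤ.* g (n ℕ.∸ k)) (upTo (suc n)))

infixl 6 _⊕_
infixl 7 _⊛_

poly : List ℤ → Series
poly []       n       = + 0
poly (c ∷ cs) zero    = c
poly (c ∷ cs) (suc n) = poly cs n

-- 1/(1 - a x) = Σ a^n x^n
geom : ℕ → Series
geom a n = + (a ^ n)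

pow : Series → ℕ → Series
pow f zero    = poly (+ 1 ∷ [])
pow f (suc k) = f ⊛ pow f k

catalanGF : Series
catalanGF n = + (((2 ℕ.* n) C n) / suc n)

catalanGF-1 : Series
catalanGF-1 zero    = + 0
catalanGF-1 (suc n) = catalanGF (suc n)

numerator : Series
numerator = poly (+ 1 ∷ ℤ.- (+ 9) ∷ + 34 ∷ ℤ.- (+ 70) ∷ + 87 ∷ ℤ.- (+ 65) ∷ + 26 ∷ ℤ.- (+ 5) ∷ [])

rhsGF : Series
rhsGF = numerator ⊛ pow (geom 1) 7 ⊛ geom 2 ⊕ geom 1 ⊛ catalanGF-1

{-# OPTIONS --safe #-}
-- Write a permutation of the class as P n Q with n its maximum.  If Q is empty, any member P of the class will do.  The members with
-- Q non-empty that avoid 123 are all the 123-avoiders (Catalan many) except one.  A member with Q non-empty that contains 123 has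
-- one of three shapes.  Either P is not decreasing and Q is, and P shuffles the values above Q with those below Q; or Q avoids 123
-- and 132 and is not decreasing, and P lists the values below Q (at least one) and then those above Q; or P is decreasing with last
-- entry t, some entry of P exceeds one of Q, and Q = a D B M R where a, D, B, R are decreasing and a > M > D > R > t > B.  The
-- number of members of these shapes is a constant times 2ⁿ plus a polynomial in n, so that both sides of the identity satisfy the
-- same first-order recurrence in n.
module Submission where

open import Defs
open import Data.Bool using (Bool; true; false)
open import Data.Empty using (⊥; ⊥-elim)
open import Data.Integer.Properties as ℤₚ using ()
open import Data.Integer.Tactic.RingSolver using () renaming (solve-∀ to ℤ-solve-∀)
open import Data.List as List using (List; []; _∷_; _++_; [_]; length; map; downFrom)
open import Data.List.Membership.Propositional using (_∈_; _∉_; find; lose)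
open import Data.List.Membership.Propositional.Properties using (∈-++⁺ˡ; ∈-++⁺ʳ; ∈-++⁻; ∈-∃++; ∈-downFrom⁺; ∈-downFrom⁻)
open import Data.List.Properties using (length-++; length-downFrom; map-applyUpTo; ∷-injective; ∷-injectiveˡ; ∷-injectiveʳ; ∷ʳ-injective; ++-assoc; ++-identityʳ; ++-cancelˡ; ++-cancelʳ)
open import Data.List.Relation.Binary.Permutation.Propositional using (_↭_; ↭-refl; ↭-sym; ↭-trans; ↭-reflexive; prep; swap)
open import Data.List.Relation.Binary.Permutation.Propositional.Properties using (drop-mid; drop-∷; ∈-resp-↭; ↭-length; shift; ↭-empty-inv; ↭-singleton-inv; ++-comm; ++-commutativeMonoid) renaming (++⁺ˡ to ++⁺ˡ-↭; ++⁺ʳ to ++⁺ʳ-↭; ++⁺ to ++⁺-↭)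
open import Data.List.Relation.Binary.Sublist.Propositional using (_⊆_; []; _∷_; from∈; to∈; lookup; ⊆-refl; ⊆-trans; minimum) renaming (_∷ʳ_ to infixr 5 _∷ˢ_)
open import Data.List.Relation.Binary.Sublist.Propositional.Properties using (++⁺; ++⁺ˡ; ++⁺ʳ)
open import Data.List.Relation.Unary.All as All using (All; []; _∷_)
open import Data.List.Relation.Unary.All.Properties as Allₚ using ()
open import Data.List.Relation.Unary.AllPairs as AllPairs using (AllPairs; []; _∷_)
open import Data.List.Relation.Unary.AllPairs.Properties as AllPairsₚ using ()
open import Data.List.Relation.Unary.Any as Any using (here; there; Any)
open import Data.List.Relation.Unary.Unique.Propositional using (Unique)
open import Data.List.Relation.Unary.Unique.Propositional.Properties using (downFrom⁺)
open import Data.List.Reverse using (Reverse; reverseView; []; _∶_∶ʳ_)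
open import Data.Nat as ℕ using (ℕ; zero; suc; pred; _+_; _*_; _∸_; _^_; _≤_; _<_; _>_; z≤n; s≤s; s≤s⁻¹; _<?_)
open import Data.Nat.Combinatorics using (_C_; nCk+nC[k+1]≡[n+1]C[k+1]; nCk≡nC[n∸k]; nCn≡1; k>n⇒nCk≡0)
open import Data.Nat.DivMod using (_/_; m*n/n≡m)
open import Data.Nat.Properties as ℕₚ using (<-asym; <-irrefl; <-trans; <-cmp; +-suc; +-comm; +-identityʳ; suc-injective; ≤-refl; ≤-trans; ≤-reflexive; m≤m+n; m≤n⇒m<n∨m≡n; <⇒≤; +-assoc; +-cancelʳ-≡; *-cancelˡ-≡; *-comm; *-zeroʳ; *-distribˡ-+; m≤n⇒m≤1+n; 1+n≰n; +-cancelˡ-<; +-cancelˡ-≡; m∸n+n≡m; m∸n≤m; m<n⇒0<n∸m; ≤-antisym; m<m+n)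
open import Data.Nat.Tactic.RingSolver using (solve-∀)
open import Data.Product using (Σ; ∃; ∃₂; _×_; _,_; proj₁; proj₂)
open import Data.Sum using (_⊎_; inj₁; inj₂; [_,_]′)
open import Data.Unit using (⊤; tt)
open import Function using (_∘_; case_of_)
open import Function.Bundles using (mk⇔; Equivalence)
open import Relation.Binary.Definitions using (tri<; tri≈; tri>; Tri)
open import Relation.Binary.PropositionalEquality using (_≡_; _≢_; refl; sym; trans; cong; cong₂; subst; subst₂; module ≡-Reasoning)
open import Relation.Nullary using (¬_; yes; no; Dec)
open import Algebra.Properties.AbelianGroup ℤₚ.+-0-abelianGroup using (∙-cancelʳ)
import Algebra.Solver.CommutativeMonoid

-- Enumerations with a count

-- For Q non-empty the maximum n can serve as the 4 of each pattern: n before a 123 of Q gives 4123,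
-- and an ascent a b of P followed by n and an entry q of Q gives 2341 when q < a and 1243 when b <
-- q. So Q avoids 123 and every ascent of P encloses all of Q in value, which makes the existence of
-- an ascent in P the first distinction; for decreasing P it is whether P lies entirely below Q. The
-- exceptional 123-avoider is the decreasing word followed by n, the only one with Q empty. The
-- obstacle is the counting. Each shape is encoded by cutting the decreasing list of the values
-- below n into consecutive blocks, with a word of booleans where two blocks are interleaved. The
-- counts are then iterated partial sums of simple sequences and depend only on the number of
-- values. Closed forms are kept as a multiple of 2ⁿ plus an integer combination of the C(n, k),
-- where summation shifts the coefficients. The 123-avoiders are counted separately by insertion of
-- the maximum, through ballot numbers.

record Enum {A : Set} (P : A → Set) (m : ℕ) : Set where
  constructor enum
  field
    list     : List A
    unique   : Unique list
    sound    : All P list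
    complete : ∀ {x} → P x → x ∈ list
    size     : length list ≡ m

module _ {A : Set} where

  enum-cong : ∀ {P Q : A → Set} {m} → (∀ {x} → P x → Q x) → (∀ {x} → Q x → P x) →
              Enum P m → Enum Q m
  enum-cong f g (enum l u s c z) = enum l u (All.map f s) (c ∘ g) z

  enum-≡ : ∀ {P : A → Set} {m k} → m ≡ k → Enum P m → Enum P k
  enum-≡ refl e = e

  enum-∅ : ∀ {P : A → Set} → (∀ {x} → ¬ P x) → Enum P 0
  enum-∅ ¬p = enum [] [] [] (⊥-elim ∘ ¬p) refl

  enum-singleton : ∀ {P : A → Set} (a : A) → P a → (∀ {x} → P x → x ≡ a) → Enum P 1
  enum-singleton a pa only = enum [ a ] ([] ∷ []) (pa ∷ []) (here ∘ only) refl

  enum-⊎ : ∀ {P Q : A → Set} {m k} → (∀ {x} → P x → Q x → ⊥) →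
           Enum P m → Enum Q k → Enum (λ x → P x ⊎ Q x) (m + k)
  enum-⊎ {P} {Q} disj (enum l u s c z) (enum l' u' s' c' z') = enum (l ++ l')
    (AllPairsₚ.++⁺ u u' (All.map (λ px → All.map (λ { qy refl → disj px qy }) s') s))
    (Allₚ.++⁺ (All.map inj₁ s) (All.map inj₂ s'))
    [ ∈-++⁺ˡ ∘ c , ∈-++⁺ʳ l ∘ c' ]′
    (trans (length-++ l) (cong₂ _+_ z z'))

  -- Since `a` is a member, m is positive and the truncated `pred` loses nothing; the equation keeps
  -- this for later arithmetic.
  enum-remove : ∀ {P : A → Set} {m a} → P a → Enum P m → m ≡ suc (pred m) × Enum (λ x → P x × x ≢ a) (pred m)
  enum-remove {P} {m} {a} pa (enum l u s c z) with ∈-∃++ (c pa)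
  ... | xs , ys , refl = trans m≡ (cong suc (sym (cong pred m≡))) , enum (xs ++ ys) u' s' c' (cong pred (trans (sym len) z))
    where
    len : length (xs ++ a ∷ ys) ≡ suc (length (xs ++ ys))
    len = trans (length-++ xs) (trans (+-suc (length xs) (length ys)) (cong suc (sym (length-++ xs))))
    m≡ : m ≡ suc (length (xs ++ ys))
    m≡ = trans (sym z) len
    parts : ∀ {R : A → A → Set} xs → AllPairs R (xs ++ a ∷ ys) → AllPairs R (xs ++ ys) × All (λ x → R x a) xs × All (R a) ys
    parts [] (p ∷ ps) = ps , [] , p
    parts (x ∷ xs) (p ∷ ps) with parts xs ps
    ... | q , r , t with Allₚ.++⁻ˡ xs p | Allₚ.++⁻ʳ xs p
    ... | p₁ | p₂ ∷ p₃ = Allₚ.++⁺ p₁ p₃ ∷ q , p₂ ∷ r , t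
    u' = proj₁ (parts xs u)
    ≢a : All (_≢ a) (xs ++ ys)
    ≢a = Allₚ.++⁺ (proj₁ (proj₂ (parts xs u))) (All.map (λ ne e → ne (sym e)) (proj₂ (proj₂ (parts xs u))))
    s' : All (λ x → P x × x ≢ a) (xs ++ ys)
    s' with Allₚ.++⁻ʳ xs s
    ... | _ ∷ sy = All.zip (Allₚ.++⁺ (Allₚ.++⁻ˡ xs s) sy , ≢a)
    c' : ∀ {x} → P x × x ≢ a → x ∈ xs ++ ys
    c' (px , ne) with ∈-++⁻ xs (c px)
    ... | inj₁ i = ∈-++⁺ˡ i
    ... | inj₂ (here e) = ⊥-elim (ne e)
    ... | inj₂ (there i) = ∈-++⁺ʳ xs i

module _ {A B : Set} where

  -- Phrased with a relation because some maps make sense on members only, such as inserting n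
  -- behind a prefix that membership provides. The image is therefore built along the proofs of
  -- membership.
  enum-rel : ∀ {P : A → Set} {m} (R : A → B → Set) →
             (∀ {x} → P x → ∃ (R x)) →
             (∀ {x y y'} → P x → R x y → R x y' → y ≡ y') →
             (∀ {x x' y} → P x → P x' → R x y → R x' y → x ≡ x') →
             Enum P m → Enum (λ y → ∃ λ x → P x × R x y) m
  enum-rel {P} R total fun inj (enum l u s c z) =
    enum (image s) (image-unique u s) (image-sound s) (λ { (_ , px , r) → image-complete s (c px) r }) (trans (image-length s) z)
    where
    image : ∀ {l} → All P l → List B
    image [] = []
    image (px ∷ s) = proj₁ (total px) ∷ image s
    image-length : ∀ {l} (s : All P l) → length (image s) ≡ length l
    image-length [] = refl
    image-length (px ∷ s) = cong suc (image-length s)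
    image-sound : ∀ {l} (s : All P l) → All (λ y → ∃ λ x → P x × R x y) (image s)
    image-sound [] = []
    image-sound (px ∷ s) = (_ , px , proj₂ (total px)) ∷ image-sound s
    image-complete : ∀ {l} (s : All P l) {x y} → x ∈ l → R x y → y ∈ image s
    image-complete (px ∷ s) (here refl) r = here (fun px r (proj₂ (total px)))
    image-complete (px ∷ s) (there i) r = there (image-complete s i r)
    image-unique : ∀ {l} → Unique l → (s : All P l) → Unique (image s)
    image-unique [] [] = []
    image-unique (ne ∷ u) (px ∷ s) = fresh ne s ∷ image-unique u s
      where
      fresh : ∀ {l} → All (_ ≢_) l → (s : All P l) → All (proj₁ (total px) ≢_) (image s)
      fresh [] [] = []
      fresh (n ∷ ne) (py ∷ s) =
        (λ e → n (inj px py (proj₂ (total px)) (subst (R _) (sym e) (proj₂ (total py))))) ∷ fresh ne s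

  enum-map : ∀ {P : A → Set} {Q : B → Set} {m} (f : A → B) →
             (∀ {x} → P x → Q (f x)) →
             (∀ {y} → Q y → ∃ λ x → P x × y ≡ f x) →
             (∀ {x x'} → P x → P x' → f x ≡ f x' → x ≡ x') →
             Enum P m → Enum Q m
  enum-map f to from inj e =
    enum-cong (λ { (x , px , refl) → to px }) from
      (enum-rel (λ x y → y ≡ f x) (λ {x} _ → f x , refl) (λ { _ refl refl → refl })
        (λ px px' e e' → inj px px' (trans (sym e) e')) e)

-- Partial sums, decreasing lists and sublists

ps xps : (ℕ → ℕ) → ℕ → ℕ
ps f zero = f zero
ps f (suc n) = f (suc n) + ps f n
xps f zero = 0
xps f (suc n) = ps f n

Desc : List ℕ → Set
Desc = AllPairs _>_

++⁻-pairs : ∀ {A : Set} {R : A → A → Set} xs {ys} → AllPairs R (xs ++ ys) →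
            AllPairs R xs × AllPairs R ys × All (λ x → All (R x) ys) xs
++⁻-pairs [] p = [] , p , []
++⁻-pairs (x ∷ xs) (p ∷ ps) with ++⁻-pairs xs ps
... | q , r , t = Allₚ.++⁻ˡ xs p ∷ q , r , Allₚ.++⁻ʳ xs p ∷ t

pair⊆ : ∀ {A : Set} {R : A → A → Set} {xs a b} → AllPairs R xs → a ∷ b ∷ [] ⊆ xs → R a b
pair⊆ (p ∷ ps) (_ ∷ˢ s) = pair⊆ ps s
pair⊆ (p ∷ ps) (refl ∷ s) = All.lookup p (to∈ s)

pairs⁺ : ∀ {A : Set} {R : A → A → Set} xs → (∀ {a b} → a ∷ b ∷ [] ⊆ xs → R a b) → AllPairs R xs
pairs⁺ [] f = []
pairs⁺ (x ∷ xs) f = All.tabulate (λ i → f (refl ∷ from∈ i)) ∷ pairs⁺ xs (λ s → f (_ ∷ˢ s))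

cut : ∀ {A : Set} xs {ys zs : List A} → zs ⊆ xs ++ ys →
      ∃₂ λ zs₁ zs₂ → zs₁ ++ zs₂ ≡ zs × zs₁ ⊆ xs × zs₂ ⊆ ys
cut [] s = [] , _ , refl , [] , s
cut (x ∷ xs) (.x ∷ˢ s) with cut xs s
... | a , b , e , p , q = a , b , e , x ∷ˢ p , q
cut (x ∷ xs) (refl ∷ s) with cut xs s
... | a , b , e , p , q = x ∷ a , b , cong (x ∷_) e , refl ∷ p , q

∈⊆ : ∀ {A : Set} {x : A} {xs ys} → x ∈ xs → xs ⊆ ys → x ∈ ys
∈⊆ i s = lookup s i

Desc⇒Unique : ∀ {xs} → Desc xs → Unique xs
Desc⇒Unique = AllPairs.map (λ { p refl → <-irrefl refl p })

asc? : ∀ {xs} → Unique xs → (∃₂ λ a b → a ∷ b ∷ [] ⊆ xs × a < b) ⊎ Desc xs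
asc? [] = inj₂ []
asc? {x ∷ xs} (ne ∷ u) with asc? u
... | inj₁ (a , b , s , l) = inj₁ (a , b , x ∷ˢ s , l)
... | inj₂ d with All.all? (_<? x) xs
... | yes p = inj₂ (p ∷ d)
... | no ¬p with larger xs ne ¬p
  where
  larger : ∀ ys → All (x ≢_) ys → ¬ All (_< x) ys → ∃ λ y → y ∈ ys × x < y
  larger [] _ n = ⊥-elim (n [])
  larger (y ∷ ys) (e ∷ es) n with <-cmp x y
  ... | tri< l _ _ = y , here refl , l
  ... | tri≈ _ q _ = ⊥-elim (e q)
  ... | tri> _ _ g with larger ys es (n ∘ (g ∷_))
  ... | z , i , l = z , there i , l
... | y , i , l = inj₁ (x , y , refl ∷ from∈ i , l)

Unique-resp-↭ : ∀ {A : Set} {xs ys : List A} → xs ↭ ys → Unique xs → Unique ys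
Unique-resp-↭ {ys = []} p u = []
Unique-resp-↭ {A} {xs} {ys = y ∷ ys} p u with ∈-∃++ (∈-resp-↭ (↭-sym p) (here refl))
... | as , bs , refl with ++⁻-pairs as u
... | ua , (ne ∷ ub) , d =
  All.tabulate fresh ∷ Unique-resp-↭ q (AllPairsₚ.++⁺ ua ub (All.map (λ { (_ ∷ r) → r }) d))
  where
  q : as ++ bs ↭ ys
  q = drop-mid as [] p
  fresh : ∀ {z} → z ∈ ys → y ≢ z
  fresh i refl with ∈-++⁻ as (∈-resp-↭ (↭-sym q) i)
  ... | inj₁ j = All.head (All.lookup d j) refl
  ... | inj₂ j = All.lookup ne j refl

-- Decreasing lists act as canonical finite sets: a cut of S into blocks is established by showing
-- that the concatenated blocks decrease and have the same entries as S.
Desc-↭⇒≡ : ∀ {xs ys} → Desc xs → Desc ys → xs ↭ ys → xs ≡ ys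
Desc-↭⇒≡ {[]} {[]} _ _ _ = refl
Desc-↭⇒≡ {[]} {y ∷ ys} _ _ p with () ← ↭-length p
Desc-↭⇒≡ {x ∷ xs} {[]} _ _ p with () ← ↭-length p
Desc-↭⇒≡ {x ∷ xs} {y ∷ ys} (a ∷ as) (b ∷ bs) p with same
  where
  same : x ≡ y
  same with ∈-resp-↭ p (here refl) | ∈-resp-↭ (↭-sym p) (here refl)
  ... | here e | _ = e
  ... | there _ | here e = sym e
  ... | there i | there j = ⊥-elim (<-asym (All.lookup a j) (All.lookup b i))
... | refl = cong (x ∷_) (Desc-↭⇒≡ as bs (drop-∷ p))

-- Both factorizations cut at the first entry that fails `B`. With `B = (_≢ q)` this recovers the
-- place of a marked entry q.
span-≡ : ∀ {A : Set} {B : A → Set} xs xs' {y y' ys ys'} → All B xs → All B xs' → ¬ B y → ¬ B y' →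
         xs ++ y ∷ ys ≡ xs' ++ y' ∷ ys' → xs ≡ xs' × y ≡ y' × ys ≡ ys'
span-≡ [] [] _ _ _ _ refl = refl , refl , refl
span-≡ [] (x ∷ _) _ (b ∷ _) n _ refl = ⊥-elim (n b)
span-≡ (x ∷ _) [] (b ∷ _) _ _ n refl = ⊥-elim (n b)
span-≡ (x ∷ xs) (_ ∷ xs') (_ ∷ p) (_ ∷ p') n n' e with ∷-injective e
... | refl , e' with span-≡ xs xs' p p' n n' e'
... | refl , r = refl , r

split-≡ : ∀ {A : Set} {B : A → Set} xs xs' {ys ys'} → All B xs → All B xs' → All (¬_ ∘ B) ys → All (¬_ ∘ B) ys' →
          xs ++ ys ≡ xs' ++ ys' → xs ≡ xs' × ys ≡ ys'
split-≡ [] [] _ _ _ _ e = refl , e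
split-≡ [] (x ∷ _) _ (b ∷ _) (n ∷ _) _ refl = ⊥-elim (n b)
split-≡ (x ∷ _) [] (b ∷ _) _ _ (n ∷ _) refl = ⊥-elim (n b)
split-≡ (x ∷ xs) (_ ∷ xs') (_ ∷ p) (_ ∷ p') n n' e with ∷-injective e
... | refl , e' with split-≡ xs xs' p p' n n' e'
... | refl , r = refl , r

-- Permutations avoiding 123

Perm : ℕ → List ℕ → Set
Perm n xs = xs ↭ downFrom n

Av123 : List ℕ → Set
Av123 xs = ∀ {a b c} → a ∷ b ∷ c ∷ [] ⊆ xs → a < b → b < c → ⊥

Perm-< : ∀ {n xs x} → Perm n xs → x ∈ xs → x < n
Perm-< p i = ∈-downFrom⁻ (∈-resp-↭ p i)

Perm-unique : ∀ {n xs} → Perm n xs → Unique xs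
Perm-unique {n} p = Unique-resp-↭ (↭-sym p) (downFrom⁺ n)

Perm-insert : ∀ {n} xs {ys} → Perm n (xs ++ ys) → Perm (suc n) (xs ++ n ∷ ys)
Perm-insert {n} xs {ys} p = ↭-trans (shift n xs ys) (prep n p)

Perm-remove : ∀ {n ρ} → Perm (suc n) ρ → ∃₂ λ xs ys → ρ ≡ xs ++ n ∷ ys × Perm n (xs ++ ys)
Perm-remove {n} p with ∈-∃++ (∈-resp-↭ (↭-sym p) (here refl))
... | xs , ys , refl = xs , ys , refl , drop-mid xs [] p

Perm-∉ˡ : ∀ {n} xs {ys} → Perm n (xs ++ ys) → All (_≢ n) xs
Perm-∉ˡ xs p = All.tabulate (λ { i refl → <-irrefl refl (Perm-< p (∈-++⁺ˡ i)) })

skip-mid : ∀ {x : ℕ} xs {ys} → xs ++ ys ⊆ xs ++ x ∷ ys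
skip-mid xs = ++⁺ (⊆-refl {x = xs}) (_ ∷ˢ ⊆-refl)

Unique-asc⊎desc : ∀ {xs a b} → Unique xs → a ∷ b ∷ [] ⊆ xs → a < b ⊎ b < a
Unique-asc⊎desc {a = a} {b} u s with <-cmp a b
... | tri< l _ _ = inj₁ l
... | tri≈ _ e _ = ⊥-elim (pair⊆ u s e)
... | tri> _ _ g = inj₂ g

desc-from : ∀ {xs} → Unique xs → (∀ {a b} → a ∷ b ∷ [] ⊆ xs → ¬ a < b) → Desc xs
desc-from {xs} u f = pairs⁺ xs g
  where
  g : ∀ {a b} → a ∷ b ∷ [] ⊆ xs → a > b
  g s with Unique-asc⊎desc u s
  ... | inj₁ l = ⊥-elim (f s l)
  ... | inj₂ l = l

-- The maximum can only be the last term of a 123, and that takes an ascent in front of it.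
Av123-insert : ∀ {n} xs {ys} → (∀ {x} → x ∈ xs ++ ys → x < n) → Desc xs → Av123 (xs ++ ys) → Av123 (xs ++ n ∷ ys)
Av123-insert {n} xs {ys} <n d av s a<b b<c with cut xs s
... | zs , _ , e , p , (_ ∷ˢ q) = av (subst (_⊆ xs ++ ys) e (++⁺ p q)) a<b b<c
... | [] , _ , refl , p , (refl ∷ q) = <-asym a<b (<n (∈-++⁺ʳ xs (to∈ (⊆-trans (refl ∷ minimum _) q))))
... | a ∷ [] , _ , refl , p , (refl ∷ q) = <-asym b<c (<n (∈-++⁺ʳ xs (to∈ q)))
... | a ∷ b ∷ [] , _ , refl , p , (refl ∷ q) = <-asym a<b (pair⊆ d p)
... | a ∷ b ∷ c ∷ [] , _ , () , p , (refl ∷ q)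
... | a ∷ b ∷ c ∷ d ∷ _ , _ , () , p , (refl ∷ q)

Av123-remove : ∀ {n} xs {ys} → Perm n (xs ++ ys) → Av123 (xs ++ n ∷ ys) → Desc xs × Av123 (xs ++ ys)
Av123-remove {n} xs {ys} perm av =
  desc-from (proj₁ (++⁻-pairs xs (Perm-unique perm)))
    (λ s a<b → av (++⁺ s (refl ∷ minimum ys)) a<b (Perm-< perm (∈-++⁺ˡ (to∈ (⊆-trans (_ ∷ˢ ⊆-refl) s)))))
  , λ s → av (⊆-trans s (skip-mid xs))

DescPrefix : ℕ → List ℕ → Set
DescPrefix d ρ = ∃₂ λ xs ys → ρ ≡ xs ++ ys × length xs ≡ d × Desc xs

-- These are the avoiders in which a new maximum may be inserted directly behind the first d
-- entries.
AvPre : ℕ → ℕ → List ℕ → Set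
AvPre n d ρ = Perm n ρ × Av123 ρ × DescPrefix d ρ

-- Equivalently, the 123-avoiders of size `suc n` whose maximum is preceded by at least d entries,
-- described by what remains when the maximum is removed.
AvIns : ℕ → ℕ → List ℕ → Set
AvIns n d ρ = ∃₂ λ xs ys → ρ ≡ xs ++ n ∷ ys × Perm n (xs ++ ys) × Av123 (xs ++ ys) × Desc xs × d ≤ length xs

++-length-≡ : ∀ {A : Set} (xs xs' : List A) {ys ys'} → length xs ≡ length xs' → xs ++ ys ≡ xs' ++ ys' → xs ≡ xs' × ys ≡ ys'
++-length-≡ [] [] _ e = refl , e
++-length-≡ (x ∷ xs) (x' ∷ xs') l e with ∷-injective e
... | refl , e' with ++-length-≡ xs xs' (suc-injective l) e'
... | refl , r = refl , r

take-prefix : ∀ {A : Set} {d} xs → d ≤ length xs → ∃₂ λ (us vs : List A) → xs ≡ us ++ vs × length us ≡ d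
take-prefix {d = zero} xs _ = [] , xs , refl , refl
take-prefix {d = suc d} (x ∷ xs) (s≤s l) with take-prefix xs l
... | us , vs , refl , e = x ∷ us , vs , refl , cong suc e

≡⊎< : ∀ {m n} → m ≤ n → n ≡ m ⊎ suc m ≤ n
≡⊎< l with m≤n⇒m<n∨m≡n l
... | inj₁ p = inj₂ p
... | inj₂ e = inj₁ (sym e)

prefix-of : ∀ {A : Set} (us : List A) {vs xs ys z} → us ++ vs ≡ xs ++ z ∷ ys → length us ≤ length xs → ∃ λ ws → xs ≡ us ++ ws
prefix-of [] e l = _ , refl
prefix-of (u ∷ us) {xs = x ∷ xs} e (s≤s l) with ∷-injective e
... | refl , e' with prefix-of us e' l
... | ws , refl = ws , refl

enum-ins : ∀ {n d m k} → Enum (AvPre n d) m → Enum (AvIns n (suc d)) k → Enum (AvIns n d) (m + k)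
enum-ins {n} {d} ep ei = enum-cong to from (enum-⊎ disj (enum-rel R total fun inj ep) ei)
  where
  R : List ℕ → List ℕ → Set
  R σ ρ = ∃₂ λ xs ys → σ ≡ xs ++ ys × length xs ≡ d × Desc xs × ρ ≡ xs ++ n ∷ ys
  total : ∀ {σ} → AvPre n d σ → ∃ (R σ)
  total (_ , _ , xs , ys , e , l , dx) = _ , xs , ys , e , l , dx , refl
  fun : ∀ {σ ρ ρ'} → AvPre n d σ → R σ ρ → R σ ρ' → ρ ≡ ρ'
  fun _ (xs , ys , refl , l , _ , refl) (xs' , ys' , e , l' , _ , refl) with ++-length-≡ xs xs' (trans l (sym l')) e
  ... | refl , refl = refl
  inj : ∀ {σ σ' ρ} → AvPre n d σ → AvPre n d σ' → R σ ρ → R σ' ρ → σ ≡ σ'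
  inj _ _ (xs , ys , refl , l , _ , refl) (xs' , ys' , refl , l' , _ , e) with ++-length-≡ xs xs' (trans l (sym l')) e
  ... | refl , refl = refl
  disj : ∀ {ρ} → (∃ λ σ → AvPre n d σ × R σ ρ) → AvIns n (suc d) ρ → ⊥
  disj (_ , (p , _) , xs , ys , refl , refl , _ , refl) (xs' , ys' , e , p' , _ , _ , l) with span-≡ xs xs' (Perm-∉ˡ xs p) (Perm-∉ˡ xs' p') (λ n → n refl) (λ n → n refl) e
  ... | refl , _ = <-irrefl refl l
  to : ∀ {ρ} → (∃ λ σ → AvPre n d σ × R σ ρ) ⊎ AvIns n (suc d) ρ → AvIns n d ρ
  to (inj₁ (_ , (p , av , _) , xs , ys , refl , refl , dx , refl)) = xs , ys , refl , p , av , dx , ≤-refl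
  to (inj₂ (xs , ys , e , p , av , dx , l)) = xs , ys , e , p , av , dx , <⇒≤ l
  from : ∀ {ρ} → AvIns n d ρ → (∃ λ σ → AvPre n d σ × R σ ρ) ⊎ AvIns n (suc d) ρ
  from (xs , ys , e , p , av , dx , l) with ≡⊎< l
  ... | inj₁ q = inj₁ (xs ++ ys , (p , av , xs , ys , refl , q , dx) , xs , ys , refl , q , dx , e)
  ... | inj₂ q = inj₂ (xs , ys , e , p , av , dx , q)

-- Either n comes first and the next d entries decrease, or n stands behind the whole decreasing
-- prefix. The total is the same m + k as in `enum-ins`, which is why `pre# r (suc d)` may be
-- defined as `ins# r d`.
enum-pre : ∀ {n d m k} → Enum (AvPre n d) m → Enum (AvIns n (suc d)) k → Enum (AvPre (suc n) (suc d)) (m + k)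
enum-pre {n} {d} ep ei = enum-cong to from (enum-⊎ disj (enum-map {Q = λ ρ → ∃ λ σ → AvPre n d σ × ρ ≡ n ∷ σ} (n ∷_) (λ p → _ , p , refl) (λ q → q) (λ _ _ → ∷-injectiveʳ) ep) ei)
  where
  disj : ∀ {ρ} → (∃ λ σ → AvPre n d σ × ρ ≡ n ∷ σ) → AvIns n (suc d) ρ → ⊥
  disj (_ , _ , refl) (x ∷ xs , _ , refl , p , _) = <-irrefl refl (Perm-< p (here refl))
  to : ∀ {ρ} → (∃ λ σ → AvPre n d σ × ρ ≡ n ∷ σ) ⊎ AvIns n (suc d) ρ → AvPre (suc n) (suc d) ρ
  to (inj₁ (_ , (p , av , xs , ys , refl , l , dx) , refl)) =
    Perm-insert [] p , Av123-insert [] (Perm-< p) [] av ,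
    n ∷ xs , ys , refl , cong suc l , All.tabulate (λ i → Perm-< p (∈-++⁺ˡ i)) ∷ dx
  to (inj₂ (xs , ys , refl , p , av , dx , l)) with take-prefix xs l
  ... | us , vs , e , l' = Perm-insert xs p , Av123-insert xs (Perm-< p) dx av ,
    us , vs ++ n ∷ ys , trans (cong (_++ n ∷ ys) e) (++-assoc us vs _) , l' , proj₁ (++⁻-pairs us (subst Desc e dx))
  from : ∀ {ρ} → AvPre (suc n) (suc d) ρ → (∃ λ σ → AvPre n d σ × ρ ≡ n ∷ σ) ⊎ AvIns n (suc d) ρ
  from {ρ} (p , av , us , vs , e , l , du) with Perm-remove {n} p
  from (p , av , [] , vs , e , () , du) | _
  from (p , av , u ∷ us , vs , e , l , _ ∷ du) | [] , ys , refl , p' =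
    inj₁ (ys , (p' , proj₂ (Av123-remove [] p' av) , us , vs , ∷-injectiveʳ e , suc-injective l , du) , refl)
  from (p , av , u ∷ us , vs , e , l , u> ∷ _) | x ∷ xs , ys , refl , p' with Av123-remove (x ∷ xs) p' av
  ... | dx , av' = inj₂ (x ∷ xs , ys , refl , p' , av' , dx , subst (_≤ length (x ∷ xs)) l (long (u ∷ us) (x ∷ xs) below (sym e)))
    where
    u<n : u < n
    u<n = subst (_< n) (∷-injectiveˡ e) (Perm-< p' (here refl))
    below : All (_< n) (u ∷ us)
    below = u<n ∷ All.map (λ v<u → <-trans v<u u<n) u>
    long : ∀ us xs {vs ys} → All (_< n) us → us ++ vs ≡ xs ++ n ∷ ys → length us ≤ length xs
    long [] xs _ _ = z≤n
    long (u ∷ us) [] (l ∷ _) refl = ⊥-elim (<-irrefl refl l)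
    long (u ∷ us) (x ∷ xs) (_ ∷ b) e = s≤s (long us xs b (∷-injectiveʳ e))

-- The size is n = r + d. Taking the slack r as the parameter makes the recursion structural and
-- leaves out the empty sets with d > n.
ins# pre# : ℕ → ℕ → ℕ
ins# zero d = pre# zero d + 0
ins# (suc r) d = pre# (suc r) d + ins# r (suc d)
pre# zero zero = 1
pre# (suc r) zero = ins# r zero
pre# r (suc d) = ins# r d

AvIns-∅ : ∀ {n ρ} → ¬ AvIns n (suc n) ρ
AvIns-∅ {n} (xs , ys , _ , p , _ , _ , l) =
  <-irrefl refl (≤-trans l (≤-trans (m≤m+n (length xs) (length ys)) (≤-reflexive (trans (sym (length-++ xs)) (trans (↭-length p) (length-downFrom n))))))

enum-AvIns : ∀ r d {n} → n ≡ r + d → Enum (AvIns n d) (ins# r d)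
enum-AvPre : ∀ r d {n} → n ≡ r + d → Enum (AvPre n d) (pre# r d)
enum-AvIns zero d refl = enum-ins (enum-AvPre zero d refl) (enum-∅ AvIns-∅)
enum-AvIns (suc r) d refl = enum-ins (enum-AvPre (suc r) d refl) (enum-AvIns r (suc d) (sym (+-suc r d)))
enum-AvPre zero zero refl = enum-singleton [] (↭-refl , (λ { () }) , [] , [] , refl , refl , []) (λ (p , _) → ↭-empty-inv p)
enum-AvPre (suc r) zero {suc n} refl = enum-cong to from (enum-AvIns r zero refl)
  where
  to : ∀ {ρ} → AvIns n 0 ρ → AvPre (suc n) 0 ρ
  to (xs , ys , refl , p , av , dx , _) = Perm-insert xs p , Av123-insert xs (Perm-< p) dx av , [] , _ , refl , refl , []
  from : ∀ {ρ} → AvPre (suc n) 0 ρ → AvIns n 0 ρ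
  from (p , av , _) with Perm-remove {n} p
  ... | xs , ys , refl , p' with Av123-remove xs p' av
  ... | dx , av' = xs , ys , refl , p' , av' , dx , z≤n
enum-AvPre zero (suc d) refl = enum-pre (enum-AvPre zero d refl) (enum-∅ AvIns-∅)
enum-AvPre (suc r) (suc d) {suc n} e =
  enum-pre (enum-AvPre (suc r) d (trans (suc-injective e) (+-suc r d))) (enum-AvIns r (suc d) (suc-injective e))

enum-Av123 : ∀ n → Enum (λ ρ → Perm (suc n) ρ × Av123 ρ) (ins# n 0)
enum-Av123 n = enum-cong {P = AvPre (suc n) 0} (λ (p , av , _) → p , av) (λ (p , av) → p , av , [] , _ , refl , refl , [])
  (enum-AvPre (suc n) 0 (cong suc (sym (+-identityʳ n))))

-- Ballot numbers and the Catalan formula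

bin : ℕ → ℕ → ℕ
bin n zero = 1
bin zero (suc k) = 0
bin (suc n) (suc k) = bin n k + bin n (suc k)

nC0≡1 : ∀ n → n C 0 ≡ 1
nC0≡1 n = trans (nCk≡nC[n∸k] {0} {n} z≤n) (nCn≡1 n)

bin≡C : ∀ n k → bin n k ≡ n C k
bin≡C n zero = sym (nC0≡1 n)
bin≡C zero (suc k) = sym (k>n⇒nCk≡0 (s≤s (z≤n {k})))
bin≡C (suc n) (suc k) = trans (cong₂ _+_ (bin≡C n k) (bin≡C n (suc k))) (nCk+nC[k+1]≡[n+1]C[k+1] n k)

-- The absorption rule (k + 1) C(n, k + 1) = (n - k) C(n, k), with the subtraction moved across.
bin-absorb : ∀ n k → suc k * bin n (suc k) + k * bin n k ≡ n * bin n k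
bin-absorb zero zero = refl
bin-absorb zero (suc k) = cong₂ _+_ (*-zeroʳ (suc (suc k))) (*-zeroʳ (suc k))
bin-absorb (suc n) zero = trans (ring₁ (bin n 1)) (trans (cong suc (bin-absorb n 0)) refl)
  where
  ring₁ : ∀ b → 1 * (1 + b) + 0 ≡ suc (1 * b + 0 * 1)
  ring₁ = solve-∀
bin-absorb (suc n) (suc k) = begin
  suc (suc k) * (b₁ + b₂) + suc k * (b₀ + b₁)                               ≡⟨ ring₁ k b₀ b₁ b₂ ⟩
  (suc (suc k) * b₂ + suc k * b₁) + (suc k * b₁ + k * b₀) + (b₀ + b₁)      ≡⟨ cong₂ (λ u v → u + v + (b₀ + b₁)) (bin-absorb n (suc k)) (bin-absorb n k) ⟩
  n * b₁ + n * b₀ + (b₀ + b₁)                                               ≡⟨ ring₂ n b₀ b₁ ⟩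
  suc n * (b₀ + b₁)                                                         ∎
  where
  open ≡-Reasoning
  b₀ = bin n k
  b₁ = bin n (suc k)
  b₂ = bin n (suc (suc k))
  ring₁ : ∀ k b₀ b₁ b₂ → suc (suc k) * (b₁ + b₂) + suc k * (b₀ + b₁) ≡
          (suc (suc k) * b₂ + suc k * b₁) + (suc k * b₁ + k * b₀) + (b₀ + b₁)
  ring₁ = solve-∀
  ring₂ : ∀ n b₀ b₁ → n * b₁ + n * b₀ + (b₀ + b₁) ≡ suc n * (b₀ + b₁)
  ring₂ = solve-∀

bin-middle : ∀ n → bin (suc (2 * n)) (suc n) ≡ bin (suc (2 * n)) n
bin-middle n = *-cancelˡ-≡ _ _ (suc n) (+-cancelʳ-≡ (n * b) _ _ (trans (bin-absorb (suc (2 * n)) n) (ring n b)))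
  where
  b = bin (suc (2 * n)) n
  ring : ∀ n b → suc (2 * n) * b ≡ suc n * b + n * b
  ring = solve-∀

-- Plays the role of C(n, k - 1). The count `ins# r d` turns out to be the ballot number C(m, r) -
-- C(m, r - 1) with m = 2r + d + 1, stated below as a sum in order to stay in ℕ.
bin-below : ℕ → ℕ → ℕ
bin-below n zero = 0
bin-below n (suc k) = bin n k

pascal : ∀ n k → bin (suc n) k ≡ bin-below n k + bin n k
pascal n zero = refl
pascal n (suc k) = refl

ins#-0 : ∀ d → ins# 0 d ≡ 1
ins#-0 zero = refl
ins#-0 (suc d) = trans (+-identityʳ _) (ins#-0 d)

ins#-ballot : ∀ r d {m} → m ≡ suc (2 * r + d) → ins# r d + bin-below m r ≡ bin m r
ins#-ballot zero d _ = trans (+-identityʳ _) (ins#-0 d)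
ins#-ballot (suc r) zero refl = subst (λ m → ins# (suc r) 0 + bin-below m (suc r) ≡ bin m (suc r)) (sym (ring₀ r)) step
  where
  open ≡-Reasoning
  M = suc (2 * r)
  ring₀ : ∀ r → suc (2 * suc r + 0) ≡ suc (suc (suc (2 * r)))
  ring₀ = solve-∀
  i₀ = ins# r 0
  i₁ = ins# r 1
  ring₁ : ∀ i₀ i₁ s t u → i₀ + i₁ + (s + (t + u)) ≡ (i₁ + s) + (i₀ + t) + u
  ring₁ = solve-∀
  ring₂ : ∀ c a → c + a + a ≡ c + (a + a)
  ring₂ = solve-∀
  step : i₀ + i₁ + bin (suc (suc M)) r ≡ bin (suc M) r + (bin M r + bin M (suc r))
  step = begin
    i₀ + i₁ + bin (suc (suc M)) r                                              ≡⟨ cong (i₀ + i₁ +_) (trans (pascal (suc M) r) (cong (bin-below (suc M) r +_) (pascal M r))) ⟩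
    i₀ + i₁ + (bin-below (suc M) r + (bin-below M r + bin M r))                ≡⟨ ring₁ i₀ i₁ (bin-below (suc M) r) (bin-below M r) (bin M r) ⟩
    (i₁ + bin-below (suc M) r) + (i₀ + bin-below M r) + bin M r                ≡⟨ cong₂ (λ u v → u + v + bin M r) (ins#-ballot r 1 (cong suc (+-comm 1 (2 * r)))) (ins#-ballot r 0 (cong suc (sym (+-identityʳ _)))) ⟩
    bin (suc M) r + bin M r + bin M r                                          ≡⟨ ring₂ (bin (suc M) r) (bin M r) ⟩
    -- For d = 0 the recurrence has `ins# r 0` in place of a count with first index `suc r`. The two
    -- middle entries of the odd row `M` agree, and this makes up for the difference.
    bin (suc M) r + (bin M r + bin M r)                                        ≡⟨ cong (λ u → bin (suc M) r + (bin M r + u)) (sym (bin-middle r)) ⟩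
    bin (suc M) r + (bin M r + bin M (suc r))                                  ∎
ins#-ballot (suc r) (suc d) refl = subst (λ m → ins# (suc r) (suc d) + bin-below m (suc r) ≡ bin m (suc r)) (sym (ring₀ r d)) (step (ins#-ballot r (suc (suc d)) (ring₁ r d)) (ins#-ballot (suc r) d refl))
  where
  open ≡-Reasoning
  M = suc (2 * suc r + d)
  ring₀ : ∀ r d → suc (2 * suc r + suc d) ≡ suc (suc (2 * suc r + d))
  ring₀ = solve-∀
  ring₁ : ∀ r d → suc (2 * suc r + d) ≡ suc (2 * r + suc (suc d))
  ring₁ = solve-∀
  i₁ = ins# (suc r) d
  i₂ = ins# r (suc (suc d))
  ring₂ : ∀ i₁ i₂ s t → i₁ + i₂ + (s + t) ≡ (i₂ + s) + (i₁ + t)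
  ring₂ = solve-∀
  step : i₂ + bin-below M r ≡ bin M r → i₁ + bin-below M (suc r) ≡ bin M (suc r) →
         i₁ + i₂ + bin (suc M) r ≡ bin M r + bin M (suc r)
  step p q = begin
    i₁ + i₂ + bin (suc M) r                  ≡⟨ cong (i₁ + i₂ +_) (pascal M r) ⟩
    i₁ + i₂ + (bin-below M r + bin M r)      ≡⟨ ring₂ i₁ i₂ (bin-below M r) (bin M r) ⟩
    (i₂ + bin-below M r) + (i₁ + bin M r)    ≡⟨ cong₂ _+_ p q ⟩
    bin M r + bin M (suc r)                  ∎

ins#-catalan : ∀ n → ins# n 0 ≡ ((2 * suc n) C suc n) / suc (suc n)
ins#-catalan n = trans (sym (m*n/n≡m c (suc (suc n)))) (cong (_/ suc (suc n)) (trans (*-comm c (suc (suc n))) (trans times (bin≡C N (suc n)))))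
  where
  open ≡-Reasoning
  c = ins# n 0
  N = 2 * suc n
  M = suc (2 * n)
  N≡ : N ≡ suc M
  N≡ = ring n
    where
    ring : ∀ n → 2 * suc n ≡ suc (suc (2 * n))
    ring = solve-∀
  absorb : suc n * bin N (suc n) ≡ suc (suc n) * bin N n
  absorb = +-cancelʳ-≡ (n * bin N n) _ _ (trans (bin-absorb N n) (ring n (bin N n)))
    where
    ring : ∀ n b → 2 * suc n * b ≡ suc (suc n) * b + n * b
    ring = solve-∀
  ballot : c + bin N n ≡ bin N (suc n)
  ballot = begin
    c + bin N n                          ≡⟨ cong (λ m → c + bin m n) N≡ ⟩
    c + bin (suc M) n                    ≡⟨ cong (c +_) (pascal M n) ⟩
    c + (bin-below M n + bin M n)        ≡⟨ sym (+-assoc c _ _) ⟩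
    c + bin-below M n + bin M n          ≡⟨ cong₂ _+_ (ins#-ballot n 0 (cong suc (sym (+-identityʳ _)))) (sym (bin-middle n)) ⟩
    bin M n + bin M (suc n)              ≡⟨ cong (λ m → bin m (suc n)) (sym N≡) ⟩
    bin N (suc n)                        ∎
  -- By `absorb`, the subtracted C(N, n) is (n + 1)/(n + 2) of the central coefficient C(N, n + 1),
  -- so the difference c is 1/(n + 2) of it.
  times : suc (suc n) * c ≡ bin N (suc n)
  times = +-cancelʳ-≡ (suc n * bin N (suc n)) _ _ (begin
    suc (suc n) * c + suc n * bin N (suc n)          ≡⟨ cong (suc (suc n) * c +_) absorb ⟩
    suc (suc n) * c + suc (suc n) * bin N n          ≡⟨ sym (*-distribˡ-+ (suc (suc n)) c _) ⟩
    suc (suc n) * (c + bin N n)                      ≡⟨ cong (suc (suc n) *_) ballot ⟩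
    suc (suc n) * bin N (suc n)                      ∎)

-- Shuffles

-- The word records which list each entry comes from. As an index it can be counted in place of the
-- shuffles themselves.
data Shuffle : List Bool → List ℕ → List ℕ → List ℕ → Set where
  []    : Shuffle [] [] [] []
  left  : ∀ {w us ls ps} x → Shuffle w us ls ps → Shuffle (true ∷ w) (x ∷ us) ls (x ∷ ps)
  right : ∀ {w us ls ps} x → Shuffle w us ls ps → Shuffle (false ∷ w) us (x ∷ ls) (x ∷ ps)

shuffle-↭ : ∀ {w us ls ps} → Shuffle w us ls ps → us ++ ls ↭ ps
shuffle-↭ [] = ↭-refl
shuffle-↭ (left x s) = prep x (shuffle-↭ s)
shuffle-↭ {us = us} (right x s) = ↭-trans (shift x us _) (prep x (shuffle-↭ s))

shuffle-⊆ˡ : ∀ {w us ls ps} → Shuffle w us ls ps → us ⊆ ps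
shuffle-⊆ˡ [] = []
shuffle-⊆ˡ (left x s) = refl ∷ shuffle-⊆ˡ s
shuffle-⊆ˡ (right x s) = x ∷ˢ shuffle-⊆ˡ s

shuffle-⊆ʳ : ∀ {w us ls ps} → Shuffle w us ls ps → ls ⊆ ps
shuffle-⊆ʳ [] = []
shuffle-⊆ʳ (left x s) = x ∷ˢ shuffle-⊆ʳ s
shuffle-⊆ʳ (right x s) = refl ∷ shuffle-⊆ʳ s

shuffle-∈ : ∀ {w us ls ps x} → Shuffle w us ls ps → x ∈ ps → x ∈ us ⊎ x ∈ ls
shuffle-∈ {us = us} s i = ∈-++⁻ us (∈-resp-↭ (↭-sym (shuffle-↭ s)) i)

shuffle-pair : ∀ {w us ls ps a b} → Shuffle w us ls ps → a ∷ b ∷ [] ⊆ ps →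
               (a ∷ b ∷ [] ⊆ us ⊎ a ∷ b ∷ [] ⊆ ls) ⊎ ((a ∈ us × b ∈ ls) ⊎ (a ∈ ls × b ∈ us))
shuffle-pair (left x s) (.x ∷ˢ i) with shuffle-pair s i
... | inj₁ (inj₁ j) = inj₁ (inj₁ (x ∷ˢ j))
... | inj₁ (inj₂ j) = inj₁ (inj₂ j)
... | inj₂ (inj₁ (j , k)) = inj₂ (inj₁ (there j , k))
... | inj₂ (inj₂ (j , k)) = inj₂ (inj₂ (j , there k))
shuffle-pair (left x s) (refl ∷ i) with shuffle-∈ s (to∈ i)
... | inj₁ j = inj₁ (inj₁ (refl ∷ from∈ j))
... | inj₂ j = inj₂ (inj₁ (here refl , j))
shuffle-pair (right x s) (.x ∷ˢ i) with shuffle-pair s i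
... | inj₁ (inj₁ j) = inj₁ (inj₁ j)
... | inj₁ (inj₂ j) = inj₁ (inj₂ (x ∷ˢ j))
... | inj₂ (inj₁ (j , k)) = inj₂ (inj₁ (j , there k))
... | inj₂ (inj₂ (j , k)) = inj₂ (inj₂ (there j , k))
shuffle-pair (right x s) (refl ∷ i) with shuffle-∈ s (to∈ i)
... | inj₁ j = inj₂ (inj₂ (here refl , j))
... | inj₂ j = inj₁ (inj₂ (refl ∷ from∈ j))

shuffle-word : ∀ {w w' us ls ps} → (∀ {x} → x ∈ us → x ∈ ls → ⊥) → Shuffle w us ls ps → Shuffle w' us ls ps → w ≡ w'
shuffle-word d [] [] = refl
shuffle-word d (left x s) (left .x s') = cong (true ∷_) (shuffle-word (λ i → d (there i)) s s')
shuffle-word d (left x s) (right .x s') = ⊥-elim (d (here refl) (here refl))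
shuffle-word d (right x s) (left .x s') = ⊥-elim (d (here refl) (here refl))
shuffle-word d (right x s) (right .x s') = cong (false ∷_) (shuffle-word (λ i j → d i (there j)) s s')

shuffle-result : ∀ {w us ls ps ps'} → Shuffle w us ls ps → Shuffle w us ls ps' → ps ≡ ps'
shuffle-result [] [] = refl
shuffle-result (left x s) (left .x s') = cong (x ∷_) (shuffle-result s s')
shuffle-result (right x s) (right .x s') = cong (x ∷_) (shuffle-result s s')

shuffle-parts : ∀ {w us us' ls ls' ps} → Shuffle w us ls ps → Shuffle w us' ls' ps → us ≡ us' × ls ≡ ls'
shuffle-parts [] [] = refl , refl
shuffle-parts (left x s) (left .x s') with shuffle-parts s s'
... | refl , refl = refl , refl
shuffle-parts (right x s) (right .x s') with shuffle-parts s s'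
... | refl , refl = refl , refl

trues falses : List Bool → ℕ
trues [] = 0
trues (true ∷ w) = suc (trues w)
trues (false ∷ w) = trues w
falses [] = 0
falses (true ∷ w) = falses w
falses (false ∷ w) = suc (falses w)

trues+falses : ∀ w → trues w + falses w ≡ length w
trues+falses [] = refl
trues+falses (true ∷ w) = cong suc (trues+falses w)
trues+falses (false ∷ w) = trans (+-suc (trues w) (falses w)) (cong suc (trues+falses w))

shuffle-trues : ∀ {w us ls ps} → Shuffle w us ls ps → length us ≡ trues w
shuffle-trues [] = refl
shuffle-trues (left x s) = cong suc (shuffle-trues s)
shuffle-trues (right x s) = shuffle-trues s

shuffle-falses : ∀ {w us ls ps} → Shuffle w us ls ps → length ls ≡ falses w
shuffle-falses [] = refl
shuffle-falses (left x s) = shuffle-falses s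
shuffle-falses (right x s) = cong suc (shuffle-falses s)

shuffle-length : ∀ {w us ls ps} → Shuffle w us ls ps → length ps ≡ length w
shuffle-length [] = refl
shuffle-length (left x s) = cong suc (shuffle-length s)
shuffle-length (right x s) = cong suc (shuffle-length s)

do-shuffle : ∀ w us ls → length us ≡ trues w → length ls ≡ falses w → ∃ (Shuffle w us ls)
do-shuffle [] [] [] _ _ = [] , []
do-shuffle (true ∷ w) (x ∷ us) ls p q with do-shuffle w us ls (suc-injective p) q
... | _ , s = _ , left x s
do-shuffle (false ∷ w) us (x ∷ ls) p q with do-shuffle w us ls p (suc-injective q)
... | _ , s = _ , right x s

un-shuffle : ∀ w ps → length w ≡ length ps → ∃₂ λ us ls → Shuffle w us ls ps
un-shuffle [] [] _ = [] , [] , []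
un-shuffle (true ∷ w) (x ∷ ps) e with un-shuffle w ps (suc-injective e)
... | _ , _ , s = _ , _ , left x s
un-shuffle (false ∷ w) (x ∷ ps) e with un-shuffle w ps (suc-injective e)
... | _ , _ , s = _ , _ , right x s

-- `HasFT` asks for a `false` somewhere before a `true`. In `Shuffled` this is an ascent of P; in
-- `Mid′`, where the shuffled result is a decreasing list, it is an entry of P above one of Q.
HasT HasFT : List Bool → Set
HasT [] = ⊥
HasT (true ∷ w) = ⊤
HasT (false ∷ w) = HasT w
HasFT [] = ⊥
HasFT (true ∷ w) = HasFT w
HasFT (false ∷ w) = HasT w

HasFT⇒HasT : ∀ w → HasFT w → HasT w
HasFT⇒HasT (true ∷ w) _ = tt
HasFT⇒HasT (false ∷ w) p = p

shuffle-HasT⁻ : ∀ {w us ls ps} → Shuffle w us ls ps → HasT w → us ≢ []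
shuffle-HasT⁻ (left x s) _ ()
shuffle-HasT⁻ (right x s) h = shuffle-HasT⁻ s h

shuffle-HasT⁺ : ∀ {w us ls ps u} → Shuffle w us ls ps → u ∈ us → HasT w
shuffle-HasT⁺ (left x s) _ = tt
shuffle-HasT⁺ (right x s) i = shuffle-HasT⁺ s i

≢[]⇒∈ : ∀ {A : Set} {xs : List A} → xs ≢ [] → ∃ (_∈ xs)
≢[]⇒∈ {xs = []} n = ⊥-elim (n refl)
≢[]⇒∈ {xs = x ∷ xs} _ = x , here refl

∈⇒≢[] : ∀ {A : Set} {x : A} {xs} → x ∈ xs → xs ≢ []
∈⇒≢[] () refl

shuffle-HasFT⁻ : ∀ {w us ls ps} → Shuffle w us ls ps → HasFT w → ∃₂ λ l u → l ∈ ls × u ∈ us × l ∷ u ∷ [] ⊆ ps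
shuffle-HasFT⁻ (left x s) h with shuffle-HasFT⁻ s h
... | l , u , i , j , k = l , u , i , there j , x ∷ˢ k
shuffle-HasFT⁻ (right x s) h with ≢[]⇒∈ (shuffle-HasT⁻ s h)
... | u , i = x , u , here refl , i , refl ∷ ⊆-trans (from∈ i) (shuffle-⊆ˡ s)

shuffle-HasFT⁺ : ∀ {w us ls ps l u} → Shuffle w us ls ps → (∀ {x} → x ∈ us → x ∈ ls → ⊥) → l ∈ ls → u ∈ us → l ∷ u ∷ [] ⊆ ps → HasFT w
shuffle-HasFT⁺ (left x s) d i j (refl ∷ k) = ⊥-elim (d (here refl) i)
shuffle-HasFT⁺ {u = u} (left x s) d i j (.x ∷ˢ k) with shuffle-∈ s (to∈ (⊆-trans (_ ∷ˢ ⊆-refl) k))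
... | inj₁ j' = shuffle-HasFT⁺ s (λ i → d (there i)) i j' k
... | inj₂ j' = ⊥-elim (d j j')
shuffle-HasFT⁺ (right x s) d i j _ = shuffle-HasT⁺ s j

enum-words : ∀ {Z : List Bool → Set} {n a b} →
             Enum (λ w → length w ≡ n × Z (true ∷ w)) a → Enum (λ w → length w ≡ n × Z (false ∷ w)) b →
             Enum (λ w → length w ≡ suc n × Z w) (a + b)
enum-words {Z} {n} ea eb = enum-cong to from
  (enum-⊎ disj (enum-map {Q = Q true} (true ∷_) (λ p → _ , refl , p) (λ { (_ , e , p) → _ , p , e }) (λ _ _ → ∷-injectiveʳ) ea)
               (enum-map {Q = Q false} (false ∷_) (λ p → _ , refl , p) (λ { (_ , e , p) → _ , p , e }) (λ _ _ → ∷-injectiveʳ) eb))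
  where
  Q : Bool → List Bool → Set
  Q b w' = ∃ λ w → w' ≡ b ∷ w × length w ≡ n × Z (b ∷ w)
  disj : ∀ {w} → Q true w → Q false w → ⊥
  disj (_ , refl , _) (_ , () , _)
  to : ∀ {w} → Q true w ⊎ Q false w → length w ≡ suc n × Z w
  to (inj₁ (_ , refl , l , z)) = cong suc l , z
  to (inj₂ (_ , refl , l , z)) = cong suc l , z
  from : ∀ {w} → length w ≡ suc n × Z w → Q true w ⊎ Q false w
  from {true ∷ w} (l , z) = inj₁ (w , refl , suc-injective l , z)
  from {false ∷ w} (l , z) = inj₂ (w , refl , suc-injective l , z)

-- In closed form 2ⁿ, 2ⁿ - 1 and 2ⁿ - 1 - n.
all# t# ft# : ℕ → ℕ
all# zero = 1
all# (suc n) = all# n + all# n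
t# zero = 0
t# (suc n) = all# n + t# n
ft# zero = 0
ft# (suc n) = ft# n + t# n

enum-all : ∀ n → Enum (λ w → length w ≡ n × ⊤) (all# n)
enum-all zero = enum-singleton [] (refl , tt) λ { {[]} _ → refl }
enum-all (suc n) = enum-words {Z = λ _ → ⊤} (enum-all n) (enum-all n)

enum-HasT : ∀ n → Enum (λ w → length w ≡ n × HasT w) (t# n)
enum-HasT zero = enum-∅ λ { {[]} () ; {_ ∷ _} (() , _) }
enum-HasT (suc n) = enum-words {Z = HasT} (enum-all n) (enum-HasT n)

enum-HasFT : ∀ n → Enum (λ w → length w ≡ n × HasFT w) (ft# n)
enum-HasFT zero = enum-∅ λ { {[]} () ; {_ ∷ _} (() , _) }
enum-HasFT (suc n) = enum-words {Z = HasFT} (enum-HasFT n) (enum-HasT n)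

enum-HasFT-≤ : ∀ n → Enum (λ w → length w ≤ n × HasFT w) (ps ft# n)
enum-HasFT-≤ zero = enum-cong (λ { (l , h) → subst (_≤ 0) (sym l) z≤n , h }) (λ { {[]} (_ , ()) ; {_ ∷ _} (() , _) }) (enum-HasFT zero)
enum-HasFT-≤ (suc n) = enum-cong (λ {w} → to {w}) (λ {w} → from {w}) (enum-⊎ (λ {w} → disj {w}) (enum-HasFT (suc n)) (enum-HasFT-≤ n))
  where
  disj : ∀ {w} → length w ≡ suc n × HasFT w → length w ≤ n × HasFT w → ⊥
  disj (e , _) (l , _) = 1+n≰n (subst (_≤ n) e l)
  to : ∀ {w} → (length w ≡ suc n × HasFT w) ⊎ (length w ≤ n × HasFT w) → length w ≤ suc n × HasFT w
  to (inj₁ (e , h)) = subst (_≤ suc n) (sym e) ≤-refl , h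
  to (inj₂ (l , h)) = m≤n⇒m≤1+n l , h
  from : ∀ {w} → length w ≤ suc n × HasFT w → (length w ≡ suc n × HasFT w) ⊎ (length w ≤ n × HasFT w)
  from (l , h) with m≤n⇒m<n∨m≡n l
  ... | inj₁ (s≤s q) = inj₂ (q , h)
  ... | inj₂ e = inj₁ (e , h)

enum-HasFT-< : ∀ n → Enum (λ w → length w < n × HasFT w) (xps ft# n)
enum-HasFT-< zero = enum-∅ λ { (() , _) }
enum-HasFT-< (suc n) = enum-cong (λ (l , h) → s≤s l , h) (λ { (s≤s l , h) → l , h }) (enum-HasFT-≤ n)

-- Families over a decreasing list of values, and cutting blocks off it

Fam : Set → Set₁
Fam X = List ℕ → X → Set

-- Only the relative order of the values matters, so the count is a function of their number. This
-- makes enumerations composable: cutting off a block replaces c by `ps c`, `xps c` or `shift# c`.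
EnumFam : ∀ {X} → Fam X → (ℕ → ℕ) → Set
EnumFam F c = ∀ S → Desc S → Enum (F S) (c (length S))

shift# : (ℕ → ℕ) → ℕ → ℕ
shift# c zero = 0
shift# c (suc n) = c n

module _ {X : Set} where

  Pre Pre⁺ : Fam X → Fam (List ℕ × X)
  Pre F S (U , x) = ∃ λ T → S ≡ U ++ T × F T x
  Pre⁺ F S (U , x) = U ≢ [] × Pre F S (U , x)

  Head : Fam X → Fam (ℕ × X)
  Head F S (M , x) = ∃ λ T → S ≡ M ∷ T × F T x

  Last : Fam X → Fam (X × ℕ)
  Last F S (x , t) = ∃ λ T → S ≡ T ++ [ t ] × F T x

  Post Post⁺ : Fam X → Fam (X × List ℕ)
  Post F S (x , B) = ∃ λ T → S ≡ T ++ B × F T x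
  Post⁺ F S (x , B) = B ≢ [] × Post F S (x , B)

  enum-Head : ∀ {F c} → EnumFam F c → EnumFam (Head F) (shift# c)
  enum-Head ef [] _ = enum-∅ λ { (_ , () , _) }
  enum-Head ef (M ∷ T) (_ ∷ d) = enum-map (M ,_) (λ p → _ , refl , p) (λ { (_ , refl , p) → _ , p , refl }) (λ { _ _ refl → refl }) (ef T d)

  enum-Pre : ∀ {F c} → EnumFam F c → EnumFam (Pre F) (ps c)
  enum-Pre⁺ : ∀ {F c} → EnumFam F c → EnumFam (Pre⁺ F) (xps c)
  enum-Pre {F} ef [] d = enum-map ([] ,_) (λ p → _ , refl , p) from (λ { _ _ refl → refl }) (ef [] d)
    where
    from : ∀ {y} → Pre F [] y → ∃ λ x → F [] x × y ≡ ([] , x)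
    from {[] , x} (_ , refl , p) = _ , p , refl
  enum-Pre {F} ef (s ∷ S) d = enum-cong to from (enum-⊎ disj
    (enum-map {Q = λ (U , x) → U ≡ [] × F (s ∷ S) x} ([] ,_) (λ p → refl , p) (λ { (refl , p) → _ , p , refl }) (λ { _ _ refl → refl }) (ef (s ∷ S) d))
    (enum-Pre⁺ ef (s ∷ S) d))
    where
    disj : ∀ {y} → (proj₁ y ≡ [] × F (s ∷ S) (proj₂ y)) → Pre⁺ F (s ∷ S) y → ⊥
    disj (refl , _) (n , _) = n refl
    to : ∀ {y} → (proj₁ y ≡ [] × F (s ∷ S) (proj₂ y)) ⊎ Pre⁺ F (s ∷ S) y → Pre F (s ∷ S) y
    to (inj₁ (refl , p)) = _ , refl , p
    to (inj₂ (_ , p)) = p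
    from : ∀ {y} → Pre F (s ∷ S) y → (proj₁ y ≡ [] × F (s ∷ S) (proj₂ y)) ⊎ Pre⁺ F (s ∷ S) y
    from {[] , x} (_ , refl , p) = inj₁ (refl , p)
    from {_ ∷ _ , x} p = inj₂ ((λ ()) , p)
  enum-Pre⁺ {F} ef [] d = enum-∅ none
    where
    none : ∀ {y} → ¬ Pre⁺ F [] y
    none {[] , _} (n , _) = n refl
    none {_ ∷ _ , _} (_ , _ , () , _)
  enum-Pre⁺ {F} ef (s ∷ S) (_ ∷ d) = enum-map (λ (U , x) → s ∷ U , x) (λ { (_ , refl , p) → (λ ()) , _ , refl , p }) from (λ { _ _ refl → refl }) (enum-Pre ef S d)
    where
    from : ∀ {y} → Pre⁺ F (s ∷ S) y → ∃ λ x → Pre F S x × y ≡ (s ∷ proj₁ x , proj₂ x)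
    from {[] , _} (n , _) = ⊥-elim (n refl)
    from {_ ∷ U , x} (_ , _ , refl , p) = (U , x) , (_ , refl , p) , refl

  enum-Last : ∀ {F c} → EnumFam F c → EnumFam (Last F) (shift# c)
  enum-Last {F} {c} ef S d with reverseView S
  ... | [] = enum-∅ λ { ([] , () , _) ; (_ ∷ _ , () , _) }
  ... | T ∶ _ ∶ʳ t = enum-≡ (cong (shift# c) (sym (trans (length-++ T) (+-comm (length T) 1))))
    (enum-map (_, t) (λ p → _ , refl , p) from (λ { _ _ refl → refl }) (ef T (proj₁ (++⁻-pairs T d))))
    where
    from : ∀ {y} → Last F (T ++ [ t ]) y → ∃ λ x → F T x × y ≡ (x , t)
    from (T' , e , p) with ∷ʳ-injective T T' e
    ... | refl , refl = _ , p , refl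

module _ {X : Set} where

  enum-Post : ∀ {F : Fam X} {c} → EnumFam F c → EnumFam (Post F) (ps c)
  enum-Post {F} {c} ef S d = go (reverseView S) d
    where
    go : ∀ {S} → Reverse S → Desc S → Enum (Post F S) (ps c (length S))
    go [] d = enum-map (_, []) (λ p → _ , refl , p) from (λ { _ _ refl → refl }) (ef [] d)
      where
      from : ∀ {y} → Post F [] y → ∃ λ x → F [] x × y ≡ (x , [])
      from {x , []} ([] , refl , p) = _ , p , refl
    go (S ∶ r ∶ʳ s) d = enum-≡ eq (enum-cong to from (enum-⊎ disj
      (enum-map {Q = λ (x , B) → B ≡ [] × F (S ++ [ s ]) x} (_, []) (λ p → refl , p) (λ { (refl , p) → _ , p , refl }) (λ { _ _ refl → refl }) (ef _ d))
      (enum-map {Q = Q₂} (λ (x , B) → x , B ++ [ s ]) (λ p → _ , refl , p) (λ { (_ , refl , p) → _ , p , refl })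
        (λ { {_ , B} {_ , B'} _ _ e → inj B B' e }) (go r (proj₁ (++⁻-pairs S d))))))
      where
      eq : c (length (S ++ [ s ])) + ps c (length S) ≡ ps c (length (S ++ [ s ]))
      eq rewrite trans (length-++ S {[ s ]}) (+-comm (length S) 1) = refl
      Q₂ : X × List ℕ → Set
      Q₂ (x , B) = ∃ λ B' → B ≡ B' ++ [ s ] × Post F S (x , B')
      inj : ∀ {x x' : X} B B' → (x , B ++ [ s ]) ≡ (x' , B' ++ [ s ]) → (x , B) ≡ (x' , B')
      inj B B' e with cong proj₁ e | ∷ʳ-injective B B' (cong proj₂ e)
      ... | refl | refl , _ = refl
      disj : ∀ {y} → (proj₂ y ≡ [] × F (S ++ [ s ]) (proj₁ y)) → Q₂ y → ⊥
      disj (refl , _) ([] , () , _)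
      disj (refl , _) (_ ∷ _ , () , _)
      to : ∀ {y} → (proj₂ y ≡ [] × F (S ++ [ s ]) (proj₁ y)) ⊎ Q₂ y → Post F (S ++ [ s ]) y
      to (inj₁ (refl , p)) = _ , sym (++-identityʳ _) , p
      to (inj₂ (B , refl , T , refl , p)) = T , ++-assoc T B _ , p
      from : ∀ {y} → Post F (S ++ [ s ]) y → (proj₂ y ≡ [] × F (S ++ [ s ]) (proj₁ y)) ⊎ Q₂ y
      from {x , B} (T , e , p) with reverseView B
      ... | [] = inj₁ (refl , subst (λ S → F S x) (trans (sym (++-identityʳ T)) (sym e)) p)
      ... | B' ∶ _ ∶ʳ s' with ∷ʳ-injective S (T ++ B') (trans e (sym (++-assoc T B' _)))
      ... | e' , refl = inj₂ (B' , refl , T , e' , p)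

  -- The last value of the non-empty suffix is taken off first; what is left of the suffix is then
  -- unrestricted.
  enum-Post⁺ : ∀ {F : Fam X} {c} → EnumFam F c → EnumFam (Post⁺ F) (shift# (ps c))
  enum-Post⁺ {F} ef S d = enum-map (λ ((x , B) , s) → x , B ++ [ s ]) to from inj (enum-Last (enum-Post ef) S d)
    where
    to : ∀ {y} → Last (Post F) S y → Post⁺ F S (proj₁ (proj₁ y) , proj₂ (proj₁ y) ++ [ proj₂ y ])
    to {(x , B) , s} (_ , refl , T , refl , p) = (λ e → snoc≢[] B e) , T , ++-assoc T B _ , p
      where
      snoc≢[] : ∀ (B : List ℕ) {s} → B ++ [ s ] ≢ []
      snoc≢[] [] ()
      snoc≢[] (_ ∷ _) ()
    from : ∀ {y} → Post⁺ F S y → ∃ λ x → Last (Post F) S x × y ≡ (proj₁ (proj₁ x) , proj₂ (proj₁ x) ++ [ proj₂ x ])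
    from {x , B} (n , T , e , p) with reverseView B
    ... | [] = ⊥-elim (n refl)
    ... | B' ∶ _ ∶ʳ s = ((x , B') , s) , (T ++ B' , trans e (sym (++-assoc T B' _)) , T , refl , p) , refl
    inj : ∀ {y y'} → Last (Post F) S y → Last (Post F) S y' →
          (proj₁ (proj₁ y) , proj₂ (proj₁ y) ++ [ proj₂ y ]) ≡ (proj₁ (proj₁ y') , proj₂ (proj₁ y') ++ [ proj₂ y' ]) → y ≡ y'
    inj {(x , B) , s} {(x' , B') , s'} _ _ e with cong proj₁ e | ∷ʳ-injective B B' (cong proj₂ e)
    ... | refl | refl , refl = refl

-- The three families

Av132 : List ℕ → Set
Av132 xs = ∀ {a b c} → a ∷ b ∷ c ∷ [] ⊆ xs → a < c → c < b → ⊥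

Layered : Fam (List ℕ)
Layered T Q = Q ↭ T × Av123 Q × Av132 Q

LayeredAsc : Fam (List ℕ)
LayeredAsc T Q = Layered T Q × ¬ Desc Q

∈∈⇒⊆ : ∀ {xs : List ℕ} {a b} → a ∈ xs → b ∈ xs → a ≢ b → a ∷ b ∷ [] ⊆ xs ⊎ b ∷ a ∷ [] ⊆ xs
∈∈⇒⊆ (here refl) (here refl) n = ⊥-elim (n refl)
∈∈⇒⊆ (here refl) (there j) n = inj₁ (refl ∷ from∈ j)
∈∈⇒⊆ (there i) (here refl) n = inj₂ (refl ∷ from∈ i)
∈∈⇒⊆ (there i) (there j) n with ∈∈⇒⊆ i j n
... | inj₁ s = inj₁ (_ ∷ˢ s)
... | inj₂ s = inj₂ (_ ∷ˢ s)

fst∈ : ∀ {A : Set} {a b : A} {cs xs} → a ∷ b ∷ cs ⊆ xs → a ∈ xs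
fst∈ s = to∈ (⊆-trans (refl ∷ minimum _) s)

snd∈ : ∀ {A : Set} {a b : A} {cs xs} → a ∷ b ∷ cs ⊆ xs → b ∈ xs
snd∈ s = to∈ (⊆-trans (_ ∷ˢ refl ∷ minimum _) s)

thd∈ : ∀ {A : Set} {a b c : A} {xs} → a ∷ b ∷ c ∷ [] ⊆ xs → c ∈ xs
thd∈ s = to∈ (⊆-trans (_ ∷ˢ _ ∷ˢ ⊆-refl) s)

-- Prepending x creates neither 123 nor 132 as long as at most one later entry t exceeds x.
module _ {x t : ℕ} {Q : List ℕ} (only : ∀ {y} → y ∈ Q → x < y → y ≡ t) where

  Av123-cons : Av123 Q → Av123 (x ∷ Q)
  Av123-cons av (_ ∷ˢ s) p q = av s p q
  Av123-cons av (refl ∷ s) p q with only (fst∈ s) p | only (snd∈ s) (<-trans p q)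
  ... | refl | refl = <-irrefl refl q

  Av132-cons : Av132 Q → Av132 (x ∷ Q)
  Av132-cons av (_ ∷ˢ s) p q = av s p q
  Av132-cons av (refl ∷ s) p q with only (snd∈ s) p | only (fst∈ s) (<-trans p q)
  ... | refl | refl = <-irrefl refl q

module _ {t t' : ℕ} {T : List ℕ} (d : Desc (t ∷ t' ∷ T)) where

  private
    t'<t : t' < t
    t'<t = All.lookup (AllPairs.head d) (here refl)
    T<t : ∀ {x} → x ∈ t' ∷ T → x < t
    T<t = All.lookup (AllPairs.head d)
    T<t' : ∀ {x} → x ∈ T → x < t'
    T<t' = All.lookup (AllPairs.head (AllPairs.tail d))
    only₁ : ∀ {Q y} → Q ↭ t' ∷ T → y ∈ Q → t < y → y ≡ 0
    only₁ p i l = ⊥-elim (<-asym l (T<t (∈-resp-↭ p i)))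
    only₂ : ∀ {Q y} → Q ↭ t ∷ T → y ∈ Q → t' < y → y ≡ t
    only₂ p i l with ∈-resp-↭ p i
    ... | here e = e
    ... | there j = ⊥-elim (<-asym l (T<t' j))

  layered-max : ∀ {Q} → Layered (t' ∷ T) Q → Layered (t ∷ t' ∷ T) (t ∷ Q)
  layered-max (p , a , b) = prep t p , Av123-cons (only₁ p) a , Av132-cons (only₁ p) b

  layered-2nd : ∀ {Q} → Layered (t ∷ T) Q → Layered (t ∷ t' ∷ T) (t' ∷ Q)
  layered-2nd (p , a , b) = ↭-trans (prep t' p) (swap t' t ↭-refl) , Av123-cons (only₂ p) a , Av132-cons (only₂ p) b

  -- If the first entry were below both t and t', these two would complete it to a 123 or a 132,
  -- according to their order. So Q starts with one of the two largest values.
  layered⁻ : ∀ {Q} → Layered (t ∷ t' ∷ T) Q →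
             (∃ λ Q' → Q ≡ t ∷ Q' × Layered (t' ∷ T) Q') ⊎ (∃ λ Q' → Q ≡ t' ∷ Q' × Layered (t ∷ T) Q')
  layered⁻ {[]} (p , _) with () ← ↭-length p
  layered⁻ {x ∷ Q} (p , a , b) with ∈-resp-↭ p (here refl)
  ... | here refl = inj₁ (Q , refl , drop-∷ p , (λ s → a (_ ∷ˢ s)) , (λ s → b (_ ∷ˢ s)))
  ... | there (here refl) = inj₂ (Q , refl , drop-∷ (↭-trans p (swap t t' ↭-refl)) , (λ s → a (_ ∷ˢ s)) , (λ s → b (_ ∷ˢ s)))
  ... | there (there i) with ∈∈⇒⊆ (inQ (here refl) (T<t (there i))) (inQ (there (here refl)) (T<t' i)) (λ { refl → <-irrefl refl t'<t })
    where
    inQ : ∀ {y} → y ∈ t ∷ t' ∷ T → x < y → y ∈ Q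
    inQ j l with ∈-resp-↭ (↭-sym p) j
    ... | here refl = ⊥-elim (<-irrefl refl l)
    ... | there k = k
  ... | inj₁ s = ⊥-elim (b (refl ∷ s) (T<t' i) t'<t)
  ... | inj₂ s = ⊥-elim (a (refl ∷ s) (T<t' i) t'<t)

  ¬Desc-2nd : ∀ {Q} → Layered (t ∷ T) Q → ¬ Desc (t' ∷ Q)
  ¬Desc-2nd (p , _) (l ∷ _) = <-asym t'<t (All.lookup l (∈-resp-↭ (↭-sym p) (here refl)))

  Desc-max : ∀ {Q} → Layered (t' ∷ T) Q → Desc Q → Desc (t ∷ Q)
  Desc-max (p , _) dQ = All.tabulate (λ i → T<t (∈-resp-↭ p i)) ∷ dQ

  LayMax Lay2nd : Fam (List ℕ) → List ℕ → Set
  LayMax F Q = ∃ λ Q' → Q ≡ t ∷ Q' × F (t' ∷ T) Q'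
  Lay2nd F Q = ∃ λ Q' → Q ≡ t' ∷ Q' × F (t ∷ T) Q'

  enum-LayMax : ∀ {F m} → Enum (F (t' ∷ T)) m → Enum (LayMax F) m
  enum-LayMax = enum-map (t ∷_) (λ p → _ , refl , p) (λ { (_ , refl , p) → _ , p , refl }) (λ _ _ → ∷-injectiveʳ)

  enum-Lay2nd : ∀ {F m} → Enum (F (t ∷ T)) m → Enum (Lay2nd F) m
  enum-Lay2nd = enum-map (t' ∷_) (λ p → _ , refl , p) (λ { (_ , refl , p) → _ , p , refl }) (λ _ _ → ∷-injectiveʳ)

  lay-disjoint : ∀ {F G Q} → LayMax F Q → Lay2nd G Q → ⊥
  lay-disjoint (_ , refl , _) (_ , e , _) = <-irrefl (sym (∷-injectiveˡ e)) t'<t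

enum-Layered : ∀ t T → Desc (t ∷ T) → Enum (Layered (t ∷ T)) (all# (length T))
enum-Layered t [] d = enum-singleton [ t ] (↭-refl , (λ { (_ ∷ˢ ()) ; (refl ∷ ()) }) , (λ { (_ ∷ˢ ()) ; (refl ∷ ()) })) (λ (p , _) → ↭-singleton-inv p)
enum-Layered t (t' ∷ T) d@((_ ∷ lt) ∷ l' ∷ dT) = enum-cong to (layered⁻ d)
  (enum-⊎ (lay-disjoint d {Layered} {Layered}) (enum-LayMax d {Layered} (enum-Layered t' T (l' ∷ dT))) (enum-Lay2nd d {Layered} (enum-Layered t T (lt ∷ dT))))
  where
  to : ∀ {Q} → LayMax d Layered Q ⊎ Lay2nd d Layered Q → Layered (t ∷ t' ∷ T) Q
  to (inj₁ (_ , refl , p)) = layered-max d p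
  to (inj₂ (_ , refl , p)) = layered-2nd d p

enum-LayeredAsc : EnumFam LayeredAsc (shift# t#)
enum-LayeredAsc [] d = enum-∅ none
  where
  none : ∀ {Q} → ¬ LayeredAsc [] Q
  none ((p , _) , n) with ↭-empty-inv p
  ... | refl = n []
enum-LayeredAsc (t ∷ []) d = enum-∅ none
  where
  none : ∀ {Q} → ¬ LayeredAsc [ t ] Q
  none ((p , _) , n) with ↭-singleton-inv p
  ... | refl = n ([] ∷ [])
enum-LayeredAsc (t ∷ t' ∷ T) d@((_ ∷ lt) ∷ l' ∷ dT) = enum-≡ (+-comm (t# (length T)) _) (enum-cong to from
  (enum-⊎ (lay-disjoint d {LayeredAsc} {Layered}) (enum-LayMax d {LayeredAsc} (enum-LayeredAsc (t' ∷ T) (l' ∷ dT))) (enum-Lay2nd d {Layered} (enum-Layered t T (lt ∷ dT)))))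
  where
  to : ∀ {Q} → LayMax d LayeredAsc Q ⊎ Lay2nd d Layered Q → LayeredAsc (t ∷ t' ∷ T) Q
  to (inj₁ (_ , refl , p , n)) = layered-max d p , λ { (_ ∷ dQ) → n dQ }
  to (inj₂ (_ , refl , p)) = layered-2nd d p , ¬Desc-2nd d p
  from : ∀ {Q} → LayeredAsc (t ∷ t' ∷ T) Q → LayMax d LayeredAsc Q ⊎ Lay2nd d Layered Q
  from (p , n) with layered⁻ d p
  ... | inj₁ (_ , refl , q) = inj₁ (_ , refl , q , λ dQ → n (Desc-max d q dQ))
  ... | inj₂ q = inj₂ q

Pair : Set
Pair = List ℕ × List ℕ

ShuffleParts : List ℕ → List Bool → Pair → Set
ShuffleParts S w (P , Q) = ∃₂ λ U L → S ≡ U ++ Q ++ L × Shuffle w U L P × Q ≢ []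

Shuffled : Fam Pair
Shuffled S pq = ∃ λ w → (length w < length S × HasFT w) × ShuffleParts S w pq

module _ {S : List ℕ} (d : Desc S) where

  parts-∉ : ∀ {U Q L x} → S ≡ U ++ Q ++ L → x ∈ U → x ∈ Q ++ L → ⊥
  parts-∉ {U} refl i j = <-irrefl refl (All.lookup (All.lookup (proj₂ (proj₂ (++⁻-pairs U d))) i) j)

-- The word alone determines the pair: its numbers of `true` and `false` are the lengths of U and L,
-- and the rest of S is Q, which is non-empty because the word is shorter than S.
enum-Shuffled : EnumFam Shuffled (xps ft#)
enum-Shuffled S d = enum-rel (ShuffleParts S) total fun inj (enum-HasFT-< (length S))
  where
  total : ∀ {w} → length w < length S × HasFT w → ∃ (ShuffleParts S w)
  total {w} (l , _) with take-prefix {d = trues w} S (≤-trans (≤-trans (m≤m+n (trues w) (falses w)) (≤-reflexive (trues+falses w))) (<⇒≤ l))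
  ... | U , Z , refl , eU with take-prefix {d = length Z ∸ falses w} Z (m∸n≤m (length Z) (falses w))
  ... | Q , L , refl , eQ with do-shuffle w U L eU (+-cancelˡ-≡ (length Q) _ _ (trans (sym (length-++ Q)) (trans (sym (m∸n+n≡m (<⇒≤ f<z))) (cong (_+ falses w) (sym eQ)))))
    where
    f<z : falses w < length Z
    f<z = +-cancelˡ-< (trues w) _ _ (≤-trans (s≤s (≤-reflexive (trues+falses w))) (≤-trans l (≤-reflexive (trans (length-++ U) (cong (_+ length Z) eU)))))
  ... | P , s = (P , Q) , U , L , refl , s , λ { refl → <-irrefl eQ (m<n⇒0<n∸m f<z) }
    where
    f<z : falses w < length Z
    f<z = +-cancelˡ-< (trues w) _ _ (≤-trans (s≤s (≤-reflexive (trues+falses w))) (≤-trans l (≤-reflexive (trans (length-++ U) (cong (_+ length Z) eU)))))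
  fun : ∀ {w y y'} → length w < length S × HasFT w → ShuffleParts S w y → ShuffleParts S w y' → y ≡ y'
  fun _ (U , L , refl , s , n) (U' , L' , e , s' , n') with ++-length-≡ U U' (trans (shuffle-trues s) (sym (shuffle-trues s'))) e
  fun {_} {_ , Q} {_ , Q'} _ (U , L , refl , s , n) (.U , L' , e , s' , n') | refl , e' with ++-length-≡ Q Q' lenQ e'
    where
    lenQ : length Q ≡ length Q'
    lenQ = +-cancelʳ-≡ (length L) _ _ (trans (sym (length-++ Q)) (trans (cong length e') (trans (length-++ Q') (cong (length Q' +_) (trans (shuffle-falses s') (sym (shuffle-falses s)))))))
  ... | refl , refl with shuffle-result s s'
  ... | refl = refl
  inj : ∀ {w w' y} → length w < length S × HasFT w → length w' < length S × HasFT w' → ShuffleParts S w y → ShuffleParts S w' y → w ≡ w'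
  inj {y = _ , []} _ _ (_ , _ , _ , _ , n) _ = ⊥-elim (n refl)
  -- The first entry q of Q marks the end of U in S.
  inj {y = P , q ∷ Q} _ _ (U , L , e , s , _) (U' , L' , e' , s' , _)
    with span-≡ {B = _≢ q} U U' (fresh e) (fresh e') (λ n → n refl) (λ n → n refl) (trans (sym e) e')
    where
    fresh : ∀ {U L} → S ≡ U ++ (q ∷ Q) ++ L → All (_≢ q) U
    fresh e = All.tabulate λ { i refl → parts-∉ d {Q = q ∷ Q} e i (here refl) }
  ... | refl , _ , e'' with ++-cancelˡ Q L L' e''
  ... | refl = shuffle-word (λ i j → parts-∉ d {Q = q ∷ Q} e i (∈-++⁺ʳ (q ∷ Q) j)) s s'

Stacked : Fam Pair
Stacked S (P , Q) = ∃ λ U → ∃ λ L → P ≡ L ++ U × L ≢ [] × ∃ λ T → S ≡ U ++ T ++ L × LayeredAsc T Q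

stacked# : ℕ → ℕ
stacked# = ps (shift# (ps (shift# t#)))

enum-Stacked : EnumFam Stacked stacked#
enum-Stacked S d = enum-map {P = Pre (Post⁺ LayeredAsc) S} (λ (U , Q , L) → L ++ U , Q) to from inj (enum-Pre (enum-Post⁺ enum-LayeredAsc) S d)
  where
  to : ∀ {y} → Pre (Post⁺ LayeredAsc) S y → Stacked S (proj₂ (proj₂ y) ++ proj₁ y , proj₁ (proj₂ y))
  to {U , Q , L} (_ , refl , n , T , refl , p) = U , L , refl , n , T , refl , p
  from : ∀ {y} → Stacked S y → ∃ λ x → Pre (Post⁺ LayeredAsc) S x × y ≡ (proj₂ (proj₂ x) ++ proj₁ x , proj₁ (proj₂ x))
  from {_ , Q} (U , L , refl , n , T , refl , p) = (U , Q , L) , (_ , refl , n , T , refl , p) , refl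
  inj : ∀ {y y'} → Pre (Post⁺ LayeredAsc) S y → Pre (Post⁺ LayeredAsc) S y' →
        (proj₂ (proj₂ y) ++ proj₁ y , proj₁ (proj₂ y)) ≡ (proj₂ (proj₂ y') ++ proj₁ y' , proj₁ (proj₂ y')) → y ≡ y'
  inj {U , [] , L} (_ , _ , _ , _ , _ , _ , n) _ e = ⊥-elim (n [])
  -- The entries of P below q form L and those above q form U, so the pair shows where P is cut.
  inj {U , q ∷ Q , L} {U' , _ , L'} (_ , e₁ , _ , T , refl , (p , _) , _) (_ , e₁' , _ , T' , refl , (p' , _) , _) e
    with cong proj₂ e
  ... | refl with split-≡ {B = _< q} L L' (proj₂ (sides {U} e₁ p)) (proj₂ (sides {U'} e₁' p')) (proj₁ (sides {U} e₁ p)) (proj₁ (sides {U'} e₁' p')) (cong proj₁ e)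
    where
    sides : ∀ {U T L} → S ≡ U ++ T ++ L → q ∷ Q ↭ T → All (λ x → ¬ x < q) U × All (_< q) L
    sides {U} {T} refl p with ++⁻-pairs U d
    ... | _ , dTL , aU with ++⁻-pairs T dTL
    ... | _ , _ , aT =
      All.map (λ a → <-asym (All.lookup a (∈-++⁺ˡ (∈-resp-↭ p (here refl))))) aU ,
      All.lookup aT (∈-resp-↭ p (here refl))
  ... | refl , refl = refl

Triple : Set
Triple = List ℕ × List ℕ × List ℕ

-- The entries between M and t, as (entries left of the maximum, entries right of it before M, entries after M).
MidWord : (List Bool → Set) → Fam Triple
MidWord Z T (c , D , R) = (∃ λ w → Z w × Shuffle w D c T) × R ≡ []

-- With R non-empty, avoidance of 2341 forces every entry of c above all of D or below all of R, so
-- T falls into four blocks.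
MidRuns : (List ℕ → Set) → Fam Triple
MidRuns Z T (c , D , R) = ∃ λ c₁ → ∃ λ c₂ → T ≡ c₁ ++ D ++ R ++ c₂ × c ≡ c₁ ++ c₂ × D ≢ [] × R ≢ [] × Z c₁

-- Mid′ replaces Mid when there is no entry below t, as otherwise P could lie below Q.
Mid Mid′ : Fam Triple
Mid T x = MidWord HasT T x ⊎ MidRuns (λ _ → ⊤) T x
Mid′ T x = MidWord HasFT T x ⊎ MidRuns (_≢ []) T x

enum-MidWord : ∀ {Z c} → (∀ n → Enum (λ w → length w ≡ n × Z w) (c n)) → EnumFam (MidWord Z) c
enum-MidWord {Z} ew T d = enum-cong to from (enum-rel R total fun inj (ew (length T)))
  where
  R : List Bool → Triple → Set
  R w (c , D , R) = Shuffle w D c T × R ≡ []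
  total : ∀ {w} → length w ≡ length T × Z w → ∃ (R w)
  total {w} (e , _) with un-shuffle w T e
  ... | D , c , s = (c , D , []) , s , refl
  fun : ∀ {w y y'} → length w ≡ length T × Z w → R w y → R w y' → y ≡ y'
  fun _ (s , refl) (s' , refl) with shuffle-parts s s'
  ... | refl , refl = refl
  disj : ∀ {w D c x} → Shuffle w D c T → x ∈ D → x ∈ c → ⊥
  disj {D = D} s i j = All.lookup (All.lookup (proj₂ (proj₂ (++⁻-pairs D (Unique-resp-↭ (↭-sym (shuffle-↭ s)) (Desc⇒Unique d))))) i) j refl
  inj : ∀ {w w' y} → length w ≡ length T × Z w → length w' ≡ length T × Z w' → R w y → R w' y → w ≡ w'
  inj _ _ (s , _) (s' , _) = shuffle-word (disj s) s s'
  to : ∀ {y} → (∃ λ w → (length w ≡ length T × Z w) × R w y) → MidWord Z T y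
  to (w , (_ , z) , s , e) = (w , z , s) , e
  from : ∀ {y} → MidWord Z T y → ∃ λ w → (length w ≡ length T × Z w) × R w y
  from ((w , z , s) , e) = w , (sym (shuffle-length s) , z) , s , e

enum-rest : EnumFam (λ T c → c ≡ T) (λ _ → 1)
enum-rest T d = enum-singleton T refl (λ e → e)

Runs : Fam (List ℕ × List ℕ × List ℕ)
Runs = Pre⁺ (Pre⁺ (λ T c → c ≡ T))

-- The binomial coefficient C(n, 2).
runs# : ℕ → ℕ
runs# = xps (xps (λ _ → 1))

runs-triple : List ℕ × List ℕ × List ℕ × List ℕ → Triple
runs-triple (c₁ , D , R , c₂) = c₁ ++ c₂ , D , R

enum-MidRuns : ∀ {Z m T} → Desc T → Enum (λ (y : List ℕ × List ℕ × List ℕ × List ℕ) → Z (proj₁ y) × Pre Runs T y) m → Enum (MidRuns Z T) m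
enum-MidRuns {Z} {m} {T} d = enum-map runs-triple to from inj
  where
  C : List ℕ × List ℕ × List ℕ × List ℕ → Set
  C y = Z (proj₁ y) × Pre Runs T y
  to : ∀ {y} → C y → MidRuns Z T (runs-triple y)
  to {c₁ , D , R , c₂} (z , _ , refl , nD , _ , refl , nR , _ , refl , refl) = c₁ , c₂ , refl , refl , nD , nR , z
  from : ∀ {x} → MidRuns Z T x → ∃ λ y → C y × x ≡ runs-triple y
  from {_ , D , R} (c₁ , c₂ , refl , refl , nD , nR , z) = (c₁ , D , R , c₂) , (z , _ , refl , nD , _ , refl , nR , _ , refl , refl) , refl
  fresh : ∀ {c₁ q D Z} → T ≡ c₁ ++ (q ∷ D) ++ Z → All (_≢ q) c₁
  fresh {D = D} e = All.tabulate λ { i refl → parts-∉ d {Q = _ ∷ D} e i (here refl) }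
  inj : ∀ {y y'} → C y → C y' → runs-triple y ≡ runs-triple y' → y ≡ y'
  inj {_ , [] , _} (_ , _ , _ , nD , _) _ e = ⊥-elim (nD refl)
  inj {c₁ , q ∷ D , R , c₂} {c₁' , _ , _ , c₂'} (z , _ , e₁ , nD , _ , refl , nR , _ , refl , refl) (z' , _ , e₁' , nD' , _ , refl , nR' , _ , refl , refl) e
    with cong (λ x → proj₁ (proj₂ x)) e | cong (λ x → proj₂ (proj₂ x)) e
  -- The triple only shows c₁ and c₂ joined. As D is non-empty, its first entry q marks the end of
  -- c₁ in T.
  ... | refl | refl with span-≡ {B = _≢ q} c₁ c₁' (fresh {D = D} e₁) (fresh {D = D} e₁') (λ n → n refl) (λ n → n refl) (trans (sym e₁) e₁')
  ... | refl , _ with ++-cancelˡ c₁ c₂ c₂' (cong proj₁ e)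
  ... | refl = refl

word-runs-disjoint : ∀ {X Y T x} → MidWord X T x → MidRuns Y T x → ⊥
word-runs-disjoint (_ , refl) (_ , _ , _ , _ , _ , n , _) = n refl

mid# mid′# : ℕ → ℕ
mid# n = t# n + ps runs# n
mid′# n = ft# n + xps runs# n

enum-Mid : EnumFam Mid mid#
enum-Mid T d = enum-⊎ (λ {x} → word-runs-disjoint {x = x}) (enum-MidWord enum-HasT T d)
  (enum-MidRuns {Z = λ _ → ⊤} d (enum-cong {P = Pre Runs T} (λ p → tt , p) proj₂ (enum-Pre (enum-Pre⁺ (enum-Pre⁺ enum-rest)) T d)))

enum-Mid′ : EnumFam Mid′ mid′#
enum-Mid′ T d = enum-⊎ (λ {x} → word-runs-disjoint {x = x}) (enum-MidWord enum-HasFT T d)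
  (enum-MidRuns {Z = _≢ []} d (enum-cong {P = Pre⁺ Runs T} (λ p → p) (λ p → p) (enum-Pre⁺ (enum-Pre⁺ (enum-Pre⁺ enum-rest)) T d)))

-- The shape requires an entry of P above one of Q. If B is non-empty, t exceeds its entries and the
-- requirement is met; if B is empty, it has to be met within T, hence `Mid′`.
Tail : Fam (Triple × ℕ × List ℕ)
Tail S (x , t , B) = ∃ λ T → S ≡ T ++ t ∷ B × (B ≢ [] × Mid T x ⊎ B ≡ [] × Mid′ T x)

tail# : ℕ → ℕ
tail# n = shift# (shift# (ps mid#)) n + shift# mid′# n

enum-Tail : EnumFam Tail tail#
enum-Tail S d = enum-cong to from (enum-⊎ disj
  (enum-map {P = Last (Post⁺ Mid) S} {Q = Long} grow to₁ from₁ inj₁′ (enum-Last (enum-Post⁺ enum-Mid) S d))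
  (enum-map {P = Last Mid′ S} {Q = Short} (λ (x , t) → x , t , []) (λ (T , e , p) → refl , T , e , p)
    (λ { {x , t , _} (refl , T , e , p) → (x , t) , (T , e , p) , refl }) (λ { _ _ refl → refl }) (enum-Last enum-Mid′ S d)))
  where
  -- A non-empty B gives up its last entry s to `Last`. The rest of t ∷ B is then an arbitrary
  -- non-empty suffix, as `Post⁺` enumerates.
  grow : (Triple × List ℕ) × ℕ → Triple × ℕ × List ℕ
  grow ((x , []) , s) = x , s , []
  grow ((x , t ∷ B) , s) = x , t , B ++ [ s ]
  Long Short : Triple × ℕ × List ℕ → Set
  Long (x , t , B) = B ≢ [] × ∃ λ T → S ≡ T ++ t ∷ B × Mid T x
  Short (x , t , B) = B ≡ [] × ∃ λ T → S ≡ T ++ t ∷ B × Mid′ T x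
  to₁ : ∀ {y} → Last (Post⁺ Mid) S y → Long (grow y)
  to₁ {(x , []) , s} (_ , _ , n , _) = ⊥-elim (n refl)
  to₁ {(x , t ∷ B) , s} (_ , refl , _ , T , refl , p) = (λ e → ∈⇒≢[] (∈-++⁺ʳ B (here refl)) e) , T , ++-assoc T (t ∷ B) [ s ] , p
  from₁ : ∀ {y} → Long y → ∃ λ z → Last (Post⁺ Mid) S z × y ≡ grow z
  from₁ {x , t , B} (n , T , e , p) with reverseView B
  ... | [] = ⊥-elim (n refl)
  ... | B' ∶ _ ∶ʳ s = ((x , t ∷ B') , s) , (T ++ t ∷ B' , trans e (sym (++-assoc T (t ∷ B') [ s ])) , (λ ()) , T , refl , p) , refl
  inj₁′ : ∀ {y y'} → Last (Post⁺ Mid) S y → Last (Post⁺ Mid) S y' → grow y ≡ grow y' → y ≡ y'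
  inj₁′ {(x , []) , s} (_ , _ , n , _) _ _ = ⊥-elim (n refl)
  inj₁′ {(x , _ ∷ _) , s} {(x' , []) , s'} _ (_ , _ , n , _) _ = ⊥-elim (n refl)
  inj₁′ {(x , t ∷ B) , s} {(x' , t' ∷ B') , s'} _ _ e with cong proj₁ e | cong (λ z → proj₁ (proj₂ z)) e | ∷ʳ-injective B B' (cong (λ z → proj₂ (proj₂ z)) e)
  ... | refl | refl | refl , refl = refl
  disj : ∀ {y} → Long y → Short y → ⊥
  disj (n , _) (e , _) = n e
  to : ∀ {y} → Long y ⊎ Short y → Tail S y
  to (inj₁ (n , T , e , p)) = T , e , inj₁ (n , p)
  to (inj₂ (n , T , e , p)) = T , e , inj₂ (n , p)
  from : ∀ {y} → Tail S y → Long y ⊎ Short y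
  from (T , e , inj₁ (n , p)) = inj₁ (n , T , e , p)
  from (T , e , inj₂ (n , p)) = inj₂ (n , T , e , p)

CrossedCode : Set
CrossedCode = List ℕ × ℕ × Triple × ℕ × List ℕ

IsCrossedCode : Fam CrossedCode
IsCrossedCode = Pre (Head Tail)

crossed-pair : CrossedCode → Pair
crossed-pair (a , M , (c , D , R) , t , B) = c ++ [ t ] , a ++ D ++ B ++ M ∷ R

Crossed : Fam Pair
Crossed S pq = ∃ λ y → IsCrossedCode S y × pq ≡ crossed-pair y

crossed# : ℕ → ℕ
crossed# = ps (shift# tail#)

module CM = Algebra.Solver.CommutativeMonoid (++-commutativeMonoid {A = ℕ})

-- The families satisfy the conditions

-- For Q non-empty and n above all entries, this says that P n Q avoids 1243, 2341 and 4123.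
record Good (P Q : List ℕ) : Set where
  field
    av123 : Av123 Q
    asc-straddles : ∀ {a b q} → a ∷ b ∷ [] ⊆ P → a < b → q ∈ Q → a < q × q < b
    av1-243 : ∀ {p x y z} → p ∈ P → x ∷ y ∷ z ∷ [] ⊆ Q → p < x → x < z → z < y → ⊥
    av2-341 : ∀ {p x y z} → p ∈ P → x ∷ y ∷ z ∷ [] ⊆ Q → z < p → p < x → x < y → ⊥
    av41-23 : ∀ {p r x y} → p ∷ r ∷ [] ⊆ P → x ∷ y ∷ [] ⊆ Q → r < x → x < y → y < p → ⊥

-- If Q avoids 123, this amounts to a 123 in P n Q: an ascent of P is completed by n, and without
-- such an ascent the occurrence has its first term in P and the other two in Q.
Increasing : List ℕ → List ℕ → Set
Increasing P Q = (∃₂ λ a b → a ∷ b ∷ [] ⊆ P × a < b) ⊎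
                 (∃ λ p → ∃₂ λ x y → p ∈ P × x ∷ y ∷ [] ⊆ Q × p < x × x < y)

record Split (S : List ℕ) (pq : Pair) : Set where
  constructor mkSplit
  private
    P = proj₁ pq
    Q = proj₂ pq
  field
    perm : P ++ Q ↭ S
    nonempty : Q ≢ []
    good : Good P Q
    increasing : Increasing P Q

pair-++ : ∀ {A : Set} xs {ys} {a b : A} → a ∷ b ∷ [] ⊆ xs ++ ys →
          a ∷ b ∷ [] ⊆ xs ⊎ ((a ∈ xs × b ∈ ys) ⊎ a ∷ b ∷ [] ⊆ ys)
pair-++ xs s with cut xs s
... | [] , _ , refl , _ , q = inj₂ (inj₂ q)
... | a ∷ [] , _ , refl , p , q = inj₂ (inj₁ (to∈ p , to∈ q))
... | a ∷ b ∷ [] , _ , refl , p , q = inj₁ p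
... | _ ∷ _ ∷ _ ∷ _ , _ , () , _ , _

fst-snd : ∀ {A : Set} {a b c : A} {xs} → a ∷ b ∷ c ∷ [] ⊆ xs → a ∷ b ∷ [] ⊆ xs
fst-snd = ⊆-trans (refl ∷ refl ∷ _ ∷ˢ [])

fst-thd : ∀ {A : Set} {a b c : A} {xs} → a ∷ b ∷ c ∷ [] ⊆ xs → a ∷ c ∷ [] ⊆ xs
fst-thd = ⊆-trans (refl ∷ _ ∷ˢ refl ∷ [])

snd-thd : ∀ {A : Set} {a b c : A} {xs} → a ∷ b ∷ c ∷ [] ⊆ xs → b ∷ c ∷ [] ⊆ xs
snd-thd = ⊆-trans (_ ∷ˢ ⊆-refl)

desc-no-asc : ∀ {xs a b} → Desc xs → a ∷ b ∷ [] ⊆ xs → a < b → ⊥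
desc-no-asc d s l = <-asym l (pair⊆ d s)

record Thirds (U T L : List ℕ) : Set where
  field
    desc-U : Desc U
    desc-T : Desc T
    desc-L : Desc L
    U>T : ∀ {u q} → u ∈ U → q ∈ T → q < u
    T>L : ∀ {q l} → q ∈ T → l ∈ L → l < q
    U>L : ∀ {u l} → u ∈ U → l ∈ L → l < u

thirds : ∀ U T L → Desc (U ++ T ++ L) → Thirds U T L
thirds U T L d with ++⁻-pairs U d
... | dU , dTL , aU with ++⁻-pairs T dTL
... | dT , dL , aT = record
  { desc-U = dU ; desc-T = dT ; desc-L = dL
  ; U>T = λ i j → All.lookup (All.lookup aU i) (∈-++⁺ˡ j)
  ; T>L = λ i j → All.lookup (All.lookup aT i) j
  ; U>L = λ i j → All.lookup (All.lookup aU i) (∈-++⁺ʳ T j) }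

thirds⁺ : ∀ {U T L} → Thirds U T L → Desc (U ++ T ++ L)
thirds⁺ {U} {T} {L} th = AllPairsₚ.++⁺ desc-U
  (AllPairsₚ.++⁺ desc-T desc-L (All.tabulate λ i → All.tabulate λ j → T>L i j))
  (All.tabulate λ i → Allₚ.++⁺ (All.tabulate λ j → U>T i j) (All.tabulate λ j → U>L i j))
  where open Thirds th

++-middle-↭ : ∀ {A : Set} (U T L : List A) → U ++ T ++ L ↭ (U ++ L) ++ T
++-middle-↭ U T L = ↭-trans (++⁺ˡ-↭ U (++-comm T L)) (↭-reflexive (sym (++-assoc U L T)))

shuffled⇒split : ∀ {S pq} → Desc S → Shuffled S pq → Split S pq
shuffled⇒split {pq = P , Q} d (w , (_ , ft) , U , L , refl , s , ne) = mkSplit perm ne good inc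
  where
  open Thirds (thirds U Q L d)
  perm : P ++ Q ↭ U ++ Q ++ L
  perm = ↭-sym (↭-trans (++-middle-↭ U Q L) (++⁺ʳ-↭ Q (shuffle-↭ s)))
  asc : ∀ {a b} → a ∷ b ∷ [] ⊆ P → a < b → a ∈ L × b ∈ U
  asc i l with shuffle-pair s i
  ... | inj₁ (inj₁ j) = ⊥-elim (desc-no-asc desc-U j l)
  ... | inj₁ (inj₂ j) = ⊥-elim (desc-no-asc desc-L j l)
  ... | inj₂ (inj₁ (j , k)) = ⊥-elim (<-asym l (U>L j k))
  ... | inj₂ (inj₂ jk) = jk
  good : Good P Q
  good = record
    { av123 = λ s l _ → desc-no-asc desc-T (fst-snd s) l
    ; asc-straddles = λ s l i → T>L i (proj₁ (asc s l)) , U>T (proj₂ (asc s l)) i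
    ; av1-243 = λ _ s _ l m → desc-no-asc desc-T (fst-snd s) (<-trans l m)
    ; av2-341 = λ _ s _ _ l → desc-no-asc desc-T (fst-snd s) l
    ; av41-23 = λ _ s _ l _ → desc-no-asc desc-T s l }
  inc : Increasing P Q
  inc with shuffle-HasFT⁻ s ft
  ... | l , u , i , j , k = inj₁ (l , u , k , U>L j i)

-- No entry of P lies between two values of Q, which excludes the 2341 with one term in P. A 4123
-- with two terms in P would need an entry of U before one of L, but P lists L first.
stacked⇒split : ∀ {S pq} → Desc S → Stacked S pq → Split S pq
stacked⇒split {pq = P , Q} d (U , L , refl , nL , T , refl , (p , a , b) , n) = mkSplit perm ne good inc
  where
  open Thirds (thirds U T L d)
  Q⇒T : ∀ {q} → q ∈ Q → q ∈ T
  Q⇒T = ∈-resp-↭ p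
  perm : (L ++ U) ++ Q ↭ U ++ T ++ L
  perm = ↭-sym (↭-trans (++-middle-↭ U T L) (++⁺-↭ (++-comm U L) (↭-sym p)))
  uQ : Unique Q
  uQ = Unique-resp-↭ (↭-sym p) (Desc⇒Unique desc-T)
  ne : Q ≢ []
  ne refl = n []
  asc : ∀ {a b} → a ∷ b ∷ [] ⊆ L ++ U → a < b → a ∈ L × b ∈ U
  asc i l with pair-++ L i
  ... | inj₁ j = ⊥-elim (desc-no-asc desc-L j l)
  ... | inj₂ (inj₁ jk) = jk
  ... | inj₂ (inj₂ j) = ⊥-elim (desc-no-asc desc-U j l)
  no-between : ∀ {p x z} → p ∈ L ++ U → x ∈ Q → z ∈ Q → z < p → p < x → ⊥
  no-between i j k l m with ∈-++⁻ L i
  ... | inj₁ i' = <-asym l (T>L (Q⇒T k) i')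
  ... | inj₂ i' = <-asym m (U>T i' (Q⇒T j))
  no-across : ∀ {p r x y} → p ∷ r ∷ [] ⊆ L ++ U → x ∈ Q → y ∈ Q → r < x → y < p → ⊥
  no-across i j k l m with pair-++ L i
  ... | inj₁ i' = <-asym m (T>L (Q⇒T k) (fst∈ i'))
  ... | inj₂ (inj₁ (i' , _)) = <-asym m (T>L (Q⇒T k) i')
  ... | inj₂ (inj₂ i') = <-asym l (U>T (snd∈ i') (Q⇒T j))
  good : Good (L ++ U) Q
  good = record
    { av123 = a
    ; asc-straddles = λ s l i → T>L (Q⇒T i) (proj₁ (asc s l)) , U>T (proj₂ (asc s l)) (Q⇒T i)
    ; av1-243 = λ _ s _ l m → b s l m
    ; av2-341 = λ i s l m _ → no-between i (fst∈ s) (thd∈ s) l m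
    ; av41-23 = λ i s l _ m → no-across i (fst∈ s) (snd∈ s) l m }
  inc : Increasing (L ++ U) Q
  inc with asc? uQ | ≢[]⇒∈ nL
  ... | inj₂ dQ | _ = ⊥-elim (n dQ)
  ... | inj₁ (x , y , s , l) | t , i = inj₂ (t , x , y , ∈-++⁺ˡ i , s , T>L (Q⇒T (fst∈ s)) i , l)

record CrossedFacts (a : List ℕ) (M : ℕ) (c D R : List ℕ) (t : ℕ) (B : List ℕ) : Set where
  field
    desc-a : Desc a
    desc-c : Desc c
    desc-D : Desc D
    desc-R : Desc R
    desc-B : Desc B
    D≢[] : D ≢ []
    a>M : ∀ {x} → x ∈ a → M < x
    c<M : ∀ {x} → x ∈ c → x < M
    D<M : ∀ {x} → x ∈ D → x < M
    R<M : ∀ {x} → x ∈ R → x < M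
    c>t : ∀ {x} → x ∈ c → t < x
    D>t : ∀ {x} → x ∈ D → t < x
    R>t : ∀ {x} → x ∈ R → t < x
    B<t : ∀ {x} → x ∈ B → x < t
    t<M : t < M
    R<D : ∀ {x y} → x ∈ R → y ∈ D → x < y
    -- If r < p < d, then p d M r would be an occurrence of 2341.
    c-gap : ∀ {p d r} → p ∈ c → d ∈ D → r ∈ R → p < d → p < r

module CrossedSound {a M c D R t B} (h : CrossedFacts a M c D R t B) where
  open CrossedFacts h

  private
    Q = a ++ D ++ B ++ M ∷ R
    P = c ++ [ t ]

  desc-P : Desc P
  desc-P = AllPairsₚ.++⁺ desc-c ([] ∷ []) (All.tabulate λ i → c>t i ∷ [])

  P≥t : ∀ {p x} → p ∈ P → p < x → t < x
  P≥t i l with ∈-++⁻ c i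
  ... | inj₁ j = <-trans (c>t j) l
  ... | inj₂ (here refl) = l

  P<M : ∀ {p} → p ∈ P → p < M
  P<M i with ∈-++⁻ c i
  ... | inj₁ j = c<M j
  ... | inj₂ (here refl) = t<M

  -- The conditions of `Good` are read off from this list of the ascents of Q. Bottoms lie in D or
  -- B, while tops are M or lie in R; this alone excludes a 123.
  asc : ∀ {x y} → x ∷ y ∷ [] ⊆ Q → x < y → (y ≡ M × (x ∈ D ⊎ x ∈ B)) ⊎ (x ∈ B × y ∈ R)
  asc s l with pair-++ a s
  ... | inj₁ s' = ⊥-elim (desc-no-asc desc-a s' l)
  ... | inj₂ (inj₁ (i , j)) = ⊥-elim (<-asym l (rest j))
    where
    rest : ∀ {y} → y ∈ D ++ B ++ M ∷ R → y < _
    rest j with ∈-++⁻ D j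
    ... | inj₁ k = <-trans (D<M k) (a>M i)
    ... | inj₂ j' with ∈-++⁻ B j'
    ... | inj₁ k = <-trans (<-trans (B<t k) t<M) (a>M i)
    ... | inj₂ (here refl) = a>M i
    ... | inj₂ (there k) = <-trans (R<M k) (a>M i)
  ... | inj₂ (inj₂ s₁) with pair-++ D s₁
  ... | inj₁ s' = ⊥-elim (desc-no-asc desc-D s' l)
  ... | inj₂ (inj₁ (i , j)) with ∈-++⁻ B j
  ... | inj₁ k = ⊥-elim (<-asym l (<-trans (B<t k) (D>t i)))
  ... | inj₂ (here refl) = inj₁ (refl , inj₁ i)
  ... | inj₂ (there k) = ⊥-elim (<-asym l (R<D k i))
  asc s l | inj₂ (inj₂ s₁) | inj₂ (inj₂ s₂) with pair-++ B s₂
  ... | inj₁ s' = ⊥-elim (desc-no-asc desc-B s' l)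
  ... | inj₂ (inj₁ (i , here refl)) = inj₁ (refl , inj₂ i)
  ... | inj₂ (inj₁ (i , there k)) = inj₂ (i , k)
  ... | inj₂ (inj₂ (refl ∷ s')) = ⊥-elim (<-asym l (R<M (to∈ s')))
  ... | inj₂ (inj₂ (_ ∷ˢ s')) = ⊥-elim (desc-no-asc desc-R s' l)

  asc-above-t : ∀ {x y} → x ∷ y ∷ [] ⊆ Q → x < y → t < x → x ∈ D × y ≡ M
  asc-above-t s l m with asc s l
  ... | inj₁ (e , inj₁ i) = i , e
  ... | inj₁ (_ , inj₂ i) = ⊥-elim (<-asym m (B<t i))
  ... | inj₂ (i , _) = ⊥-elim (<-asym m (B<t i))

  after-M : ∀ {z} → M ∷ z ∷ [] ⊆ Q → z ∈ R
  after-M s with pair-++ a s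
  ... | inj₁ s' = ⊥-elim (<-irrefl refl (a>M (fst∈ s')))
  ... | inj₂ (inj₁ (i , _)) = ⊥-elim (<-irrefl refl (a>M i))
  ... | inj₂ (inj₂ s₁) with pair-++ D s₁
  ... | inj₁ s' = ⊥-elim (<-irrefl refl (D<M (fst∈ s')))
  ... | inj₂ (inj₁ (i , _)) = ⊥-elim (<-irrefl refl (D<M i))
  ... | inj₂ (inj₂ s₂) with pair-++ B s₂
  ... | inj₁ s' = ⊥-elim (<-asym (B<t (fst∈ s')) t<M)
  ... | inj₂ (inj₁ (i , _)) = ⊥-elim (<-asym (B<t i) t<M)
  ... | inj₂ (inj₂ (refl ∷ s')) = to∈ s'
  ... | inj₂ (inj₂ (_ ∷ˢ s')) = ⊥-elim (<-irrefl refl (R<M (fst∈ s')))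

  D-then-M : ∀ {x} → x ∈ D → x ∷ M ∷ [] ⊆ Q
  D-then-M i = ++⁺ˡ a (++⁺ (from∈ i) (++⁺ˡ B (refl ∷ minimum R)))

  ¬desc-Q : ¬ Desc Q
  ¬desc-Q dQ with ≢[]⇒∈ D≢[]
  ... | x , i = desc-no-asc dQ (D-then-M i) (D<M i)

  -- Identifies M within Q as the largest top of an ascent, which makes the encoding invertible.
  top-≤M : ∀ {x y} → x ∷ y ∷ [] ⊆ Q → x < y → y ≤ M
  top-≤M s l with asc s l
  ... | inj₁ (refl , _) = ≤-refl
  ... | inj₂ (_ , j) = <⇒≤ (R<M j)

  good : Good P Q
  good = record
    { av123 = no123
    ; asc-straddles = λ s l _ → ⊥-elim (desc-no-asc desc-P s l)
    ; av1-243 = no243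
    ; av2-341 = no341
    ; av41-23 = no4123 }
    where
    not-low : ∀ {y} → y ∈ D ⊎ y ∈ B → y < M × (y ∈ R → ⊥)
    not-low (inj₁ i) = D<M i , λ j → <-irrefl refl (R<D j i)
    not-low (inj₂ i) = <-trans (B<t i) t<M , λ j → <-asym (R>t j) (B<t i)
    low : ∀ {y z} → y ∷ z ∷ [] ⊆ Q → y < z → y ∈ D ⊎ y ∈ B
    low s l with asc s l
    ... | inj₁ (_ , k) = k
    ... | inj₂ (i , _) = inj₂ i
    no123 : Av123 Q
    no123 s l m with asc (fst-snd s) l | low (snd-thd s) m
    ... | inj₁ (refl , _) | k = <-irrefl refl (proj₁ (not-low k))
    ... | inj₂ (_ , j) | k = proj₂ (not-low k) j
    no243 : ∀ {p x y z} → p ∈ P → x ∷ y ∷ z ∷ [] ⊆ Q → p < x → x < z → z < y → ⊥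
    no243 i s l m n with asc-above-t (fst-snd s) (<-trans m n) (P≥t i l) | asc-above-t (fst-thd s) m (P≥t i l)
    ... | _ , refl | _ , refl = <-irrefl refl n
    no341 : ∀ {p x y z} → p ∈ P → x ∷ y ∷ z ∷ [] ⊆ Q → z < p → p < x → x < y → ⊥
    no341 i s l m n with asc-above-t (fst-snd s) n (P≥t i m)
    ... | j , refl with ∈-++⁻ c i | after-M (snd-thd s)
    ... | inj₁ i' | k = <-asym l (c-gap i' j k m)
    ... | inj₂ (here refl) | k = <-asym l (R>t k)
    no4123 : ∀ {p r x y} → p ∷ r ∷ [] ⊆ P → x ∷ y ∷ [] ⊆ Q → r < x → x < y → y < p → ⊥
    no4123 i s l m n with asc-above-t s m (P≥t (snd∈ i) l)
    ... | _ , refl = <-asym n (P<M (fst∈ i))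

  increasing : Increasing P Q
  increasing with ≢[]⇒∈ D≢[]
  ... | x , i = inj₂ (t , x , M , ∈-++⁺ʳ c (here refl) , D-then-M i , D>t i , D<M i)

record Mids (c D R T : List ℕ) : Set where
  field
    perm : c ++ D ++ R ↭ T
    desc-c : Desc c
    desc-D : Desc D
    desc-R : Desc R
    D≢[] : D ≢ []
    R<D : ∀ {x y} → x ∈ R → y ∈ D → x < y
    c-gap : ∀ {p d r} → p ∈ c → d ∈ D → r ∈ R → p < d → p < r

desc-⊆ : ∀ {xs ys} → xs ⊆ ys → Desc ys → Desc xs
desc-⊆ {xs} s d = pairs⁺ xs (λ i → pair⊆ d (⊆-trans i s))

mids : ∀ {T c D R} → Desc T → Mid T (c , D , R) → Mids c D R T
mids {T} {c} {D} d (inj₁ ((w , h , s) , refl)) = record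
  { perm = ↭-trans (++⁺ˡ-↭ c (↭-reflexive (++-identityʳ D))) (↭-trans (++-comm c D) (shuffle-↭ s))
  ; desc-c = desc-⊆ (shuffle-⊆ʳ s) d ; desc-D = desc-⊆ (shuffle-⊆ˡ s) d ; desc-R = []
  ; D≢[] = shuffle-HasT⁻ s h ; R<D = λ () ; c-gap = λ _ _ () }
mids {D = D} {R} d (inj₂ (c₁ , c₂ , refl , refl , nD , nR , _)) with ++⁻-pairs c₁ d
... | d₁ , dDRc , a₁ with ++⁻-pairs D dDRc
... | dD , dRc , aD with ++⁻-pairs R dRc
... | dR , d₂ , aR = record
  { perm = ↭-sym (↭-trans (++⁺ˡ-↭ c₁ (↭-trans (↭-reflexive (sym (++-assoc D R c₂))) (++-comm (D ++ R) c₂)))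
      (↭-reflexive (sym (++-assoc c₁ c₂ (D ++ R)))))
  ; desc-c = AllPairsₚ.++⁺ d₁ d₂ (All.map (λ q → Allₚ.++⁻ʳ R (Allₚ.++⁻ʳ D q)) a₁)
  ; desc-D = dD ; desc-R = dR ; D≢[] = nD
  ; R<D = λ i j → All.lookup (All.lookup aD j) (∈-++⁺ˡ i)
  ; c-gap = gap }
  where
  gap : ∀ {p d r} → p ∈ c₁ ++ c₂ → d ∈ D → r ∈ R → p < d → p < r
  gap i j k l with ∈-++⁻ c₁ i
  ... | inj₁ i' = ⊥-elim (<-asym l (All.lookup (All.lookup a₁ i') (∈-++⁺ˡ j)))
  ... | inj₂ i' = All.lookup (All.lookup aR k) i'

Mid′⇒Mid : ∀ {T x} → Mid′ T x → Mid T x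
Mid′⇒Mid (inj₁ ((w , h , s) , e)) = inj₁ ((w , HasFT⇒HasT w h , s) , e)
Mid′⇒Mid (inj₂ (c₁ , c₂ , e , e' , nD , nR , _)) = inj₂ (c₁ , c₂ , e , e' , nD , nR , tt)

-- An inversion between the two sides distinguishes this family from Stacked.
Crossing : List ℕ → List ℕ → Set
Crossing P Q = ∃₂ λ p q → p ∈ P × q ∈ Q × q < p

record CrossedCodeFacts (S : List ℕ) (y : CrossedCode) : Set where
  private
    a = proj₁ y
    M = proj₁ (proj₂ y)
    c = proj₁ (proj₁ (proj₂ (proj₂ y)))
    D = proj₁ (proj₂ (proj₁ (proj₂ (proj₂ y))))
    R = proj₂ (proj₂ (proj₁ (proj₂ (proj₂ y))))
    t = proj₁ (proj₂ (proj₂ (proj₂ y)))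
    B = proj₂ (proj₂ (proj₂ (proj₂ y)))
  field
    T : List ℕ
    S≡ : S ≡ a ++ M ∷ T ++ t ∷ B
    T↭ : c ++ D ++ R ↭ T
    facts : CrossedFacts a M c D R t B
    crossing : Crossing (c ++ [ t ]) (a ++ D ++ B ++ M ∷ R)

crossed-facts : ∀ {S y} → Desc S → IsCrossedCode S y → CrossedCodeFacts S y
crossed-facts {y = a , M , (c , D , R) , t , B} d (_ , refl , _ , refl , T , refl , m) with ++⁻-pairs a d
... | da , aM ∷ dTtB , aa with ++⁻-pairs T dTtB
... | dT , tB ∷ dB , aT = record { T = T ; S≡ = refl ; T↭ = perm ; facts = record
    { desc-a = da ; desc-c = desc-c ; desc-D = desc-D ; desc-R = desc-R ; desc-B = dB ; D≢[] = D≢[]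
    ; a>M = λ i → All.head (All.lookup aa i)
    ; c<M = λ i → T<M (c⇒T i) ; D<M = λ i → T<M (D⇒T i) ; R<M = λ i → T<M (R⇒T i)
    ; c>t = λ i → T>t (c⇒T i) ; D>t = λ i → T>t (D⇒T i) ; R>t = λ i → T>t (R⇒T i)
    ; B<t = All.lookup tB ; t<M = All.lookup aM (∈-++⁺ʳ T (here refl))
    ; R<D = R<D ; c-gap = c-gap }
  ; crossing = cross m }
  where
  mid : B ≢ [] × Mid T (c , D , R) ⊎ B ≡ [] × Mid′ T (c , D , R) → Mid T (c , D , R)
  mid (inj₁ (_ , p)) = p
  mid (inj₂ (_ , p)) = Mid′⇒Mid p
  open Mids (mids dT (mid m))
  T<M : ∀ {x} → x ∈ T → x < M
  T<M i = All.lookup aM (∈-++⁺ˡ i)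
  T>t : ∀ {x} → x ∈ T → t < x
  T>t i = All.head (All.lookup aT i)
  c⇒T : ∀ {x} → x ∈ c → x ∈ T
  c⇒T i = ∈-resp-↭ perm (∈-++⁺ˡ i)
  D⇒T : ∀ {x} → x ∈ D → x ∈ T
  D⇒T i = ∈-resp-↭ perm (∈-++⁺ʳ c (∈-++⁺ˡ i))
  R⇒T : ∀ {x} → x ∈ R → x ∈ T
  R⇒T i = ∈-resp-↭ perm (∈-++⁺ʳ c (∈-++⁺ʳ D i))
  cross : B ≢ [] × Mid T (c , D , R) ⊎ B ≡ [] × Mid′ T (c , D , R) → Crossing (c ++ [ t ]) (a ++ D ++ B ++ M ∷ R)
  cross (inj₁ (n , _)) with ≢[]⇒∈ n
  ... | b , i = t , b , ∈-++⁺ʳ c (here refl) , ∈-++⁺ʳ a (∈-++⁺ʳ D (∈-++⁺ˡ i)) , All.lookup tB i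
  cross (inj₂ (_ , inj₁ ((w , h , s) , _))) with shuffle-HasFT⁻ s h
  ... | p , q , i , j , k = p , q , ∈-++⁺ˡ i , ∈-++⁺ʳ a (∈-++⁺ˡ j) , pair⊆ dT k
  cross (inj₂ (_ , inj₂ (c₁ , c₂ , e , e' , nD , nR , n))) with ≢[]⇒∈ n | ≢[]⇒∈ nD
  ... | p , i | q , j = p , q , subst (λ c → p ∈ c ++ [ t ]) (sym e') (∈-++⁺ˡ (∈-++⁺ˡ i)) , ∈-++⁺ʳ a (∈-++⁺ˡ j) ,
    All.lookup (All.lookup (proj₂ (proj₂ (++⁻-pairs c₁ (subst Desc e dT)))) i) (∈-++⁺ˡ j)

crossed⇒split : ∀ {S pq} → Desc S → Crossed S pq → Split S pq
crossed⇒split d ((a , M , (c , D , R) , t , B) , code , refl) = mkSplit perm ne good increasing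
  where
  open CrossedCodeFacts (crossed-facts d code)
  open CrossedSound facts
  open CM using (_⊜_) renaming (_⊕_ to _⊞_)
  ne : a ++ D ++ B ++ M ∷ R ≢ []
  ne = ∈⇒≢[] (∈-++⁺ʳ a (∈-++⁺ʳ D (∈-++⁺ʳ B (here refl))))
  perm : (c ++ [ t ]) ++ a ++ D ++ B ++ M ∷ R ↭ _
  perm = ↭-trans (CM.solve 7 (λ a M c D R t B → (c ⊞ t) ⊞ (a ⊞ (D ⊞ (B ⊞ (M ⊞ R)))) ⊜ a ⊞ (M ⊞ ((c ⊞ (D ⊞ R)) ⊞ (t ⊞ B)))) ↭-refl a [ M ] c D R [ t ] B)
    (↭-trans (++⁺ˡ-↭ a (prep M (++⁺ʳ-↭ (t ∷ B) T↭))) (↭-reflexive (sym S≡)))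

-- The last entry of P is t, and M is the largest ascent top of Q. These two values cut S into a, T
-- and B, after which D and R are read off from Q.
crossed-pair-injective : ∀ {S y y'} → Desc S → IsCrossedCode S y → IsCrossedCode S y' → crossed-pair y ≡ crossed-pair y' → y ≡ y'
crossed-pair-injective {S} {a , M , (c , D , R) , t , B} {a' , M' , (c' , D' , R') , t' , B'} d code code' e
  with ∷ʳ-injective c c' (cong proj₁ e)
... | refl , refl = goal
  where
  module A = CrossedCodeFacts (crossed-facts d code)
  module A' = CrossedCodeFacts (crossed-facts d code')
  module C = CrossedSound A.facts
  module C' = CrossedSound A'.facts
  Q≡ = cong proj₂ e
  M≡ : M ≡ M'
  M≡ with ≢[]⇒∈ (CrossedFacts.D≢[] A.facts) | ≢[]⇒∈ (CrossedFacts.D≢[] A'.facts)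
  ... | x , i | x' , i' = ≤-antisym
    (C'.top-≤M (subst (_ ⊆_) Q≡ (C.D-then-M i)) (CrossedFacts.D<M A.facts i))
    (C.top-≤M (subst (_ ⊆_) (sym Q≡) (C'.D-then-M i')) (CrossedFacts.D<M A'.facts i'))
  goal : (a , M , (c , D , R) , t , B) ≡ (a' , M' , (c , D' , R') , t , B')
  goal with M≡
  ... | refl with span-≡ {B = _≢ M} a a' (fresh A.facts) (fresh A'.facts) (λ n → n refl) (λ n → n refl) (trans (sym A.S≡) A'.S≡)
    where
    fresh : ∀ {a c D R t B} → CrossedFacts a M c D R t B → All (_≢ M) a
    fresh h = All.tabulate λ { i refl → <-irrefl refl (CrossedFacts.a>M h i) }
  ... | refl , _ , e₁ with span-≡ {B = _≢ t} A.T A'.T (fresh A.T↭ A.facts) (fresh A'.T↭ A'.facts) (λ n → n refl) (λ n → n refl) e₁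
    where
    fresh : ∀ {a M c D R B T} → c ++ D ++ R ↭ T → CrossedFacts a M c D R t B → All (_≢ t) T
    fresh {c = c} {D} p h = All.tabulate λ { i refl → absurd (∈-resp-↭ (↭-sym p) i) }
      where
      absurd : t ∈ c ++ D ++ _ → ⊥
      absurd i with ∈-++⁻ c i
      ... | inj₁ j = <-irrefl refl (CrossedFacts.c>t h j)
      ... | inj₂ j with ∈-++⁻ D j
      ... | inj₁ k = <-irrefl refl (CrossedFacts.D>t h k)
      ... | inj₂ k = <-irrefl refl (CrossedFacts.R>t h k)
  ... | _ , _ , refl with span-≡ {B = _≢ M} (D ++ B) (D' ++ B) (fresh A.facts) (fresh A'.facts) (λ n → n refl) (λ n → n refl)
                           (trans (++-assoc D B _) (trans (++-cancelˡ a _ _ Q≡) (sym (++-assoc D' B _))))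
    where
    fresh : ∀ {a c D R} → CrossedFacts a M c D R t B → All (_≢ M) (D ++ B)
    fresh h = Allₚ.++⁺ (All.tabulate λ { i refl → <-irrefl refl (CrossedFacts.D<M h i) })
                       (All.tabulate λ { i refl → <-asym (CrossedFacts.B<t h i) (CrossedFacts.t<M h) })
  ... | e₂ , _ , refl with ++-cancelʳ B D D' e₂
  ... | refl = refl

enum-Crossed : EnumFam Crossed crossed#
enum-Crossed S d = enum-map {P = IsCrossedCode S} crossed-pair (λ p → _ , p , refl) (λ (y , p , e) → y , p , e) (crossed-pair-injective d) (enum-Pre (enum-Head enum-Tail) S d)

shuffled-desc : ∀ {S P Q} → Desc S → Shuffled S (P , Q) → Desc Q
shuffled-desc {Q = Q} d (_ , _ , U , L , refl , _) = proj₁ (++⁻-pairs Q (proj₁ (proj₂ (++⁻-pairs U d))))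

shuffled-stacked-disjoint : ∀ {S pq} → Desc S → Shuffled S pq → Stacked S pq → ⊥
shuffled-stacked-disjoint d f (_ , _ , _ , _ , _ , _ , _ , n) = n (shuffled-desc d f)

shuffled-crossed-disjoint : ∀ {S pq} → Desc S → Shuffled S pq → Crossed S pq → ⊥
shuffled-crossed-disjoint d f (_ , code , refl) = CrossedSound.¬desc-Q (CrossedCodeFacts.facts (crossed-facts d code)) (shuffled-desc d f)

-- In a stacked pair an entry of P exceeding one of Q lies in U, so an entry of L precedes it. That
-- is an ascent, but P decreases in the crossed family.
stacked-crossed-disjoint : ∀ {S pq} → Desc S → Stacked S pq → Crossed S pq → ⊥
stacked-crossed-disjoint d (U , L , e , nL , T , refl , (p , _) , _) (_ , code , refl) with CrossedCodeFacts.crossing (crossed-facts d code) | ≢[]⇒∈ nL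
... | x , q , i , j , q<x | l , k with ∈-++⁻ L (subst (x ∈_) e i)
... | inj₁ i' = <-asym q<x (Thirds.T>L (thirds U T L d) (∈-resp-↭ p j) i')
... | inj₂ i' = <-asym (Thirds.U>L (thirds U T L d) i' k)
  (pair⊆ (subst Desc e (CrossedSound.desc-P (CrossedCodeFacts.facts (crossed-facts d code)))) (++⁺ (from∈ k) (from∈ i')))

-- Completeness of the families

Merged : List ℕ → List ℕ → Set
Merged us ls = ∃₂ λ w ps → Shuffle w us ls ps × Desc ps

shuffle-All : ∀ {A : ℕ → Set} {w us ls ps} → Shuffle w us ls ps → All A us → All A ls → All A ps
shuffle-All [] _ _ = []
shuffle-All (left x s) (a ∷ p) q = a ∷ shuffle-All s p q
shuffle-All (right x s) p (a ∷ q) = a ∷ shuffle-All s p q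

merged-left : ∀ {u us ls} → All (_< u) us → All (_< u) ls → Merged us ls → Merged (u ∷ us) ls
merged-left p q (_ , _ , s , d) = _ , _ , left _ s , shuffle-All s p q ∷ d

merged-right : ∀ {l us ls} → All (_< l) us → All (_< l) ls → Merged us ls → Merged us (l ∷ ls)
merged-right p q (_ , _ , s , d) = _ , _ , right _ s , shuffle-All s p q ∷ d

merge-desc : ∀ us ls → Desc us → Desc ls → (∀ {x} → x ∈ us → x ∈ ls → ⊥) → Merged us ls
merge-desc [] [] _ _ _ = [] , [] , [] , []
merge-desc (u ∷ us) [] (p ∷ du) dl _ = merged-left p [] (merge-desc us [] du dl (λ _ ()))
merge-desc [] (l ∷ ls) du (q ∷ dl) _ = merged-right [] q (merge-desc [] ls du dl (λ ()))
merge-desc (u ∷ us) (l ∷ ls) (p ∷ du) (q ∷ dl) dj = pick (<-cmp l u)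
  (merge-desc us (l ∷ ls) du (q ∷ dl) (λ i → dj (there i)))
  (merge-desc (u ∷ us) ls (p ∷ du) dl (λ i j → dj i (there j)))
  where
  pick : Tri (l < u) (l ≡ u) (u < l) → Merged us (l ∷ ls) → Merged (u ∷ us) ls → Merged (u ∷ us) (l ∷ ls)
  pick (tri< l<u _ _) m _ = merged-left p (l<u ∷ All.map (λ k → <-trans k l<u) q) m
  pick (tri≈ _ refl _) _ _ = ⊥-elim (dj (here refl) (here refl))
  pick (tri> _ _ u<l) _ m = merged-right (u<l ∷ All.map (λ k → <-trans k u<l) p) q m

sort-desc : ∀ xs → Unique xs → ∃ λ ys → ys ↭ xs × Desc ys
sort-desc [] _ = [] , ↭-refl , []
sort-desc (x ∷ xs) (ne ∷ u) with sort-desc xs u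
... | ys , p , d with merge-desc [ x ] ys ([] ∷ []) d (λ { (here refl) j → All.lookup ne (∈-resp-↭ p j) refl })
... | w , zs , s , dz = zs , ↭-trans (↭-sym (shuffle-↭ s)) (prep x p) , dz

partition-shuffle : ∀ {A : ℕ → Set} → (∀ x → Dec (A x)) → ∀ xs → ∃ λ w → ∃₂ λ us ls → Shuffle w us ls xs × All A us × All (¬_ ∘ A) ls
partition-shuffle A? [] = [] , [] , [] , [] , [] , []
partition-shuffle A? (x ∷ xs) with A? x | partition-shuffle A? xs
... | yes a | w , us , ls , s , p , q = _ , _ , _ , left x s , a ∷ p , q
... | no ¬a | w , us , ls , s , p , q = _ , _ , _ , right x s , p , ¬a ∷ q

desc-split : ∀ {k xs} → Desc xs → k ∉ xs → ∃₂ λ us vs → xs ≡ us ++ vs × All (k <_) us × All (_< k) vs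
desc-split {xs = []} _ _ = [] , [] , refl , [] , []
desc-split {k} {x ∷ xs} (p ∷ d) n with <-cmp k x
... | tri≈ _ refl _ = ⊥-elim (n (here refl))
... | tri> _ _ x<k = [] , x ∷ xs , refl , [] , x<k ∷ All.map (λ l → <-trans l x<k) p
... | tri< k<x _ _ with desc-split d (n ∘ there)
... | us , vs , refl , a , b = x ∷ us , vs , refl , k<x ∷ a , b

first-ascent : ∀ xs → Unique xs → Desc xs ⊎ (∃₂ λ us z → ∃₂ λ m vs → xs ≡ us ++ z ∷ m ∷ vs × Desc (us ++ [ z ]) × z < m)
first-ascent [] _ = inj₁ []
first-ascent (x ∷ []) _ = inj₁ ([] ∷ [])
first-ascent (x ∷ y ∷ xs) (ne ∷ u) with <-cmp x y
... | tri< l _ _ = inj₂ ([] , x , y , xs , refl , [] ∷ [] , l)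
... | tri≈ _ e _ = ⊥-elim (All.head ne e)
... | tri> _ _ y<x with first-ascent (y ∷ xs) u
... | inj₁ (p ∷ d) = inj₁ ((y<x ∷ All.map (λ l → <-trans l y<x) p) ∷ p ∷ d)
... | inj₂ ([] , z , m , vs , refl , d , l) = inj₂ ([ x ] , z , m , vs , refl , (y<x ∷ []) ∷ d , l)
... | inj₂ (.y ∷ us , z , m , vs , refl , p ∷ d , l) =
  inj₂ (x ∷ y ∷ us , z , m , vs , refl , (y<x ∷ All.map (λ l → <-trans l y<x) p) ∷ p ∷ d , l)

⊆-chain : ∀ {xs : List ℕ} {a b c} → Unique xs → a ∷ b ∷ [] ⊆ xs → b ∷ c ∷ [] ⊆ xs → a ∷ b ∷ c ∷ [] ⊆ xs
⊆-chain (ne ∷ u) (_ ∷ˢ s) (_ ∷ˢ r) = _ ∷ˢ ⊆-chain u s r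
⊆-chain (ne ∷ u) (_ ∷ˢ s) (refl ∷ r) = ⊥-elim (All.lookup ne (snd∈ s) refl)
⊆-chain (ne ∷ u) (refl ∷ s) (refl ∷ r) = ⊥-elim (All.lookup ne (to∈ s) refl)
⊆-chain (ne ∷ u) (refl ∷ s) (_ ∷ˢ r) = refl ∷ r

shuffle-concat : ∀ {w us ls ps} → Shuffle w us ls ps → (∀ {u l} → u ∈ us → l ∈ ls → ¬ (u ∷ l ∷ [] ⊆ ps)) → ps ≡ ls ++ us
shuffle-concat [] _ = refl
shuffle-concat (right x s) n = cong (x ∷_) (shuffle-concat s (λ i j k → n i (there j) (x ∷ˢ k)))
shuffle-concat {ls = []} (left x s) n = cong (x ∷_) (shuffle-concat s (λ i j k → n (there i) j (x ∷ˢ k)))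
shuffle-concat {ls = l ∷ ls} (left x s) n = ⊥-elim (n (here refl) (here refl) (refl ∷ from∈ (∈⊆ (here refl) (shuffle-⊆ʳ s))))

Families : Fam Pair
Families S pq = Shuffled S pq ⊎ (Stacked S pq ⊎ Crossed S pq)

module Complete {S P Q : List ℕ} (dS : Desc S) (sp : Split S (P , Q)) where
  open Split sp
  open Good good

  uPQ : Unique (P ++ Q)
  uPQ = Unique-resp-↭ (↭-sym perm) (Desc⇒Unique dS)
  uP : Unique P
  uP = proj₁ (++⁻-pairs P uPQ)
  uQ : Unique Q
  uQ = proj₁ (proj₂ (++⁻-pairs P uPQ))
  P∩Q : ∀ {p q} → p ∈ P → q ∈ Q → p ≢ q
  P∩Q i j = All.lookup (All.lookup (proj₂ (proj₂ (++⁻-pairs P uPQ))) i) j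

  module AscP {a₀ b₀} (ab : a₀ ∷ b₀ ∷ [] ⊆ P) (a<b : a₀ < b₀) where

    q₀ : ∃ (_∈ Q)
    q₀ = ≢[]⇒∈ nonempty

    -- The essential case is a₀ < p < b₀. If p stands after a₀, the ascent a₀ p puts p above Q; if
    -- it stands before a₀, the ascent p b₀ puts it below Q.
    sides : ∀ {p} → p ∈ P → (∀ {q} → q ∈ Q → p < q) ⊎ (∀ {q} → q ∈ Q → q < p)
    sides {p} i with <-cmp p b₀ | <-cmp p a₀
    ... | tri≈ _ refl _ | _ = inj₂ (λ j → proj₂ (asc-straddles ab a<b j))
    ... | tri> _ _ b<p | _ = inj₂ (λ j → <-trans (proj₂ (asc-straddles ab a<b j)) b<p)
    ... | tri< p<b _ _ | tri< p<a _ _ = inj₁ (λ j → <-trans p<a (proj₁ (asc-straddles ab a<b j)))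
    ... | tri< p<b _ _ | tri≈ _ refl _ = inj₁ (λ j → proj₁ (asc-straddles ab a<b j))
    ... | tri< p<b _ _ | tri> _ ne a<p with ∈∈⇒⊆ (fst∈ ab) i (ne ∘ sym)
    ... | inj₁ s = inj₂ (λ j → proj₂ (asc-straddles s a<p j))
    ... | inj₂ s = inj₁ (λ j → proj₁ (asc-straddles (fst-thd (⊆-chain uP s ab)) p<b j))

    result : Families S (P , Q)
    result with partition-shuffle (proj₁ q₀ <?_) P
    ... | w , U , L , s , aU , aL with sort-desc Q uQ
    ... | T , T↭Q , dT = conclude
      where
      U>Q : ∀ {u q} → u ∈ U → q ∈ Q → q < u
      U>Q i j with sides (∈⊆ i (shuffle-⊆ˡ s))
      ... | inj₁ f = ⊥-elim (<-asym (f (proj₂ q₀)) (All.lookup aU i))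
      ... | inj₂ f = f j
      L<Q : ∀ {l q} → l ∈ L → q ∈ Q → l < q
      L<Q i j with sides (∈⊆ i (shuffle-⊆ʳ s))
      ... | inj₁ f = f j
      ... | inj₂ f = ⊥-elim (All.lookup aL i (f (proj₂ q₀)))
      U∩L : ∀ {x} → x ∈ U → x ∈ L → ⊥
      U∩L i j = All.lookup aL j (All.lookup aU i)
      a∈L : a₀ ∈ L
      a∈L with shuffle-∈ s (fst∈ ab)
      ... | inj₁ i = ⊥-elim (<-asym (All.lookup aU i) (proj₁ (asc-straddles ab a<b (proj₂ q₀))))
      ... | inj₂ i = i
      b∈U : b₀ ∈ U
      b∈U with shuffle-∈ s (snd∈ ab)
      ... | inj₁ i = i
      ... | inj₂ i = ⊥-elim (All.lookup aL i (proj₂ (asc-straddles ab a<b (proj₂ q₀))))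
      th : Thirds U T L
      th = record
        { desc-U = desc-from (sub-unique (shuffle-⊆ˡ s)) (λ r l → <-asym (proj₁ (asc-straddles (⊆-trans r (shuffle-⊆ˡ s)) l (proj₂ q₀))) (All.lookup aU (fst∈ r)))
        ; desc-T = dT
        ; desc-L = desc-from (sub-unique (shuffle-⊆ʳ s)) (λ r l → All.lookup aL (snd∈ r) (proj₂ (asc-straddles (⊆-trans r (shuffle-⊆ʳ s)) l (proj₂ q₀))))
        ; U>T = λ i j → U>Q i (∈-resp-↭ T↭Q j)
        ; T>L = λ i j → L<Q j (∈-resp-↭ T↭Q i)
        ; U>L = λ i j → <-trans (L<Q j (proj₂ q₀)) (U>Q i (proj₂ q₀)) }
        where
        sub-unique : ∀ {xs} → xs ⊆ P → Unique xs
        sub-unique {xs} r = pairs⁺ xs (λ i → pair⊆ uP (⊆-trans i r))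
      S≡ : S ≡ U ++ T ++ L
      S≡ = Desc-↭⇒≡ dS (thirds⁺ th)
        (↭-sym (↭-trans (++-middle-↭ U T L) (↭-trans (++⁺-↭ (shuffle-↭ s) T↭Q) perm)))
      w<S : length w < length S
      w<S = subst (length w <_) (trans (cong (_+ length Q) (sym (shuffle-length s))) (trans (sym (length-++ P)) (↭-length perm)))
        (m<m+n (length w) (pos nonempty))
        where
        pos : ∀ {xs : List ℕ} → xs ≢ [] → 0 < length xs
        pos {[]} n = ⊥-elim (n refl)
        pos {_ ∷ _} _ = s≤s z≤n
      conclude : Families S (P , Q)
      conclude with asc? uQ
      ... | inj₂ dQ = inj₁ (w , (w<S , shuffle-HasFT⁺ s U∩L a∈L b∈U ab) , U , L ,
        subst (λ T → S ≡ U ++ T ++ L) (Desc-↭⇒≡ dT dQ T↭Q) S≡ , s , nonempty)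
      -- Given the ascent x y of Q, an upper entry u before a lower entry l would make u l x y a
      -- 4123, so P is L followed by U. A 132 in Q would become a 1243 behind a₀.
      ... | inj₁ (x , y , xy , x<y) = inj₂ (inj₁ (U , L ,
        shuffle-concat s (λ i j k → av41-23 k xy (L<Q j (fst∈ xy)) x<y (U>Q i (snd∈ xy))) ,
        ∈⇒≢[] a∈L , T , S≡ , (↭-sym T↭Q , av123 , (λ r l m → av1-243 (fst∈ ab) r (L<Q a∈L (fst∈ r)) l m)) ,
        λ dQ → desc-no-asc dQ xy x<y))

  -- The stacked shape with no value above Q: here U is empty and L is all of P.
  module BelowP (dP : Desc P) (P<Q : ∀ {p q} → p ∈ P → q ∈ Q → p < q) {p x y} (p∈P : p ∈ P) (xy : x ∷ y ∷ [] ⊆ Q) (x<y : x < y) where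

    result : Families S (P , Q)
    result with sort-desc Q uQ
    ... | T , T↭Q , dT = inj₂ (inj₁ ([] , P , sym (++-identityʳ P) , ∈⇒≢[] p∈P , T ,
      Desc-↭⇒≡ dS (AllPairsₚ.++⁺ dT dP (All.tabulate λ i → All.tabulate λ j → P<Q j (∈-resp-↭ T↭Q i)))
        (↭-trans (↭-sym perm) (↭-trans (++-comm P Q) (++⁺ʳ-↭ P (↭-sym T↭Q)))) ,
      (↭-sym T↭Q , av123 , λ r l m → av1-243 p∈P r (P<Q p∈P (fst∈ r)) l m) , λ dQ → desc-no-asc dQ xy x<y))

  -- V is the decreasing prefix of Q that ends with the bottom z of the first ascent z M. Cutting V
  -- by value at M and at t produces a, D and B; the forbidden patterns then place c and R relative
  -- to these blocks.
  module CrossP {c t} (P≡ : P ≡ c ++ [ t ]) (dP : Desc P)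
                {p' q'} (p'∈P : p' ∈ P) (q'∈Q : q' ∈ Q) (q'<p' : q' < p')
                {x y} (xy : x ∷ y ∷ [] ⊆ Q) (t<x : t < x) (x<y : x < y)
                {V z M R} (Q≡V : Q ≡ V ++ M ∷ R) (z∈V : z ∈ V) (dV : Desc V) (z<M : z < M)
                {a V₁ D B} (V≡₁ : V ≡ a ++ V₁) (a>M′ : All (M <_) a) (V₁<M′ : All (_< M) V₁)
                (V≡₂ : V₁ ≡ D ++ B) (D>t′ : All (t <_) D) (B<t′ : All (_< t) B) where

    to-Q : ∀ {xs} → xs ⊆ V ++ M ∷ R → xs ⊆ Q
    to-Q = subst (_ ⊆_) (sym Q≡V)
    t∈P : t ∈ P
    t∈P = subst (t ∈_) (sym P≡) (∈-++⁺ʳ c (here refl))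
    c⊆P : ∀ {p} → p ∈ c → p ∈ P
    c⊆P i = subst (_ ∈_) (sym P≡) (∈-++⁺ˡ i)
    c,t : ∀ {p} → p ∈ c → p ∷ t ∷ [] ⊆ P
    c,t i = subst (_ ⊆_) (sym P≡) (++⁺ (from∈ i) ⊆-refl)
    VMR : ∀ {v r} → v ∈ V → r ∈ R → v ∷ M ∷ r ∷ [] ⊆ Q
    VMR i j = to-Q (++⁺ (from∈ i) (refl ∷ from∈ j))
    VM : ∀ {v} → v ∈ V → v ∷ M ∷ [] ⊆ Q
    VM i = to-Q (++⁺ (from∈ i) (refl ∷ minimum R))
    VRR : ∀ {v r r'} → v ∈ V → r ∷ r' ∷ [] ⊆ R → v ∷ r ∷ r' ∷ [] ⊆ Q
    VRR i s = to-Q (++⁺ (from∈ i) (M ∷ˢ s))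
    MR≢ : ∀ {r} → r ∈ R → M ≢ r
    MR≢ j = pair⊆ uQ (to-Q (++⁺ˡ V (refl ∷ from∈ j)))
    M∉V : M ∉ V
    M∉V i = pair⊆ uQ (VM i) refl
    V≢R : ∀ {v r} → v ∈ V → r ∈ R → v ≢ r
    V≢R i j = pair⊆ uQ (fst-thd (VMR i j))

    a>M : ∀ {x} → x ∈ a → M < x
    a>M = All.lookup a>M′
    V₁<M : ∀ {x} → x ∈ V₁ → x < M
    V₁<M = All.lookup V₁<M′
    V₁⇒V : ∀ {x} → x ∈ V₁ → x ∈ V
    V₁⇒V i = subst (_ ∈_) (sym V≡₁) (∈-++⁺ʳ a i)
    dV₁ : Desc V₁
    dV₁ = proj₁ (proj₂ (++⁻-pairs a (subst Desc V≡₁ dV)))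
    D>t : ∀ {x} → x ∈ D → t < x
    D>t = All.lookup D>t′
    B<t : ∀ {x} → x ∈ B → x < t
    B<t = All.lookup B<t′
    D⇒V : ∀ {x} → x ∈ D → x ∈ V
    D⇒V i = V₁⇒V (subst (_ ∈_) (sym V≡₂) (∈-++⁺ˡ i))
    B⇒V : ∀ {x} → x ∈ B → x ∈ V
    B⇒V i = V₁⇒V (subst (_ ∈_) (sym V≡₂) (∈-++⁺ʳ D i))
    D<M : ∀ {x} → x ∈ D → x < M
    D<M i = V₁<M (subst (_ ∈_) (sym V≡₂) (∈-++⁺ˡ i))
    V-cases : ∀ {x} → x ∈ V → x ∈ a ⊎ (x ∈ D ⊎ x ∈ B)
    V-cases i with ∈-++⁻ a (subst (_ ∈_) V≡₁ i)
    ... | inj₁ j = inj₁ j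
    ... | inj₂ j with ∈-++⁻ D (subst (_ ∈_) V≡₂ j)
    ... | inj₁ k = inj₂ (inj₁ k)
    ... | inj₂ k = inj₂ (inj₂ k)
    Q≡′ : Q ≡ a ++ D ++ B ++ M ∷ R
    Q≡′ = trans Q≡V (trans (cong (_++ M ∷ R) (trans V≡₁ (cong (a ++_) V≡₂)))
      (trans (++-assoc a (D ++ B) _) (cong (a ++_) (++-assoc D B _))))

    in-D : ∀ {v} → v ∈ V → t < v → v < M → v ∈ D
    in-D i l m with V-cases i
    ... | inj₁ j = ⊥-elim (<-asym m (a>M j))
    ... | inj₂ (inj₁ j) = j
    ... | inj₂ (inj₂ j) = ⊥-elim (<-asym l (B<t j))

    -- If x lies in V, it must be below M, or else z M y would be a 123, and x belongs to D. If x
    -- lies in R, then z > x, since z x y is no 123, and z belongs to D.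
    D∋ : ∃ (_∈ D)
    D∋ with pair-++ V (subst (_ ⊆_) Q≡V xy)
    ... | inj₁ s = ⊥-elim (desc-no-asc dV s x<y)
    ... | inj₂ (inj₂ (refl ∷ s)) = ⊥-elim (av123 (VMR z∈V (to∈ s)) z<M x<y)
    ... | inj₂ (inj₂ (_ ∷ˢ s)) with <-cmp z x
    ... | tri< z<x _ _ = ⊥-elim (av123 (VRR z∈V s) z<x x<y)
    ... | tri≈ _ e _ = ⊥-elim (V≢R z∈V (fst∈ s) e)
    ... | tri> _ _ x<z = z , in-D z∈V (<-trans t<x x<z) z<M
    D∋ | inj₂ (inj₁ (i , j)) with <-cmp x M
    ... | tri< x<M _ _ = x , in-D i t<x x<M
    ... | tri≈ _ refl _ = ⊥-elim (M∉V i)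
    D∋ | inj₂ (inj₁ (i , here refl)) | tri> _ _ M<x = ⊥-elim (<-asym M<x x<y)
    D∋ | inj₂ (inj₁ (i , there j)) | tri> _ _ M<x = ⊥-elim (av123 (VMR z∈V j) z<M (<-trans M<x x<y))

    d : ℕ
    d = proj₁ D∋
    d∈D : d ∈ D
    d∈D = proj₂ D∋
    t<M : t < M
    t<M = <-trans (D>t d∈D) (D<M d∈D)

    gap : ∀ {p d r} → p ∈ P → d ∈ D → r ∈ R → p < d → p < r
    gap {p} {_} {r} i j k l with <-cmp p r
    ... | tri< m _ _ = m
    ... | tri≈ _ e _ = ⊥-elim (P∩Q i (thd∈ (VMR (D⇒V j) k)) e)
    ... | tri> _ _ m = ⊥-elim (av2-341 i (VMR (D⇒V j) k) m l (D<M j))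

    R>t : ∀ {r} → r ∈ R → t < r
    R>t i = gap t∈P d∈D i (D>t d∈D)

    -- For d < r < M the word t d M r is a 1243, and for r > M the word d M r is a 123 in Q.
    R<D : ∀ {r d} → r ∈ R → d ∈ D → r < d
    R<D {r} {d} i j with <-cmp r d
    ... | tri< l _ _ = l
    ... | tri≈ _ e _ = ⊥-elim (V≢R (D⇒V j) i (sym e))
    ... | tri> _ _ d<r with <-cmp r M
    ... | tri< r<M _ _ = ⊥-elim (av1-243 t∈P (VMR (D⇒V j) i) (D>t j) d<r r<M)
    ... | tri≈ _ e _ = ⊥-elim (MR≢ i (sym e))
    ... | tri> _ _ M<r = ⊥-elim (av123 (VMR (D⇒V j) i) (D<M j) M<r)

    R<M : ∀ {r} → r ∈ R → r < M
    R<M i = <-trans (R<D i d∈D) (D<M d∈D)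

    c>t : ∀ {p} → p ∈ c → t < p
    c>t i = pair⊆ dP (c,t i)

    -- An entry p of c above M would give the 4123 formed by p, t, an entry of D, and M.
    c<M : ∀ {p} → p ∈ c → p < M
    c<M {p} i with <-cmp p M
    ... | tri< l _ _ = l
    ... | tri≈ _ e _ = ⊥-elim (P∩Q (c⊆P i) (snd∈ (VM z∈V)) e)
    ... | tri> _ _ l = ⊥-elim (av41-23 (c,t i) (VM (D⇒V d∈D)) (D>t d∈D) (D<M d∈D) l)

    P-cases : ∀ {p} → p ∈ P → p ∈ c ⊎ p ≡ t
    P-cases i with ∈-++⁻ c (subst (_ ∈_) P≡ i)
    ... | inj₁ j = inj₁ j
    ... | inj₂ (here e) = inj₂ e

    q'-cases : q' ∈ D ++ R ⊎ q' ∈ B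
    q'-cases with ∈-++⁻ V (subst (_ ∈_) Q≡V q'∈Q)
    ... | inj₂ (there i) = inj₁ (∈-++⁺ʳ D i)
    ... | inj₁ i with V-cases i
    ... | inj₂ (inj₁ j) = inj₁ (∈-++⁺ˡ j)
    ... | inj₂ (inj₂ j) = inj₂ j
    ... | inj₁ j = ⊥-elim (<-asym (below p'∈P) (<-trans (a>M j) q'<p'))
      where
      below : ∀ {p} → p ∈ P → p < M
      below k with P-cases k
      ... | inj₁ l = c<M l
      ... | inj₂ refl = t<M
    q'-cases | inj₂ (here refl) with P-cases p'∈P
    ... | inj₁ l = ⊥-elim (<-asym q'<p' (c<M l))
    ... | inj₂ e = ⊥-elim (<-asym q'<p' (subst (_< M) (sym e) t<M))

    DR>t : ∀ {q} → q ∈ D ++ R → t < q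
    DR>t i with ∈-++⁻ D i
    ... | inj₁ j = D>t j
    ... | inj₂ j = R>t j

    crossing : B ≡ [] → p' ∈ c × q' ∈ D ++ R
    crossing B≡[] with q'-cases
    ... | inj₂ i = ⊥-elim (∈⇒≢[] i B≡[])
    ... | inj₁ i with P-cases p'∈P
    ... | inj₁ j = j , i
    ... | inj₂ e = ⊥-elim (<-asym q'<p' (subst (_< q') (sym e) (DR>t i)))

    uR : Unique R
    uR = pairs⁺ R (λ s → pair⊆ uQ (to-Q (++⁺ˡ V (M ∷ˢ s))))

    -- Let r s be an ascent of R. If B has an entry b, then b r s is a 123. If B is empty, p' lies
    -- in c and p' t r s is a 4123 when s < p'; when p' < s, the entry p' is below all of D and R,
    -- against q' < p'.
    desc-R : Desc R
    desc-R = desc-from uR no-asc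
      where
      no-asc : ∀ {r s} → r ∷ s ∷ [] ⊆ R → ¬ r < s
      no-asc {r} {s} rs r<s = contra (empty? B)
        where
        empty? : ∀ (xs : List ℕ) → xs ≡ [] ⊎ ∃ (_∈ xs)
        empty? [] = inj₁ refl
        empty? (x ∷ _) = inj₂ (x , here refl)
        MRR : r ∷ s ∷ [] ⊆ Q
        MRR = to-Q (++⁺ˡ V (M ∷ˢ rs))
        contra : B ≡ [] ⊎ ∃ (_∈ B) → ⊥
        contra (inj₂ (b , i)) = av123 (VRR (B⇒V i) rs) (<-trans (B<t i) (R>t (fst∈ rs))) r<s
        contra (inj₁ e) with crossing e
        ... | i , j with <-cmp p' s
        ... | tri≈ _ e' _ = P∩Q p'∈P (snd∈ MRR) e'
        ... | tri> _ _ s<p = av41-23 (c,t i) MRR (R>t (fst∈ rs)) r<s s<p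
        ... | tri< p<s _ _ with ∈-++⁻ D j
        ... | inj₁ k = <-asym q'<p' (<-trans p<s (R<D (snd∈ rs) k))
        ... | inj₂ k = <-asym q'<p' (gap p'∈P d∈D k (<-trans p<s (R<D (snd∈ rs) d∈D)))

    desc-a : Desc a
    desc-a = proj₁ (++⁻-pairs a (subst Desc V≡₁ dV))
    desc-DB : Desc (D ++ B)
    desc-DB = subst Desc V≡₂ dV₁
    desc-D : Desc D
    desc-D = proj₁ (++⁻-pairs D desc-DB)
    desc-B : Desc B
    desc-B = proj₁ (proj₂ (++⁻-pairs D desc-DB))
    desc-c : Desc c
    desc-c = proj₁ (++⁻-pairs c (subst Desc P≡ dP))

    c∩D : ∀ {x} → x ∈ D → x ∈ c → ⊥
    c∩D i j = P∩Q (c⊆P j) (fst∈ (VM (D⇒V i))) refl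

    assemble : ∀ {T} → Desc T → c ++ D ++ R ↭ T → Mid T (c , D , R) → (B ≡ [] → Mid′ T (c , D , R)) → Crossed S (P , Q)
    assemble {T} dT T↭ m m′ = (a , M , (c , D , R) , t , B) , (_ , S≡ , _ , refl , T , refl , choose B refl) , cong₂ _,_ P≡ Q≡′
      where
      open CM using (_⊜_) renaming (_⊕_ to _⊞_)
      choose : ∀ B' → B ≡ B' → B ≢ [] × Mid T (c , D , R) ⊎ B ≡ [] × Mid′ T (c , D , R)
      choose [] e = inj₂ (e , m′ e)
      choose (_ ∷ _) e = inj₁ ((λ e' → case trans (sym e) e' of λ ()) , m)
      T-cases : ∀ {x} → x ∈ T → x ∈ c ⊎ x ∈ D ++ R
      T-cases i = ∈-++⁻ c (∈-resp-↭ (↭-sym T↭) i)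
      T>t : ∀ {x} → x ∈ T → t < x
      T>t i with T-cases i
      ... | inj₁ j = c>t j
      ... | inj₂ j = DR>t j
      T<M : ∀ {x} → x ∈ T → x < M
      T<M i with T-cases i
      ... | inj₁ j = c<M j
      ... | inj₂ j with ∈-++⁻ D j
      ... | inj₁ k = D<M k
      ... | inj₂ k = R<M k
      TtB : Desc (T ++ t ∷ B)
      TtB = AllPairsₚ.++⁺ dT (All.tabulate B<t ∷ desc-B)
        (All.tabulate λ i → T>t i ∷ All.tabulate λ j → <-trans (B<t j) (T>t i))
      below-M : ∀ {x} → x ∈ T ++ t ∷ B → x < M
      below-M i with ∈-++⁻ T i
      ... | inj₁ j = T<M j
      ... | inj₂ (here refl) = t<M
      ... | inj₂ (there j) = <-trans (B<t j) t<M
      S≡ : S ≡ a ++ M ∷ T ++ t ∷ B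
      S≡ = Desc-↭⇒≡ dS
        (AllPairsₚ.++⁺ desc-a (All.tabulate below-M ∷ TtB)
          (All.tabulate λ i → a>M i ∷ All.tabulate λ j → <-trans (below-M j) (a>M i)))
        (↭-trans (↭-sym perm) (↭-trans (↭-reflexive (cong₂ _++_ P≡ Q≡′))
          (↭-trans (CM.solve 7 (λ a M c D R t B → (c ⊞ t) ⊞ (a ⊞ (D ⊞ (B ⊞ (M ⊞ R)))) ⊜ a ⊞ (M ⊞ ((c ⊞ (D ⊞ R)) ⊞ (t ⊞ B)))) ↭-refl a [ M ] c D R [ t ] B)
            (++⁺ˡ-↭ a (prep M (++⁺ʳ-↭ (t ∷ B) T↭))))))

    -- Without R nothing ties c to D, so merging them by value gives an arbitrary word.
    words : R ≡ [] → Crossed S (P , Q)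
    words R≡[] with merge-desc D c desc-D desc-c c∩D
    ... | w , T , s , dT = assemble dT
      (↭-trans (++⁺ˡ-↭ c (↭-reflexive (trans (cong (D ++_) R≡[]) (++-identityʳ D)))) (↭-trans (++-comm c D) (shuffle-↭ s)))
      (inj₁ ((w , shuffle-HasT⁺ s d∈D , s) , R≡[])) (λ e → inj₁ ((w , ft e , s) , R≡[]))
      where
      ft : B ≡ [] → HasFT w
      ft e with crossing e
      ... | i , j with subst (q' ∈_) (trans (cong (D ++_) R≡[]) (++-identityʳ D)) j
      ... | k with ∈∈⇒⊆ (∈⊆ i (shuffle-⊆ʳ s)) (∈⊆ k (shuffle-⊆ˡ s)) (λ e' → <-irrefl (sym e') q'<p')
      ... | inj₁ r = shuffle-HasFT⁺ s c∩D i k r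
      ... | inj₂ r = ⊥-elim (desc-no-asc dT r q'<p')

    -- By `gap`, an entry of c below some entry of D is below all of R. Comparison with the single
    -- entry r₀ therefore separates c into c₁ above D and c₂ below R.
    runs : ∀ {r₀} → r₀ ∈ R → Crossed S (P , Q)
    runs {r₀} r₀∈R with desc-split desc-c (λ i → P∩Q (c⊆P i) (thd∈ (VMR z∈V r₀∈R)) refl)
    ... | c₁ , c₂ , e , hi , lo = assemble {T = c₁ ++ D ++ R ++ c₂} dT T↭
      (inj₂ (c₁ , c₂ , refl , e , ∈⇒≢[] d∈D , ∈⇒≢[] r₀∈R , tt)) (λ e' → inj₂ (c₁ , c₂ , refl , e , ∈⇒≢[] d∈D , ∈⇒≢[] r₀∈R , ne e'))
      where
      c₁⇒c : ∀ {x} → x ∈ c₁ → x ∈ c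
      c₁⇒c i = subst (_ ∈_) (sym e) (∈-++⁺ˡ i)
      c₂⇒c : ∀ {x} → x ∈ c₂ → x ∈ c
      c₂⇒c i = subst (_ ∈_) (sym e) (∈-++⁺ʳ c₁ i)
      c₁>D : ∀ {x y} → x ∈ c₁ → y ∈ D → y < x
      c₁>D {x} {y} i j with <-cmp x y
      ... | tri< l _ _ = ⊥-elim (<-asym (All.lookup hi i) (gap (c⊆P (c₁⇒c i)) j r₀∈R l))
      ... | tri≈ _ refl _ = ⊥-elim (c∩D j (c₁⇒c i))
      ... | tri> _ _ l = l
      c₂<R : ∀ {x y} → x ∈ c₂ → y ∈ R → x < y
      c₂<R i j = gap (c⊆P (c₂⇒c i)) d∈D j (<-trans (All.lookup lo i) (R<D r₀∈R d∈D))
      dc₁ : Desc c₁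
      dc₁ = proj₁ (++⁻-pairs c₁ (subst Desc e desc-c))
      dc₂ : Desc c₂
      dc₂ = proj₁ (proj₂ (++⁻-pairs c₁ (subst Desc e desc-c)))
      dT : Desc (c₁ ++ D ++ R ++ c₂)
      dT = thirds⁺ {U = c₁} {T = D} record
        { desc-U = dc₁ ; desc-T = desc-D
        ; desc-L = AllPairsₚ.++⁺ desc-R dc₂ (All.tabulate λ i → All.tabulate λ j → c₂<R j i)
        ; U>T = c₁>D
        ; T>L = λ i j → D>rest i (∈-++⁻ R j)
        ; U>L = λ i j → <-trans (D>rest d∈D (∈-++⁻ R j)) (c₁>D i d∈D) }
        where
        D>rest : ∀ {x y} → x ∈ D → y ∈ R ⊎ y ∈ c₂ → y < x
        D>rest i (inj₁ j) = R<D j i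
        D>rest i (inj₂ j) = <-trans (c₂<R j r₀∈R) (R<D r₀∈R i)
      T↭ : c ++ D ++ R ↭ c₁ ++ D ++ R ++ c₂
      T↭ = ↭-trans (↭-reflexive (cong (_++ D ++ R) e))
        (CM.solve 4 (λ c₁ c₂ D R → (c₁ ⊞ c₂) ⊞ (D ⊞ R) ⊜ c₁ ⊞ (D ⊞ (R ⊞ c₂))) ↭-refl c₁ c₂ D R)
        where open CM using (_⊜_) renaming (_⊕_ to _⊞_)
      ne : B ≡ [] → c₁ ≢ []
      ne e' c₁≡[] with crossing e'
      ... | i , j with subst (p' ∈_) (trans e (cong (_++ c₂) c₁≡[])) i | ∈-++⁻ D j
      ... | k | inj₁ l = <-asym q'<p' (<-trans (c₂<R k r₀∈R) (R<D r₀∈R l))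
      ... | k | inj₂ l = <-asym q'<p' (c₂<R k l)

    result : Crossed S (P , Q)
    result = choose R refl
      where
      choose : ∀ R' → R ≡ R' → Crossed S (P , Q)
      choose [] e = words e
      choose (r ∷ _) e = runs (subst (r ∈_) (sym e) (here refl))

  crossing? : Crossing P Q ⊎ (∀ {p q} → p ∈ P → q ∈ Q → p < q)
  crossing? with Any.any? (λ p → Any.any? (_<? p) Q) P
  ... | yes any = inj₁ (found (find any))
    where
    found : (∃ λ p → p ∈ P × Any (_< p) Q) → Crossing P Q
    found (p , i , any') with find any'
    ... | q , j , l = p , q , i , j , l
  ... | no none = inj₂ below
    where
    below : ∀ {p q} → p ∈ P → q ∈ Q → p < q
    below {p} {q} i j with <-cmp p q
    ... | tri< l _ _ = l
    ... | tri≈ _ e _ = ⊥-elim (P∩Q i j e)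
    ... | tri> _ _ l = ⊥-elim (none (lose i (lose j l)))

  descP : Desc P → Families S (P , Q)
  descP dP with increasing
  ... | inj₁ (_ , _ , s , l) = ⊥-elim (desc-no-asc dP s l)
  ... | inj₂ (p , x , y , i , xy , p<x , x<y) with crossing?
  ... | inj₂ P<Q = BelowP.result dP P<Q i xy x<y
  ... | inj₁ cr with first-ascent Q uQ
  ... | inj₁ dQ = ⊥-elim (desc-no-asc dQ xy x<y)
  ... | inj₂ (X , z , M , R , Q≡ , dV , z<M) = last-of (reverseView P) refl
    where
    Q≡V : Q ≡ (X ++ [ z ]) ++ M ∷ R
    Q≡V = trans Q≡ (sym (++-assoc X [ z ] (M ∷ R)))
    last-of : ∀ {P'} → Reverse P' → P ≡ P' → Families S (P , Q)
    last-of [] e = ⊥-elim (∈⇒≢[] i e)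
    last-of (c ∶ _ ∶ʳ t) e with desc-split dV (λ i → pair⊆ uQ (VM i) refl)
      where
      VM : ∀ {v} → v ∈ X ++ [ z ] → v ∷ M ∷ [] ⊆ Q
      VM i = subst (_ ⊆_) (sym Q≡V) (++⁺ (from∈ i) (refl ∷ minimum R))
    ... | a , V₁ , V≡₁ , a>M , V₁<M with desc-split (proj₁ (proj₂ (++⁻-pairs a (subst Desc V≡₁ dV)))) (λ i → P∩Q t∈P (in-Q i) refl)
      where
      t∈P : t ∈ P
      t∈P = subst (t ∈_) (sym e) (∈-++⁺ʳ c (here refl))
      in-Q : ∀ {v} → v ∈ V₁ → v ∈ Q
      in-Q i = subst (_ ∈_) (sym Q≡V) (∈-++⁺ˡ (subst (_ ∈_) (sym V≡₁) (∈-++⁺ʳ a i)))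
    ... | D , B , V≡₂ , D>t , B<t = inj₂ (inj₂ (CrossP.result e dP
      (proj₁ (proj₂ (proj₂ cr))) (proj₁ (proj₂ (proj₂ (proj₂ cr)))) (proj₂ (proj₂ (proj₂ (proj₂ cr))))
      xy (t<x (∈-++⁻ c (subst (p ∈_) e i))) x<y Q≡V (∈-++⁺ʳ X (here refl)) dV z<M V≡₁ a>M V₁<M V≡₂ D>t B<t))
      where
      t<x : p ∈ c ⊎ p ∈ [ t ] → t < x
      t<x (inj₁ j) = <-trans (pair⊆ (subst Desc e dP) (++⁺ (from∈ j) ⊆-refl)) p<x
      t<x (inj₂ (here refl)) = p<x

  families : Families S (P , Q)
  families with asc? uP
  ... | inj₁ (_ , _ , s , l) = AscP.result s l
  ... | inj₂ dP = descP dP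

split# : ℕ → ℕ
split# n = xps ft# n + (stacked# n + crossed# n)

enum-Split : EnumFam Split split#
enum-Split S d = enum-cong to (λ sp → Complete.families d sp)
  (enum-⊎ disj (enum-Shuffled S d) (enum-⊎ (stacked-crossed-disjoint d) (enum-Stacked S d) (enum-Crossed S d)))
  where
  to : ∀ {pq} → Families S pq → Split S pq
  to (inj₁ f) = shuffled⇒split d f
  to (inj₂ (inj₁ g)) = stacked⇒split d g
  to (inj₂ (inj₂ h)) = crossed⇒split d h
  disj : ∀ {pq} → Shuffled S pq → Stacked S pq ⊎ Crossed S pq → ⊥
  disj f (inj₁ g) = shuffled-stacked-disjoint d f g
  disj f (inj₂ h) = shuffled-crossed-disjoint d f h

-- The class and its permutations

record Class (xs : List ℕ) : Set where
  field
    av1243 : ∀ {a b c d} → a ∷ b ∷ c ∷ d ∷ [] ⊆ xs → a < b → b < d → d < c → ⊥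
    av2341 : ∀ {a b c d} → a ∷ b ∷ c ∷ d ∷ [] ⊆ xs → a < b → b < c → d < a → ⊥
    av4123 : ∀ {a b c d} → a ∷ b ∷ c ∷ d ∷ [] ⊆ xs → b < c → c < d → d < a → ⊥

drop-4th : ∀ {a b c d : ℕ} {xs} → a ∷ b ∷ c ∷ d ∷ [] ⊆ xs → a ∷ b ∷ c ∷ [] ⊆ xs
drop-4th = ⊆-trans (refl ∷ refl ∷ refl ∷ _ ∷ˢ [])

drop-1st : ∀ {a : ℕ} {zs xs} → a ∷ zs ⊆ xs → zs ⊆ xs
drop-1st = ⊆-trans (_ ∷ˢ ⊆-refl)

Av123⇒Class : ∀ {xs} → Av123 xs → Class xs
Av123⇒Class av = record
  { av1243 = λ s l m n → av (drop-4th s) l (<-trans m n)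
  ; av2341 = λ s l m _ → av (drop-4th s) l m
  ; av4123 = λ s l m _ → av (drop-1st s) l m }

quad-∷ʳ : ∀ {xs n} {a b c d : ℕ} → a ∷ b ∷ c ∷ d ∷ [] ⊆ xs ++ [ n ] → a ∷ b ∷ c ∷ d ∷ [] ⊆ xs ⊎ (d ≡ n × a ∷ b ∷ c ∷ [] ⊆ xs)
quad-∷ʳ {xs} s with cut xs s
... | _ , [] , e , p , _ = inj₁ (subst (_⊆ xs) (trans (sym (++-identityʳ _)) e) p)
... | _ ∷ _ ∷ _ ∷ [] , _ ∷ [] , refl , p , refl ∷ [] = inj₂ (refl , p)
... | _ , _ ∷ _ ∷ _ , _ , _ , (refl ∷ ())
... | _ , _ ∷ _ ∷ _ , _ , _ , (_ ∷ˢ ())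
... | _ , _ ∷ [] , _ , _ , (_ ∷ˢ ())
... | [] , _ ∷ [] , () , _ , _
... | _ ∷ [] , _ ∷ [] , () , _ , _
... | _ ∷ _ ∷ [] , _ ∷ [] , () , _ , _
... | _ ∷ _ ∷ _ ∷ _ ∷ [] , _ ∷ [] , () , _ , _
... | _ ∷ _ ∷ _ ∷ _ ∷ _ ∷ _ , _ ∷ [] , () , _ , _

Class-∷ʳ : ∀ {xs n} → (∀ {x} → x ∈ xs → x < n) → Class xs → Class (xs ++ [ n ])
Class-∷ʳ {xs} {n} <n cl = record { av1243 = p ; av2341 = q ; av4123 = r }
  where
  open Class cl
  p : ∀ {a b c d} → a ∷ b ∷ c ∷ d ∷ [] ⊆ xs ++ [ n ] → a < b → b < d → d < c → ⊥
  p s k l m with quad-∷ʳ s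
  ... | inj₁ s' = av1243 s' k l m
  ... | inj₂ (refl , s') = <-asym m (<n (thd∈ s'))
  q : ∀ {a b c d} → a ∷ b ∷ c ∷ d ∷ [] ⊆ xs ++ [ n ] → a < b → b < c → d < a → ⊥
  q s k l m with quad-∷ʳ s
  ... | inj₁ s' = av2341 s' k l m
  ... | inj₂ (refl , s') = <-asym m (<n (fst∈ s'))
  r : ∀ {a b c d} → a ∷ b ∷ c ∷ d ∷ [] ⊆ xs ++ [ n ] → b < c → c < d → d < a → ⊥
  r s k l m with quad-∷ʳ s
  ... | inj₁ s' = av4123 s' k l m
  ... | inj₂ (refl , s') = <-asym m (<n (fst∈ s'))

Class-⊆ : ∀ {xs ys} → xs ⊆ ys → Class ys → Class xs
Class-⊆ r cl = record
  { av1243 = λ s → av1243 (⊆-trans s r) ; av2341 = λ s → av2341 (⊆-trans s r) ; av4123 = λ s → av4123 (⊆-trans s r) }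
  where open Class cl

-- A four-term subsequence of P ++ n ∷ Q, by the number of terms in P and whether n is used.
data Quad (n : ℕ) (P Q : List ℕ) : (a b c d : ℕ) → Set where
  q0  : ∀ {a b c d} → a ∷ b ∷ c ∷ d ∷ [] ⊆ Q → Quad n P Q a b c d
  q0′ : ∀ {b c d} → b ∷ c ∷ d ∷ [] ⊆ Q → Quad n P Q n b c d
  q1  : ∀ {a b c d} → a ∈ P → b ∷ c ∷ d ∷ [] ⊆ Q → Quad n P Q a b c d
  q1′ : ∀ {a c d} → a ∈ P → c ∷ d ∷ [] ⊆ Q → Quad n P Q a n c d
  q2  : ∀ {a b c d} → a ∷ b ∷ [] ⊆ P → c ∷ d ∷ [] ⊆ Q → Quad n P Q a b c d
  q2′ : ∀ {a b d} → a ∷ b ∷ [] ⊆ P → d ∈ Q → Quad n P Q a b n d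
  q3  : ∀ {a b c d} → a ∷ b ∷ c ∷ [] ⊆ P → d ∈ Q → Quad n P Q a b c d
  q3′ : ∀ {a b c} → a ∷ b ∷ c ∷ [] ⊆ P → Quad n P Q a b c n
  q4  : ∀ {a b c d} → a ∷ b ∷ c ∷ d ∷ [] ⊆ P → Quad n P Q a b c d

quad : ∀ {n} P {Q a b c d} → a ∷ b ∷ c ∷ d ∷ [] ⊆ P ++ n ∷ Q → Quad n P Q a b c d
quad P s with cut P s
... | [] , _ , refl , p , (_ ∷ˢ q) = q0 q
... | [] , _ , refl , p , (refl ∷ q) = q0′ q
... | _ ∷ [] , _ , refl , p , (_ ∷ˢ q) = q1 (to∈ p) q
... | _ ∷ [] , _ , refl , p , (refl ∷ q) = q1′ (to∈ p) q
... | _ ∷ _ ∷ [] , _ , refl , p , (_ ∷ˢ q) = q2 p q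
... | _ ∷ _ ∷ [] , _ , refl , p , (refl ∷ q) = q2′ p (to∈ q)
... | _ ∷ _ ∷ _ ∷ [] , _ , refl , p , (_ ∷ˢ q) = q3 p (to∈ q)
... | _ ∷ _ ∷ _ ∷ [] , _ , refl , p , (refl ∷ q) = q3′ p
... | _ ∷ _ ∷ _ ∷ _ ∷ [] , _ , refl , p , q = q4 p
... | _ ∷ _ ∷ _ ∷ _ ∷ _ ∷ _ , _ , () , p , q

module _ {n P Q} (<n : ∀ {x} → x ∈ P ++ Q → x < n) where

  private
    P<n : ∀ {x} → x ∈ P → x < n
    P<n i = <n (∈-++⁺ˡ i)
    Q<n : ∀ {x} → x ∈ Q → x < n
    Q<n i = <n (∈-++⁺ʳ P i)

  Good⇒Class : Q ≢ [] → Good P Q → Class (P ++ n ∷ Q)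
  Good⇒Class ne g = record { av1243 = λ s → p (quad P s) ; av2341 = λ s → q (quad P s) ; av4123 = λ s → r (quad P s) }
    where
    open Good g
    -- The middle term of a 123 in P would be both above and below any entry of Q.
    no123 : Av123 P
    no123 s l m with ≢[]⇒∈ ne
    ... | _ , i = <-asym (proj₂ (asc-straddles (fst-snd s) l i)) (proj₁ (asc-straddles (snd-thd s) m i))
    p : ∀ {a b c d} → Quad n P Q a b c d → a < b → b < d → d < c → ⊥
    p (q0 s) k l m = av123 (drop-4th s) k (<-trans l m)
    p (q0′ s) k l m = <-asym k (Q<n (fst∈ s))
    p (q1 i s) k l m = av1-243 i s k l m
    p (q1′ i s) k l m = <-asym l (Q<n (snd∈ s))
    p (q2 i s) k l m = <-asym l (proj₂ (asc-straddles i k (snd∈ s)))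
    p (q2′ i j) k l m = <-asym l (proj₂ (asc-straddles i k j))
    p (q3 i j) k l m = <-asym l (proj₂ (asc-straddles (fst-snd i) k j))
    p (q3′ i) k l m = <-asym m (P<n (thd∈ i))
    p (q4 i) k l m = no123 (drop-4th i) k (<-trans l m)
    q : ∀ {a b c d} → Quad n P Q a b c d → a < b → b < c → d < a → ⊥
    q (q0 s) k l m = av123 (drop-4th s) k l
    q (q0′ s) k l m = <-asym k (Q<n (fst∈ s))
    q (q1 i s) k l m = av2-341 i s m k l
    q (q1′ i s) k l m = <-asym l (Q<n (fst∈ s))
    q (q2 i s) k l m = <-asym m (proj₁ (asc-straddles i k (snd∈ s)))
    q (q2′ i j) k l m = <-asym m (proj₁ (asc-straddles i k j))
    q (q3 i j) k l m = <-asym m (proj₁ (asc-straddles (fst-snd i) k j))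
    q (q3′ i) k l m = <-asym m (P<n (fst∈ i))
    q (q4 i) k l m = no123 (drop-4th i) k l
    r : ∀ {a b c d} → Quad n P Q a b c d → b < c → c < d → d < a → ⊥
    r (q0 s) k l m = av123 (drop-1st s) k l
    r (q0′ s) k l m = av123 s k l
    r (q1 i s) k l m = av123 s k l
    r (q1′ i s) k l m = <-asym k (Q<n (fst∈ s))
    r (q2 i s) k l m = av41-23 i s k l m
    r (q2′ i j) k l m = <-asym l (Q<n j)
    r (q3 i j) k l m = <-asym l (proj₂ (asc-straddles (snd-thd i) k j))
    r (q3′ i) k l m = <-asym m (P<n (fst∈ i))
    r (q4 i) k l m = no123 (drop-1st i) k l

  Class⇒Good : Unique (P ++ Q) → Class (P ++ n ∷ Q) → Good P Q
  Class⇒Good u cl = record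
    { av123 = λ s k l → av4123 (++⁺ˡ P (refl ∷ s)) k l (Q<n (thd∈ s))
    ; asc-straddles = straddles
    ; av1-243 = λ i s → av1243 (++⁺ (from∈ i) (n ∷ˢ s))
    ; av2-341 = λ i s k l m → av2341 (++⁺ (from∈ i) (n ∷ˢ s)) l m k
    ; av41-23 = λ i s → av4123 (++⁺ i (n ∷ˢ s)) }
    where
    open Class cl
    straddles : ∀ {a b q} → a ∷ b ∷ [] ⊆ P → a < b → q ∈ Q → a < q × q < b
    straddles {a} {b} {q} s a<b i with <-cmp a q | <-cmp q b
    ... | tri< k _ _ | tri< l _ _ = k , l
    ... | tri≈ _ e _ | _ = ⊥-elim (pair⊆ u (++⁺ (from∈ (fst∈ s)) (from∈ i)) e)
    ... | tri> _ _ k | _ = ⊥-elim (av2341 (++⁺ s (refl ∷ from∈ i)) a<b (P<n (snd∈ s)) k)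
    ... | _ | tri≈ _ e _ = ⊥-elim (pair⊆ u (++⁺ (from∈ (snd∈ s)) (from∈ i)) (sym e))
    ... | tri< _ _ _ | tri> _ _ l = ⊥-elim (av1243 (++⁺ s (refl ∷ from∈ i)) a<b l (Q<n i))

  increasing⇒¬Av123 : Increasing P Q → ¬ Av123 (P ++ n ∷ Q)
  increasing⇒¬Av123 (inj₁ (a , b , s , l)) av = av (++⁺ s (refl ∷ minimum Q)) l (P<n (snd∈ s))
  increasing⇒¬Av123 (inj₂ (p , x , y , i , s , k , l)) av = av (++⁺ (from∈ i) (n ∷ˢ s)) k l

Has123 : List ℕ → Set
Has123 xs = ∃ λ a → ∃₂ λ b c → a ∷ b ∷ c ∷ [] ⊆ xs × a < b × b < c

-- A 123 that starts at x is an ascent among the later entries above x, so these are filtered out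
-- and tested for descent.
has123? : ∀ {xs} → Unique xs → Has123 xs ⊎ Av123 xs
has123? {[]} _ = inj₂ λ ()
has123? {x ∷ xs} (_ ∷ u) with has123? u | partition-shuffle (x <?_) xs
... | inj₁ (a , b , c , s , l) | _ = inj₁ (a , b , c , x ∷ˢ s , l)
... | inj₂ av | w , us , ls , s , hi , lo with asc? (pairs⁺ us (λ i → pair⊆ u (⊆-trans i (shuffle-⊆ˡ s))))
... | inj₁ (b , c , i , b<c) = inj₁ (x , b , c , refl ∷ ⊆-trans i (shuffle-⊆ˡ s) , All.lookup hi (fst∈ i) , b<c)
... | inj₂ d = inj₂ no123
  where
  no123 : Av123 (x ∷ xs)
  no123 (_ ∷ˢ i) k l = av i k l
  no123 (refl ∷ i) k l with shuffle-pair s i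
  ... | inj₁ (inj₁ j) = desc-no-asc d j l
  ... | inj₁ (inj₂ j) = All.lookup lo (fst∈ j) k
  ... | inj₂ (inj₁ (_ , j)) = All.lookup lo j (<-trans k l)
  ... | inj₂ (inj₂ (j , _)) = All.lookup lo j k

increasing? : ∀ {n P Q} → (∀ {x} → x ∈ P ++ Q → x < n) → Unique (P ++ Q) → Av123 Q → Increasing P Q ⊎ Av123 (P ++ n ∷ Q)
increasing? {n} {P} {Q} <n u avQ with asc? (proj₁ (++⁻-pairs P u))
... | inj₁ asc = inj₁ (inj₁ asc)
... | inj₂ dP with has123? u
... | inj₂ av = inj₂ (Av123-insert P <n dP av)
... | inj₁ (a , b , c , s , k , l) with cut P s
... | [] , _ , refl , _ , q = ⊥-elim (avQ q k l)
... | _ ∷ [] , _ , refl , p , q = inj₁ (inj₂ (a , b , c , to∈ p , q , k , l))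
... | _ ∷ _ ∷ [] , _ , refl , p , _ = ⊥-elim (desc-no-asc dP p k)
... | _ ∷ _ ∷ _ ∷ [] , _ , refl , p , _ = ⊥-elim (desc-no-asc dP (fst-snd p) k)
... | _ ∷ _ ∷ _ ∷ _ ∷ _ , _ , () , _ , _

-- The recursion on the maximum

ClassPerm : ℕ → List ℕ → Set
ClassPerm n ρ = Perm n ρ × Class ρ

desc-downFrom : ∀ n → Desc (downFrom n)
desc-downFrom zero = []
desc-downFrom (suc n) = All.tabulate ∈-downFrom⁻ ∷ desc-downFrom n

module ClassStep (n : ℕ) where

  -- The only 123-avoider that ends with its maximum. It is already counted under `MaxLast`, hence
  -- its exclusion from `NoIncrease`.
  special : List ℕ
  special = downFrom n ++ [ n ]

  MaxLast NoIncrease WithIncrease : List ℕ → Set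
  MaxLast ρ = ∃ λ σ → ClassPerm n σ × ρ ≡ σ ++ [ n ]
  NoIncrease ρ = (Perm (suc n) ρ × Av123 ρ) × ρ ≢ special
  WithIncrease ρ = ∃ λ (pq : Pair) → Split (downFrom n) pq × ρ ≡ proj₁ pq ++ n ∷ proj₂ pq

  same-split : ∀ {P Q P' Q'} → Perm n (P ++ Q) → Perm n (P' ++ Q') → P ++ n ∷ Q ≡ P' ++ n ∷ Q' → P ≡ P' × Q ≡ Q'
  same-split {P} {P' = P'} p p' e with span-≡ P P' (Perm-∉ˡ P p) (Perm-∉ˡ P' p') (λ n → n refl) (λ n → n refl) e
  ... | e₁ , _ , e₂ = e₁ , e₂

  right[] : ∀ {σ} → Perm n σ → Perm n (σ ++ [])
  right[] = subst (Perm n) (sym (++-identityʳ _))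

  special-ok : Perm (suc n) special × Av123 special
  special-ok = Perm-insert (downFrom n) (right[] ↭-refl) ,
    Av123-insert (downFrom n) (λ i → Perm-< (right[] ↭-refl) i) (desc-downFrom n) (λ s l _ → desc-no-asc (subst Desc (sym (++-identityʳ _)) (desc-downFrom n)) (fst-snd s) l)

  to : ∀ {ρ} → MaxLast ρ ⊎ (NoIncrease ρ ⊎ WithIncrease ρ) → ClassPerm (suc n) ρ
  to (inj₁ (σ , (p , cl) , refl)) = Perm-insert σ (right[] p) , Class-∷ʳ (Perm-< p) cl
  to (inj₂ (inj₁ ((p , av) , _))) = p , Av123⇒Class av
  to (inj₂ (inj₂ ((P , Q) , mkSplit p ne g _ , refl))) = Perm-insert P p , Good⇒Class (Perm-< p) ne g

  from : ∀ {ρ} → ClassPerm (suc n) ρ → MaxLast ρ ⊎ (NoIncrease ρ ⊎ WithIncrease ρ)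
  from (p , cl) with Perm-remove p
  ... | P , [] , refl , p' = inj₁ (P , (subst (Perm n) (++-identityʳ P) p' , Class-⊆ (++⁺ʳ [ n ] ⊆-refl) cl) , refl)
  ... | P , q ∷ Q , refl , p' with Class⇒Good (Perm-< p') (Perm-unique p') cl
  ... | g with increasing? (Perm-< p') (Perm-unique p') (Good.av123 g)
  ... | inj₁ inc = inj₂ (inj₂ ((P , q ∷ Q) , mkSplit p' (λ ()) g inc , refl))
  ... | inj₂ av = inj₂ (inj₁ ((p , av) , λ e → case proj₂ (same-split p' (right[] ↭-refl) e) of λ ()))

  disj₁ : ∀ {ρ} → MaxLast ρ → NoIncrease ρ ⊎ WithIncrease ρ → ⊥
  disj₁ (σ , (p , _) , refl) (inj₁ ((_ , av) , ne)) =
    ne (cong (_++ [ n ]) (Desc-↭⇒≡ (proj₁ (Av123-remove σ (right[] p) av)) (desc-downFrom n) p))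
  disj₁ (σ , (p , _) , refl) (inj₂ ((P , Q) , mkSplit p' ne _ _ , e)) = ne (sym (proj₂ (same-split (right[] p) p' e)))

  disj₂ : ∀ {ρ} → NoIncrease ρ → WithIncrease ρ → ⊥
  disj₂ ((_ , av) , _) (_ , mkSplit p _ _ inc , refl) = increasing⇒¬Av123 (Perm-< p) inc av

  ins#-positive : ins# n 0 ≡ suc (pred (ins# n 0))
  ins#-positive = proj₁ (enum-remove special-ok (enum-Av123 n))

  enum-step : ∀ {m} → Enum (ClassPerm n) m → Enum (ClassPerm (suc n)) (m + (pred (ins# n 0) + split# n))
  enum-step {m} e = enum-cong to from (enum-⊎ disj₁ last (enum-⊎ disj₂ noInc withInc))
    where
    last : Enum MaxLast m
    last = enum-map (_++ [ n ]) (λ p → _ , p , refl) (λ q → q) (λ {σ} {σ'} _ _ → ++-cancelʳ [ n ] σ σ') e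
    noInc : Enum NoIncrease (pred (ins# n 0))
    noInc = proj₂ (enum-remove special-ok (enum-Av123 n))
    withInc : Enum WithIncrease (split# n)
    withInc = enum-map (λ (P , Q) → P ++ n ∷ Q) (λ p → _ , p , refl) (λ q → q)
      (λ sp sp' e → case same-split (Split.perm sp) (Split.perm sp') e of λ { (e₁ , e₂) → cong₂ _,_ e₁ e₂ })
      (enum-≡ (cong split# (length-downFrom n)) (enum-Split (downFrom n) (desc-downFrom n)))

class# : ℕ → ℕ
class# zero = 1
class# (suc n) = class# n + (pred (ins# n 0) + split# n)

enum-ClassPerm : ∀ n → Enum (ClassPerm n) (class# n)
enum-ClassPerm zero = enum-singleton [] (↭-refl , Av123⇒Class λ ()) (λ (p , _) → ↭-empty-inv p)
enum-ClassPerm (suc n) = ClassStep.enum-step n (enum-ClassPerm n)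

-- Words of vectors

open import Data.Fin as Fin using (Fin; zero; suc; toℕ)
open import Data.Fin.Properties as Finₚ using (toℕ<n; toℕ-fromℕ<; toℕ-injective)
open import Data.Vec as Vec using (Vec; []; _∷_)
open import Data.Vec.Properties as Vecₚ using ()

Unique-⊆⇒↭ : ∀ {A : Set} {xs ys : List A} → Unique xs → (∀ {x} → x ∈ xs → x ∈ ys) → length ys ≤ length xs → xs ↭ ys
Unique-⊆⇒↭ {xs = []} {[]} _ _ _ = ↭-refl
Unique-⊆⇒↭ {xs = x ∷ xs} (ne ∷ u) sub l with ∈-∃++ (sub (here refl))
... | as , bs , refl = ↭-trans (prep x (Unique-⊆⇒↭ u sub' l')) (↭-sym (shift x as bs))
  where
  sub' : ∀ {y} → y ∈ xs → y ∈ as ++ bs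
  sub' i with ∈-++⁻ as (sub (there i))
  ... | inj₁ j = ∈-++⁺ˡ j
  ... | inj₂ (here refl) = ⊥-elim (All.lookup ne i refl)
  ... | inj₂ (there j) = ∈-++⁺ʳ as j
  l' : length (as ++ bs) ≤ length xs
  l' with ≤-trans (≤-reflexive (sym (trans (length-++ as {x ∷ bs}) (trans (+-suc (length as) (length bs)) (cong suc (sym (length-++ as))))))) l
  ... | s≤s k = k

word : ∀ {n m} → Vec (Fin n) m → List ℕ
word v = Vec.toList (Vec.map toℕ v)

Mono : ∀ {k n} → (Fin k → Fin n) → Set
Mono f = ∀ i j → i Fin.< j → f i Fin.< f j

above-zero : ∀ {n x} {j : Fin (suc n)} → x < toℕ j → ∃ λ j' → j ≡ suc j'
above-zero {j = suc j} _ = j , refl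

-- `f zero` tells whether the head of v is used or skipped. By monotonicity the positions still to
-- be treated are positive, so they can be lowered by one for the tail.
mono⇒⊆ : ∀ {m} (v : Vec ℕ m) zs (f : Fin (length zs) → Fin m) → Mono f →
         (∀ i → List.lookup zs i ≡ Vec.lookup v (f i)) → zs ⊆ Vec.toList v
mono⇒⊆ v [] f _ _ = minimum _
mono⇒⊆ [] (z ∷ zs) f _ _ with () ← f zero
mono⇒⊆ {suc m} (x ∷ v) (z ∷ zs) f mono e = go (f zero) refl
  where
  go : ∀ i → f zero ≡ i → z ∷ zs ⊆ x ∷ Vec.toList v
  go zero f0 = trans (e zero) (cong (Vec.lookup (x ∷ v)) f0) ∷ mono⇒⊆ v zs g g-mono g-eq
    where
    above : ∀ i → ∃ λ j → f (suc i) ≡ suc j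
    above i = above-zero (subst (Fin._< f (suc i)) f0 (mono zero (suc i) (s≤s z≤n)))
    g : Fin (length zs) → Fin m
    g i = proj₁ (above i)
    g-mono : Mono g
    g-mono i j l = s≤s⁻¹ (subst₂ Fin._<_ (proj₂ (above i)) (proj₂ (above j)) (mono (suc i) (suc j) (s≤s l)))
    g-eq : ∀ i → List.lookup zs i ≡ Vec.lookup v (g i)
    g-eq i = trans (e (suc i)) (cong (Vec.lookup (x ∷ v)) (proj₂ (above i)))
  go (suc i₀) f0 = x ∷ˢ mono⇒⊆ v (z ∷ zs) g g-mono g-eq
    where
    above : ∀ i → ∃ λ j → f i ≡ suc j
    above zero = i₀ , f0
    above (suc i) = above-zero (subst (Fin._< f (suc i)) f0 (mono zero (suc i) (s≤s z≤n)))
    g : Fin (suc (length zs)) → Fin m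
    g i = proj₁ (above i)
    g-mono : Mono g
    g-mono i j l = s≤s⁻¹ (subst₂ Fin._<_ (proj₂ (above i)) (proj₂ (above j)) (mono i j l))
    g-eq : ∀ i → List.lookup (z ∷ zs) i ≡ Vec.lookup v (g i)
    g-eq i = trans (e i) (cong (Vec.lookup (x ∷ v)) (proj₂ (above i)))

⊆⇒mono : ∀ {m} (v : Vec ℕ m) {zs} → zs ⊆ Vec.toList v →
         ∃ λ (f : Fin (length zs) → Fin m) → Mono f × (∀ i → List.lookup zs i ≡ Vec.lookup v (f i))
⊆⇒mono [] [] = (λ ()) , (λ ()) , λ ()
⊆⇒mono (x ∷ v) (_ ∷ˢ s) with ⊆⇒mono v s
... | f , mono , e = (λ i → suc (f i)) , (λ i j l → s≤s (mono i j l)) , e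
⊆⇒mono (x ∷ v) {z ∷ zs} (refl ∷ s) with ⊆⇒mono v s
... | f , mono , e = g , g-mono , g-eq
  where
  g : Fin (suc (length zs)) → Fin _
  g zero = zero
  g (suc i) = suc (f i)
  g-mono : Mono g
  g-mono zero (suc j) _ = s≤s z≤n
  g-mono (suc i) (suc j) (s≤s l) = s≤s (mono i j l)
  g-eq : ∀ i → List.lookup (z ∷ zs) i ≡ Vec.lookup (x ∷ v) (g i)
  g-eq zero = refl
  g-eq (suc i) = e i

word-lookup : ∀ {n m} (σ : Vec (Fin n) m) i → Vec.lookup (Vec.map toℕ σ) i ≡ toℕ (Vec.lookup σ i)
word-lookup σ i = Vecₚ.lookup-map i toℕ σ

word-length : ∀ {n m} (σ : Vec (Fin n) m) → length (word σ) ≡ m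
word-length σ = Vecₚ.length-toList (Vec.map toℕ σ)

word-injective : ∀ {n m} (σ σ' : Vec (Fin n) m) → word σ ≡ word σ' → σ ≡ σ'
word-injective [] [] _ = refl
word-injective (x ∷ σ) (x' ∷ σ') e = cong₂ _∷_ (toℕ-injective (∷-injectiveˡ e)) (word-injective σ σ' (∷-injectiveʳ e))

word-< : ∀ {n m} (σ : Vec (Fin n) m) → All (_< n) (word σ)
word-< [] = []
word-< (x ∷ σ) = toℕ<n x ∷ word-< σ

from-word : ∀ {n m} ρ → length ρ ≡ m → All (_< n) ρ → ∃ λ (σ : Vec (Fin n) m) → ρ ≡ word σ
from-word [] refl [] = [] , refl
from-word (x ∷ ρ) refl (l ∷ ls) with from-word ρ refl ls
... | σ , e = Fin.fromℕ< l ∷ σ , cong₂ _∷_ (sym (toℕ-fromℕ< l)) e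

IsPerm⇒Perm : ∀ {n} (σ : Vec (Fin n) n) → IsPerm σ → Perm n (word σ)
IsPerm⇒Perm {n} σ inj = Unique-⊆⇒↭ (pairs⁺ (word σ) distinct)
  (λ i → ∈-downFrom⁺ (All.lookup (word-< σ) i)) (≤-reflexive (trans (length-downFrom n) (sym (word-length σ))))
  where
  distinct : ∀ {a b} → a ∷ b ∷ [] ⊆ word σ → a ≢ b
  distinct s e with ⊆⇒mono (Vec.map toℕ σ) s
  ... | f , mono , eq = <-irrefl (cong toℕ (inj (toℕ-injective
    (trans (sym (word-lookup σ _)) (trans (sym (eq zero)) (trans e (trans (eq (suc zero)) (word-lookup σ _)))))))) (mono zero (suc zero) (s≤s z≤n))

word-distinct : ∀ {n m} (σ : Vec (Fin n) m) → Unique (word σ) → ∀ i j → i Fin.< j → Vec.lookup σ i ≢ Vec.lookup σ j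
word-distinct σ u i j l e = pair⊆ u (mono⇒⊆ (Vec.map toℕ σ) (toℕ (Vec.lookup σ i) ∷ toℕ (Vec.lookup σ j) ∷ []) f f-mono f-eq) (cong toℕ e)
  where
  f : Fin 2 → Fin _
  f zero = i
  f (suc zero) = j
  f-mono : Mono f
  f-mono zero (suc zero) _ = l
  f-mono (suc zero) (suc zero) (s≤s ())
  f-eq : ∀ k → List.lookup (toℕ (Vec.lookup σ i) ∷ toℕ (Vec.lookup σ j) ∷ []) k ≡ Vec.lookup (Vec.map toℕ σ) (f k)
  f-eq zero = sym (word-lookup σ i)
  f-eq (suc zero) = sym (word-lookup σ j)

Perm⇒IsPerm : ∀ {n} (σ : Vec (Fin n) n) → Perm n (word σ) → IsPerm σ
Perm⇒IsPerm σ p {i} {j} e with Finₚ.<-cmp i j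
... | tri< l _ _ = ⊥-elim (word-distinct σ (Perm-unique p) i j l e)
... | tri≈ _ i≡j _ = i≡j
... | tri> _ _ l = ⊥-elim (word-distinct σ (Perm-unique p) j i l (sym e))

Quadruple : Set
Quadruple = Fin 4 → ℕ

quadruple : Quadruple → List ℕ
quadruple v = v zero ∷ v (suc zero) ∷ v (suc (suc zero)) ∷ v (suc (suc (suc zero))) ∷ []

-- v is ordered by the ranks r, hence order isomorphic to any τ with the same ranks.
module _ {n} (σ : Vec (Fin n) n) (τ : Vec ℕ 4) (r : Fin 4 → Fin 4) (τ≡ : ∀ i → Vec.lookup τ i ≡ suc (toℕ (r i))) where

  contains⁺ : ∀ (h : Quadruple) → h zero < h (suc zero) → h (suc zero) < h (suc (suc zero)) → h (suc (suc zero)) < h (suc (suc (suc zero))) →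
              quadruple (λ i → h (r i)) ⊆ word σ → Contains σ τ
  contains⁺ h h₀₁ h₁₂ h₂₃ s with ⊆⇒mono (Vec.map toℕ σ) s
  ... | f , f-mono , e = f , f-mono , λ i j → mk⇔ (to i j) (from i j)
    where
    h-mono : ∀ x y → x Fin.< y → h x < h y
    h-mono zero (suc zero) _ = h₀₁
    h-mono zero (suc (suc zero)) _ = <-trans h₀₁ h₁₂
    h-mono zero (suc (suc (suc zero))) _ = <-trans h₀₁ (<-trans h₁₂ h₂₃)
    h-mono (suc zero) (suc (suc zero)) _ = h₁₂
    h-mono (suc zero) (suc (suc (suc zero))) _ = <-trans h₁₂ h₂₃
    h-mono (suc (suc zero)) (suc (suc (suc zero))) _ = h₂₃
    h-mono (suc zero) (suc zero) (s≤s ())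
    h-mono (suc (suc _)) (suc zero) (s≤s ())
    h-mono (suc (suc zero)) (suc (suc zero)) (s≤s (s≤s ()))
    h-mono (suc (suc (suc _))) (suc (suc zero)) (s≤s (s≤s ()))
    h-mono (suc (suc (suc zero))) (suc (suc (suc zero))) (s≤s (s≤s (s≤s ())))
    h-reflects : ∀ x y → h x < h y → x Fin.< y
    h-reflects x y l with Finₚ.<-cmp x y
    ... | tri< k _ _ = k
    ... | tri≈ _ refl _ = ⊥-elim (<-irrefl refl l)
    ... | tri> _ _ k = ⊥-elim (<-asym l (h-mono y x k))
    value : ∀ i → toℕ (Vec.lookup σ (f i)) ≡ h (r i)
    value i = trans (sym (word-lookup σ (f i))) (trans (sym (e i)) (list-value i))
      where
      list-value : ∀ i → List.lookup (quadruple (λ i → h (r i))) i ≡ h (r i)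
      list-value zero = refl
      list-value (suc zero) = refl
      list-value (suc (suc zero)) = refl
      list-value (suc (suc (suc zero))) = refl
    to : ∀ i j → toℕ (Vec.lookup σ (f i)) < toℕ (Vec.lookup σ (f j)) → Vec.lookup τ i < Vec.lookup τ j
    to i j l = subst₂ _<_ (sym (τ≡ i)) (sym (τ≡ j)) (s≤s (h-reflects (r i) (r j) (subst₂ _<_ (value i) (value j) l)))
    from : ∀ i j → Vec.lookup τ i < Vec.lookup τ j → toℕ (Vec.lookup σ (f i)) < toℕ (Vec.lookup σ (f j))
    from i j l with subst₂ _<_ (τ≡ i) (τ≡ j) l
    ... | s≤s k = subst₂ _<_ (sym (value i)) (sym (value j)) (h-mono (r i) (r j) k)

  contains⁻ : Contains σ τ → ∃ λ (v : Quadruple) → quadruple v ⊆ word σ × (∀ i j → r i Fin.< r j → v i < v j)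
  contains⁻ (f , f-mono , iff) = v , mono⇒⊆ (Vec.map toℕ σ) (quadruple v) f f-mono value , order
    where
    v : Quadruple
    v i = toℕ (Vec.lookup σ (f i))
    value : ∀ i → List.lookup (quadruple v) i ≡ Vec.lookup (Vec.map toℕ σ) (f i)
    value zero = sym (word-lookup σ _)
    value (suc zero) = sym (word-lookup σ _)
    value (suc (suc zero)) = sym (word-lookup σ _)
    value (suc (suc (suc zero))) = sym (word-lookup σ _)
    order : ∀ i j → r i Fin.< r j → v i < v j
    order i j l = Equivalence.from (iff i j) (subst₂ _<_ (sym (τ≡ i)) (sym (τ≡ j)) (s≤s l))

i₀ i₁ i₂ i₃ : Fin 4
i₀ = zero
i₁ = suc zero
i₂ = suc (suc zero)
i₃ = suc (suc (suc zero))

tuple : ∀ {A : Set} → A → A → A → A → Fin 4 → A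
tuple a b c d zero = a
tuple a b c d (suc zero) = b
tuple a b c d (suc (suc zero)) = c
tuple a b c d (suc (suc (suc zero))) = d

r1243 r2341 r4123 : Fin 4 → Fin 4
r1243 = tuple i₀ i₁ i₃ i₂
r2341 = tuple i₁ i₂ i₃ i₀
r4123 = tuple i₃ i₀ i₁ i₂

ranks1243 : ∀ i → Vec.lookup p1243 i ≡ suc (toℕ (r1243 i))
ranks1243 = λ { zero → refl ; (suc zero) → refl ; (suc (suc zero)) → refl ; (suc (suc (suc zero))) → refl }
ranks2341 : ∀ i → Vec.lookup p2341 i ≡ suc (toℕ (r2341 i))
ranks2341 = λ { zero → refl ; (suc zero) → refl ; (suc (suc zero)) → refl ; (suc (suc (suc zero))) → refl }
ranks4123 : ∀ i → Vec.lookup p4123 i ≡ suc (toℕ (r4123 i))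
ranks4123 = λ { zero → refl ; (suc zero) → refl ; (suc (suc zero)) → refl ; (suc (suc (suc zero))) → refl }

ClassPerm⇒InSnT : ∀ {n} (σ : Vec (Fin n) n) → ClassPerm n (word σ) → InSnT σ
ClassPerm⇒InSnT σ (p , cl) = Perm⇒IsPerm σ p
  , (λ c → case contains⁻ σ p1243 r1243 ranks1243 c of λ { (v , s , o) → av1243 s (o i₀ i₁ 0<1) (o i₁ i₃ 1<2) (o i₃ i₂ 2<3) })
  , (λ c → case contains⁻ σ p2341 r2341 ranks2341 c of λ { (v , s , o) → av2341 s (o i₀ i₁ 1<2) (o i₁ i₂ 2<3) (o i₃ i₀ 0<1) })
  , (λ c → case contains⁻ σ p4123 r4123 ranks4123 c of λ { (v , s , o) → av4123 s (o i₁ i₂ 0<1) (o i₂ i₃ 1<2) (o i₃ i₀ 2<3) })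
  where
  open Class cl
  0<1 : 0 < 1
  0<1 = ≤-refl
  1<2 : 1 < 2
  1<2 = ≤-refl
  2<3 : 2 < 3
  2<3 = ≤-refl

InSnT⇒ClassPerm : ∀ {n} (σ : Vec (Fin n) n) → InSnT σ → ClassPerm n (word σ)
InSnT⇒ClassPerm σ (p , ¬1243 , ¬2341 , ¬4123) = IsPerm⇒Perm σ p , record
  -- Each tuple lists the four values in increasing order, and the ranks put them back into word
  -- order.
  { av1243 = λ {a} {b} {c} {d} s k l m → ¬1243 (contains⁺ σ p1243 r1243 ranks1243 (tuple a b d c) k l m s)
  ; av2341 = λ {a} {b} {c} {d} s k l m → ¬2341 (contains⁺ σ p2341 r2341 ranks2341 (tuple d a b c) m k l s)
  ; av4123 = λ {a} {b} {c} {d} s k l m → ¬4123 (contains⁺ σ p4123 r4123 ranks4123 (tuple b c d a) k l m s) }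

card : ∀ n → CardSnT n (class# n)
card n = list , unique , (λ σ → mk⇔ (All.lookup sound) complete) , size
  where
  R : List ℕ → Vec (Fin n) n → Set
  R ρ σ = ρ ≡ word σ
  total : ∀ {ρ} → ClassPerm n ρ → ∃ (R ρ)
  total (p , _) = from-word _ (trans (↭-length p) (length-downFrom n)) (All.tabulate (Perm-< p))
  members : Enum InSnT (class# n)
  members = enum-cong {Q = InSnT} (λ { {σ} (_ , p , refl) → ClassPerm⇒InSnT σ p }) (λ {σ} p → word σ , InSnT⇒ClassPerm σ p , refl)
    (enum-rel R total (λ _ e e' → word-injective _ _ (trans (sym e) e')) (λ _ _ e e' → trans e (sym e')) (enum-ClassPerm n))
  open Enum members

-- Power series

open import Data.Integer as ℤ using (ℤ; +_; -[1+_]; -1ℤ)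
open ≡-Reasoning

⊛-suc : ∀ f g n → (f ⊛ g) (suc n) ≡ f 0 ℤ.* g (suc n) ℤ.+ ((λ k → f (suc k)) ⊛ g) n
⊛-suc f g n = cong (λ l → f 0 ℤ.* g (suc n) ℤ.+ sumℤ l)
  (trans (map-applyUpTo suc (λ k → f k ℤ.* g (suc n ℕ.∸ k)) (suc n)) (sym (map-applyUpTo (λ k → k) (λ k → f (suc k) ℤ.* g (n ℕ.∸ k)) (suc n))))

-- With Y = X/(1 - x), expressed by partial sums, this is f · (X/(1 - x)) = (f · X)/(1 - x)
-- coefficientwise.
⊛-partial-sums : ∀ X Y → Y 0 ≡ X 0 → (∀ n → Y (suc n) ≡ Y n ℤ.+ X (suc n)) →
                 ∀ f n → (f ⊛ Y) (suc n) ≡ (f ⊛ Y) n ℤ.+ (f ⊛ X) (suc n)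
⊛-partial-sums X Y e₀ e f zero = begin
  f 0 ℤ.* Y 1 ℤ.+ (f 1 ℤ.* Y 0 ℤ.+ + 0)                                ≡⟨ cong₂ (λ u v → f 0 ℤ.* u ℤ.+ (f 1 ℤ.* v ℤ.+ + 0)) (e 0) e₀ ⟩
  f 0 ℤ.* (Y 0 ℤ.+ X 1) ℤ.+ (f 1 ℤ.* X 0 ℤ.+ + 0)                      ≡⟨ ring (f 0) (f 1) (Y 0) (X 1) (X 0) ⟩
  (f 0 ℤ.* Y 0 ℤ.+ + 0) ℤ.+ (f 0 ℤ.* X 1 ℤ.+ (f 1 ℤ.* X 0 ℤ.+ + 0))    ∎
  where
  ring : ∀ a b y x₁ x₀ → a ℤ.* (y ℤ.+ x₁) ℤ.+ (b ℤ.* x₀ ℤ.+ + 0) ≡ (a ℤ.* y ℤ.+ + 0) ℤ.+ (a ℤ.* x₁ ℤ.+ (b ℤ.* x₀ ℤ.+ + 0))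
  ring = ℤ-solve-∀
⊛-partial-sums X Y e₀ e f (suc n) = begin
  (f ⊛ Y) (suc (suc n))                                                        ≡⟨ ⊛-suc f Y (suc n) ⟩
  f 0 ℤ.* Y (suc (suc n)) ℤ.+ (f′ ⊛ Y) (suc n)                                 ≡⟨ cong₂ (λ u v → f 0 ℤ.* u ℤ.+ v) (e (suc n)) (⊛-partial-sums X Y e₀ e f′ n) ⟩
  f 0 ℤ.* (Y (suc n) ℤ.+ X (suc (suc n))) ℤ.+ ((f′ ⊛ Y) n ℤ.+ (f′ ⊛ X) (suc n))  ≡⟨ ring (f 0) (Y (suc n)) (X (suc (suc n))) _ _ ⟩
  (f 0 ℤ.* Y (suc n) ℤ.+ (f′ ⊛ Y) n) ℤ.+ (f 0 ℤ.* X (suc (suc n)) ℤ.+ (f′ ⊛ X) (suc n))  ≡⟨ cong₂ ℤ._+_ (sym (⊛-suc f Y n)) (sym (⊛-suc f X (suc n))) ⟩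
  (f ⊛ Y) (suc n) ℤ.+ (f ⊛ X) (suc (suc n))                                    ∎
  where
  f′ = λ k → f (suc k)
  ring : ∀ a y x u v → a ℤ.* (y ℤ.+ x) ℤ.+ (u ℤ.+ v) ≡ (a ℤ.* y ℤ.+ u) ℤ.+ (a ℤ.* x ℤ.+ v)
  ring = ℤ-solve-∀

-- Stated for every series with all coefficients 1 because the induction passes to the tail of g,
-- which is `geom 1` only pointwise.
ones-⊛ : ∀ g X → (∀ k → g k ≡ + 1) → ∀ n → (g ⊛ X) (suc n) ≡ (g ⊛ X) n ℤ.+ X (suc n)
ones-⊛ g X ones zero = begin
  g 0 ℤ.* X 1 ℤ.+ (g 1 ℤ.* X 0 ℤ.+ + 0)    ≡⟨ cong₂ (λ u v → u ℤ.* X 1 ℤ.+ (v ℤ.* X 0 ℤ.+ + 0)) (ones 0) (trans (ones 1) (sym (ones 0))) ⟩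
  + 1 ℤ.* X 1 ℤ.+ (g 0 ℤ.* X 0 ℤ.+ + 0)    ≡⟨ ring (X 1) _ ⟩
  (g 0 ℤ.* X 0 ℤ.+ + 0) ℤ.+ X 1            ∎
  where
  ring : ∀ x u → + 1 ℤ.* x ℤ.+ u ≡ u ℤ.+ x
  ring = ℤ-solve-∀
ones-⊛ g X ones (suc n) = begin
  (g ⊛ X) (suc (suc n))                                               ≡⟨ ⊛-suc g X (suc n) ⟩
  g 0 ℤ.* X (suc (suc n)) ℤ.+ (g′ ⊛ X) (suc n)                        ≡⟨ cong₂ (λ u v → u ℤ.* X (suc (suc n)) ℤ.+ v) (ones 0) (ones-⊛ g′ X (λ k → ones (suc k)) n) ⟩
  + 1 ℤ.* X (suc (suc n)) ℤ.+ ((g′ ⊛ X) n ℤ.+ X (suc n))              ≡⟨ ring (X (suc (suc n))) _ (X (suc n)) ⟩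
  (+ 1 ℤ.* X (suc n) ℤ.+ (g′ ⊛ X) n) ℤ.+ X (suc (suc n))              ≡⟨ cong (λ u → (u ℤ.* X (suc n) ℤ.+ (g′ ⊛ X) n) ℤ.+ X (suc (suc n))) (sym (ones 0)) ⟩
  (g 0 ℤ.* X (suc n) ℤ.+ (g′ ⊛ X) n) ℤ.+ X (suc (suc n))              ≡⟨ cong (ℤ._+ X (suc (suc n))) (sym (⊛-suc g X n)) ⟩
  (g ⊛ X) (suc n) ℤ.+ X (suc (suc n))                                 ∎
  where
  g′ = λ k → g (suc k)
  ring : ∀ a u x → + 1 ℤ.* a ℤ.+ (u ℤ.+ x) ≡ (+ 1 ℤ.* x ℤ.+ u) ℤ.+ a
  ring = ℤ-solve-∀

geom1≡1 : ∀ k → geom 1 k ≡ + 1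
geom1≡1 k = cong +_ (ℕₚ.^-zeroˡ k)

geom1-⊛ : ∀ X n → (geom 1 ⊛ X) (suc n) ≡ (geom 1 ⊛ X) n ℤ.+ X (suc n)
geom1-⊛ X = ones-⊛ (geom 1) X geom1≡1

geom1-⊛-0 : ∀ X → (geom 1 ⊛ X) 0 ≡ X 0
geom1-⊛-0 X = ring (X 0)
  where
  ring : ∀ x → + 1 ℤ.* x ℤ.+ + 0 ≡ x
  ring = ℤ-solve-∀

⊛-geom2 : ∀ f n → (f ⊛ geom 2) (suc n) ≡ + 2 ℤ.* (f ⊛ geom 2) n ℤ.+ f (suc n)
⊛-geom2 f zero = ring (f 0) (f 1)
  where
  ring : ∀ a b → a ℤ.* + 2 ℤ.+ (b ℤ.* + 1 ℤ.+ + 0) ≡ + 2 ℤ.* (a ℤ.* + 1 ℤ.+ + 0) ℤ.+ b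
  ring = ℤ-solve-∀
⊛-geom2 f (suc n) = begin
  (f ⊛ geom 2) (suc (suc n))                                              ≡⟨ ⊛-suc f (geom 2) (suc n) ⟩
  f 0 ℤ.* geom 2 (suc (suc n)) ℤ.+ (f′ ⊛ geom 2) (suc n)                  ≡⟨ cong₂ (λ u v → f 0 ℤ.* u ℤ.+ v) (ℤₚ.pos-* 2 (2 ^ suc n)) (⊛-geom2 f′ n) ⟩
  f 0 ℤ.* (+ 2 ℤ.* geom 2 (suc n)) ℤ.+ (+ 2 ℤ.* (f′ ⊛ geom 2) n ℤ.+ f (suc (suc n)))  ≡⟨ ring (f 0) (geom 2 (suc n)) _ _ ⟩
  + 2 ℤ.* (f 0 ℤ.* geom 2 (suc n) ℤ.+ (f′ ⊛ geom 2) n) ℤ.+ f (suc (suc n))  ≡⟨ cong (λ u → + 2 ℤ.* u ℤ.+ f (suc (suc n))) (sym (⊛-suc f (geom 2) n)) ⟩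
  + 2 ℤ.* (f ⊛ geom 2) (suc n) ℤ.+ f (suc (suc n))                        ∎
  where
  f′ = λ k → f (suc k)
  ring : ∀ a g u v → a ℤ.* (+ 2 ℤ.* g) ℤ.+ (+ 2 ℤ.* u ℤ.+ v) ≡ + 2 ℤ.* (a ℤ.* g ℤ.+ u) ℤ.+ v
  ring = ℤ-solve-∀

⊛-one : ∀ f n → (f ⊛ poly (+ 1 ∷ [])) n ≡ f n
⊛-one f zero = ring (f 0)
  where
  ring : ∀ a → a ℤ.* + 1 ℤ.+ + 0 ≡ a
  ring = ℤ-solve-∀
⊛-one f (suc n) = trans (⊛-suc f (poly (+ 1 ∷ [])) n) (trans (cong (λ u → f 0 ℤ.* + 0 ℤ.+ u) (⊛-one (λ k → f (suc k)) n)) (ring (f 0) _))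
  where
  ring : ∀ a b → a ℤ.* + 0 ℤ.+ b ≡ b
  ring = ℤ-solve-∀

-- binom i cs n = Σⱼ cs[j] · C(n, i + j)
binom : ℕ → List ℤ → ℕ → ℤ
binom i [] n = + 0
binom i (c ∷ cs) n = c ℤ.* + bin n i ℤ.+ binom (suc i) cs n

binom-suc : ∀ i cs n → binom (suc i) cs (suc n) ≡ binom i cs n ℤ.+ binom (suc i) cs n
binom-suc i [] n = refl
binom-suc i (c ∷ cs) n = trans (cong₂ (λ u v → c ℤ.* u ℤ.+ v) (ℤₚ.pos-+ (bin n i) (bin n (suc i))) (binom-suc (suc i) cs n))
  (ring c (+ bin n i) (+ bin n (suc i)) _ _)
  where
  ring : ∀ c p q u v → c ℤ.* (p ℤ.+ q) ℤ.+ (u ℤ.+ v) ≡ (c ℤ.* p ℤ.+ u) ℤ.+ (c ℤ.* q ℤ.+ v)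
  ring = ℤ-solve-∀

-- As C(n + 1, k) - C(n, k) = C(n, k - 1), the forward difference in Newton's basis drops the
-- leading coefficient.
binom-Δ : ∀ c cs n → binom 0 (c ∷ cs) (suc n) ≡ binom 0 (c ∷ cs) n ℤ.+ binom 0 cs n
binom-Δ c cs n = trans (cong (λ u → c ℤ.* + 1 ℤ.+ u) (binom-suc 0 cs n)) (ring (c ℤ.* + 1) _ _)
  where
  ring : ∀ c u v → c ℤ.+ (u ℤ.+ v) ≡ (c ℤ.+ v) ℤ.+ u
  ring = ℤ-solve-∀

binom-0 : ∀ c cs → binom 0 (c ∷ cs) 0 ≡ c
binom-0 c cs = trans (cong (λ u → c ℤ.* + 1 ℤ.+ u) (vanish 0 cs)) (ring c)
  where
  ring : ∀ c → c ℤ.* + 1 ℤ.+ + 0 ≡ c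
  ring = ℤ-solve-∀
  ring₀ : ∀ c → c ℤ.* + 0 ℤ.+ + 0 ≡ + 0
  ring₀ = ℤ-solve-∀
  vanish : ∀ i cs → binom (suc i) cs 0 ≡ + 0
  vanish i [] = refl
  vanish i (c ∷ cs) = trans (cong (λ u → c ℤ.* + 0 ℤ.+ u) (vanish (suc i) cs)) (ring₀ c)

_⊞_ : List ℤ → List ℤ → List ℤ
[] ⊞ ds = ds
(c ∷ cs) ⊞ [] = c ∷ cs
(c ∷ cs) ⊞ (d ∷ ds) = (c ℤ.+ d) ∷ (cs ⊞ ds)

binom-⊞ : ∀ i cs ds n → binom i (cs ⊞ ds) n ≡ binom i cs n ℤ.+ binom i ds n
binom-⊞ i [] ds n = sym (ℤₚ.+-identityˡ _)
binom-⊞ i (c ∷ cs) [] n = sym (ℤₚ.+-identityʳ _)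
binom-⊞ i (c ∷ cs) (d ∷ ds) n = trans (cong (λ u → (c ℤ.+ d) ℤ.* + bin n i ℤ.+ u) (binom-⊞ (suc i) cs ds n)) (ring c d (+ bin n i) _ _)
  where
  ring : ∀ c d b u v → (c ℤ.+ d) ℤ.* b ℤ.+ (u ℤ.+ v) ≡ (c ℤ.* b ℤ.+ u) ℤ.+ (d ℤ.* b ℤ.+ v)
  ring = ℤ-solve-∀

rest : List ℤ → List ℤ
rest [] = []
rest (c ∷ cs) = cs

-- The Newton coefficients of the shifted function: the function plus its difference.
next : List ℤ → List ℤ
next cs = cs ⊞ rest cs

binom-next : ∀ cs n → binom 0 cs (suc n) ≡ binom 0 (next cs) n
binom-next [] n = refl
binom-next (c ∷ cs) n = trans (binom-Δ c cs n) (sym (binom-⊞ 0 (c ∷ cs) cs n))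

-- Closed forms of the counts

record Rep (f : ℕ → ℕ) (α : ℤ) (cs : List ℤ) : Set where
  constructor rep
  field
    at : ∀ n → + f n ≡ α ℤ.* + (2 ^ n) ℤ.+ binom 0 cs n
open Rep

2^suc : ∀ n → + (2 ^ suc n) ≡ + 2 ℤ.* + (2 ^ n)
2^suc n = ℤₚ.pos-* 2 (2 ^ n)

rep-suc : ∀ {f α cs} → Rep f α cs → Rep (λ n → f (suc n)) (α ℤ.* + 2) (next cs)
rep-suc {α = α} {cs} r .at n = trans (at r (suc n)) (cong₂ ℤ._+_ (trans (cong (α ℤ.*_) (2^suc n)) (sym (ℤₚ.*-assoc α (+ 2) _))) (binom-next cs n))

rep-+ : ∀ {f g α β cs ds} → Rep f α cs → Rep g β ds → Rep (λ n → f n ℕ.+ g n) (α ℤ.+ β) (cs ⊞ ds)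
rep-+ {f} {g} {α} {β} {cs} {ds} r s .at n = begin
  + (f n ℕ.+ g n)                                                          ≡⟨ ℤₚ.pos-+ (f n) (g n) ⟩
  + f n ℤ.+ + g n                                                          ≡⟨ cong₂ ℤ._+_ (at r n) (at s n) ⟩
  (α ℤ.* p ℤ.+ binom 0 cs n) ℤ.+ (β ℤ.* p ℤ.+ binom 0 ds n)                ≡⟨ ring α β p _ _ ⟩
  (α ℤ.+ β) ℤ.* p ℤ.+ (binom 0 cs n ℤ.+ binom 0 ds n)                      ≡⟨ cong (λ u → (α ℤ.+ β) ℤ.* p ℤ.+ u) (sym (binom-⊞ 0 cs ds n)) ⟩
  (α ℤ.+ β) ℤ.* p ℤ.+ binom 0 (cs ⊞ ds) n                                  ∎
  where
  p = + (2 ^ n)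
  ring : ∀ α β p u v → (α ℤ.* p ℤ.+ u) ℤ.+ (β ℤ.* p ℤ.+ v) ≡ (α ℤ.+ β) ℤ.* p ℤ.+ (u ℤ.+ v)
  ring = ℤ-solve-∀

-- Since 2ⁿ is its own difference, f inherits α from its difference g, and the new leading
-- coefficient adjusts the value at 0.
rep-Δ : ∀ f {g α cs} → (∀ n → f (suc n) ≡ f n ℕ.+ g n) → Rep g α cs → Rep f α ((+ f 0 ℤ.- α) ∷ cs)
rep-Δ f {g} {α} {cs} e r .at zero = sym (trans (cong (λ u → α ℤ.* + 1 ℤ.+ u) (binom-0 _ cs)) (ring α (+ f 0)))
  where
  ring : ∀ α x → α ℤ.* + 1 ℤ.+ (x ℤ.- α) ≡ x
  ring = ℤ-solve-∀
rep-Δ f {g} {α} {cs} e r .at (suc n) = begin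
  + f (suc n)                                                                    ≡⟨ trans (cong +_ (e n)) (ℤₚ.pos-+ (f n) (g n)) ⟩
  + f n ℤ.+ + g n                                                                ≡⟨ cong₂ ℤ._+_ (at (rep-Δ f e r) n) (at r n) ⟩
  (α ℤ.* p ℤ.+ binom 0 (c ∷ cs) n) ℤ.+ (α ℤ.* p ℤ.+ binom 0 cs n)                ≡⟨ ring α p _ _ ⟩
  α ℤ.* (+ 2 ℤ.* p) ℤ.+ (binom 0 (c ∷ cs) n ℤ.+ binom 0 cs n)                    ≡⟨ cong₂ (λ u v → α ℤ.* u ℤ.+ v) (sym (2^suc n)) (sym (binom-Δ c cs n)) ⟩
  α ℤ.* + (2 ^ suc n) ℤ.+ binom 0 (c ∷ cs) (suc n)                               ∎
  where
  c = + f 0 ℤ.- α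
  p = + (2 ^ n)
  ring : ∀ α p u v → (α ℤ.* p ℤ.+ u) ℤ.+ (α ℤ.* p ℤ.+ v) ≡ α ℤ.* (+ 2 ℤ.* p) ℤ.+ (u ℤ.+ v)
  ring = ℤ-solve-∀

rep-≗ : ∀ {f g α cs} → (∀ n → f n ≡ g n) → Rep f α cs → Rep g α cs
rep-≗ e r .at n = trans (cong +_ (sym (e n))) (at r n)

rep-xps : ∀ {f α cs} → Rep f α cs → Rep (xps f) α ((+ 0 ℤ.- α) ∷ cs)
rep-xps {f} = rep-Δ (xps f) λ { zero → refl ; (suc n) → ℕₚ.+-comm (f (suc n)) (ps f n) }

rep-ps : ∀ {f α cs} → Rep f α cs → Rep (ps f) (α ℤ.* + 2) ((+ f 0 ℤ.- α ℤ.* + 2) ∷ next cs)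
rep-ps {f} r = rep-Δ (ps f) (λ n → ℕₚ.+-comm (f (suc n)) (ps f n)) (rep-suc r)

ps-shift : ∀ f n → ps (shift# f) n ≡ xps f n
ps-shift f zero = refl
ps-shift f (suc zero) = ℕₚ.+-identityʳ (f 0)
ps-shift f (suc (suc n)) = cong (f (suc n) ℕ.+_) (ps-shift f (suc n))

rep-ps-shift : ∀ {f α cs} → Rep f α cs → Rep (ps (shift# f)) α ((+ 0 ℤ.- α) ∷ cs)
rep-ps-shift {f} r = rep-≗ (λ n → sym (ps-shift f n)) (rep-xps r)

rep-all : Rep all# (+ 1) []
rep-all .at n = trans (cong +_ (all≡ n)) (ring (+ (2 ^ n)))
  where
  all≡ : ∀ n → all# n ≡ 2 ^ n
  all≡ zero = refl
  all≡ (suc n) = cong₂ ℕ._+_ (all≡ n) (trans (all≡ n) (sym (ℕₚ.+-identityʳ _)))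
  ring : ∀ p → p ≡ + 1 ℤ.* p ℤ.+ + 0
  ring = ℤ-solve-∀

rep-one : Rep (λ _ → 1) (+ 0) (+ 1 ∷ [])
rep-one .at n = refl

rep-t : Rep t# (+ 1) (-1ℤ ∷ [])
rep-t = rep-Δ t# (λ n → ℕₚ.+-comm (all# n) (t# n)) rep-all

rep-ft : Rep ft# (+ 1) (-1ℤ ∷ -1ℤ ∷ [])
rep-ft = rep-Δ ft# (λ n → refl) rep-t

rep-mid : Rep mid# (+ 1) (-1ℤ ∷ + 0 ∷ + 1 ∷ + 1 ∷ [])
rep-mid = rep-+ rep-t (rep-ps (rep-xps (rep-xps rep-one)))

rep-mid′ : Rep mid′# (+ 1) (-1ℤ ∷ -1ℤ ∷ + 0 ∷ + 1 ∷ [])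
rep-mid′ = rep-+ rep-ft (rep-xps (rep-xps (rep-xps rep-one)))

-- The two tail shapes of the third family start at different sizes, so one formula covers them only from size 2 on.
split₂# : ℕ → ℕ
split₂# n = split# (suc (suc n))

-- The polynomial part of `split#`. Each of the three families contributes one 2ⁿ, hence the factor
-- 3 in `rep-split`; it appears as 12 in `rep-split₂` because of the shift by two.
excess : List ℤ
excess = -[1+ 2 ] ∷ -[1+ 2 ] ∷ -[1+ 2 ] ∷ -1ℤ ∷ + 1 ∷ + 1 ∷ []

rep-split₂ : Rep split₂# (+ 12) (next (next excess))
rep-split₂ = rep-+ (rep-suc (rep-suc (rep-xps rep-ft))) (rep-+ (rep-suc (rep-suc (rep-ps-shift (rep-ps-shift rep-t))))
  (rep-≗ (λ n → sym (ps-shift tail# (suc (suc n))))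
    (rep-Δ (λ n → ps tail# (suc n)) (λ n → ℕₚ.+-comm (tail# (suc (suc n))) (ps tail# (suc n))) (rep-+ (rep-ps rep-mid) (rep-suc rep-mid′)))))

rep-split : Rep split# (+ 3) excess
rep-split .at zero = refl
rep-split .at (suc zero) = refl
rep-split .at (suc (suc n)) = trans (at rep-split₂ n) (cong₂ ℤ._+_ (trans (ring (+ (2 ^ n))) (cong (+ 3 ℤ.*_) (sym (trans (2^suc (suc n)) (cong (+ 2 ℤ.*_) (2^suc n))))))
  (sym (trans (binom-next excess (suc n)) (binom-next (next excess) n))))
  where
  ring : ∀ p → + 12 ℤ.* p ≡ + 3 ℤ.* (+ 2 ℤ.* (+ 2 ℤ.* p))
  ring = ℤ-solve-∀

-- The rational part of the generating function

numerator/[1-x]^ : ℕ → Series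
numerator/[1-x]^ j = numerator ⊛ pow (geom 1) j

record From (j o : ℕ) (cs : List ℤ) : Set where
  field
    value : ∀ n → numerator/[1-x]^ j (o ℕ.+ n) ≡ binom 0 cs n
open From

-- Division by 1 - x is summation, so the known tail becomes the difference of the new one, and the
-- value at degree o becomes its leading coefficient. The offset thus drops from 8, just past the
-- degree of the numerator, to 1 after seven divisions.
from-suc : ∀ {j o cs} → From j (suc o) cs → From (suc j) o (numerator/[1-x]^ (suc j) o ∷ cs)
from-suc {j} {o} {cs} e .value zero = trans (cong (numerator/[1-x]^ (suc j)) (ℕₚ.+-identityʳ o)) (sym (binom-0 _ cs))
from-suc {j} {o} {cs} e .value (suc n) = begin
  numerator/[1-x]^ (suc j) (o ℕ.+ suc n)                                             ≡⟨ cong (numerator/[1-x]^ (suc j)) (ℕₚ.+-suc o n) ⟩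
  numerator/[1-x]^ (suc j) (suc (o ℕ.+ n))                                           ≡⟨ ⊛-partial-sums X (pow (geom 1) (suc j)) (geom1-⊛-0 X) (geom1-⊛ X) numerator (o ℕ.+ n) ⟩
  numerator/[1-x]^ (suc j) (o ℕ.+ n) ℤ.+ numerator/[1-x]^ j (suc (o ℕ.+ n))          ≡⟨ cong₂ ℤ._+_ (value (from-suc e) n) (value e n) ⟩
  binom 0 (c ∷ cs) n ℤ.+ binom 0 cs n                                                ≡⟨ sym (binom-Δ c cs n) ⟩
  binom 0 (c ∷ cs) (suc n)                                                           ∎
  where
  X = pow (geom 1) j
  c = numerator/[1-x]^ (suc j) o

from-0 : From 0 8 []
from-0 .value n = ⊛-one numerator (8 ℕ.+ n)

-- For k = 1, ..., 7 the k-th entry is the coefficient of x^k in the numerator divided by (1 - x)^(8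
-- - k).
fraction : List ℤ
fraction = -[1+ 1 ] ∷ + 1 ∷ + 0 ∷ + 2 ∷ + 2 ∷ + 0 ∷ -1ℤ ∷ []

from-7 : From 7 1 fraction
from-7 = from-suc (from-suc (from-suc (from-suc (from-suc (from-suc (from-suc from-0))))))

rational : Series
rational = numerator ⊛ pow (geom 1) 7 ⊛ geom 2

-- The recurrence of 1/(1 - 2x) makes each entry the previous one plus the corresponding entry of
-- `fraction`, starting from 1 - 3. The entries of `fraction` sum to 2, so 3 is the multiple of 2ⁿ
-- for which this ends at 0 and leaves a polynomial.
rationals : List ℤ
rationals = -[1+ 1 ] ∷ -[1+ 3 ] ∷ -[1+ 2 ] ∷ -[1+ 2 ] ∷ -1ℤ ∷ + 1 ∷ + 1 ∷ + 0 ∷ []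

rational-closed : ∀ n → rational n ≡ + 3 ℤ.* + (2 ^ n) ℤ.+ binom 0 rationals n
rational-closed zero = refl
rational-closed (suc n) = begin
  rational (suc n)                                                                     ≡⟨ ⊛-geom2 (numerator/[1-x]^ 7) n ⟩
  + 2 ℤ.* rational n ℤ.+ numerator/[1-x]^ 7 (suc n)                                    ≡⟨ cong₂ (λ u v → + 2 ℤ.* u ℤ.+ v) (rational-closed n) (value from-7 n) ⟩
  + 2 ℤ.* (+ 3 ℤ.* p ℤ.+ binom 0 rationals n) ℤ.+ binom 0 fraction n                   ≡⟨ ring p _ _ ⟩
  + 3 ℤ.* (+ 2 ℤ.* p) ℤ.+ (binom 0 rationals n ℤ.+ (binom 0 rationals n ℤ.+ binom 0 fraction n)) ≡⟨ cong₂ (λ u v → + 3 ℤ.* u ℤ.+ (binom 0 rationals n ℤ.+ v)) (sym (2^suc n)) (sym (binom-⊞ 0 rationals fraction n)) ⟩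
  + 3 ℤ.* + (2 ^ suc n) ℤ.+ (binom 0 rationals n ℤ.+ binom 0 (rest rationals) n)       ≡⟨ cong (λ u → + 3 ℤ.* + (2 ^ suc n) ℤ.+ u) (sym (binom-Δ -[1+ 1 ] (rest rationals) n)) ⟩
  + 3 ℤ.* + (2 ^ suc n) ℤ.+ binom 0 rationals (suc n)                                  ∎
  where
  p = + (2 ^ n)
  ring : ∀ p u v → + 2 ℤ.* (+ 3 ℤ.* p ℤ.+ u) ℤ.+ v ≡ + 3 ℤ.* (+ 2 ℤ.* p) ℤ.+ (u ℤ.+ (u ℤ.+ v))
  ring = ℤ-solve-∀

-- The 1 on the left accounts for the 123-avoider that is left out of the Catalan count at each
-- size.
rational-Δ : ∀ n → rational (suc n) ℤ.+ + 1 ≡ rational n ℤ.+ + split# n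
rational-Δ n = begin
  rational (suc n) ℤ.+ + 1                                                             ≡⟨ cong (ℤ._+ + 1) (rational-closed (suc n)) ⟩
  + 3 ℤ.* + (2 ^ suc n) ℤ.+ binom 0 rationals (suc n) ℤ.+ + 1                          ≡⟨ cong₂ (λ u v → + 3 ℤ.* u ℤ.+ v ℤ.+ + 1) (2^suc n) (binom-Δ -[1+ 1 ] (rest rationals) n) ⟩
  + 3 ℤ.* (+ 2 ℤ.* p) ℤ.+ (binom 0 rationals n ℤ.+ binom 0 (rest rationals) n) ℤ.+ + 1 ≡⟨ ring p _ _ ⟩
  (+ 3 ℤ.* p ℤ.+ binom 0 rationals n) ℤ.+ (+ 3 ℤ.* p ℤ.+ (binom 0 (rest rationals) n ℤ.+ (+ 1 ℤ.* + 1 ℤ.+ + 0)))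
    ≡⟨ cong₂ (λ u v → u ℤ.+ (+ 3 ℤ.* p ℤ.+ v)) (sym (rational-closed n)) (sym (binom-⊞ 0 (rest rationals) (+ 1 ∷ []) n)) ⟩
  rational n ℤ.+ (+ 3 ℤ.* p ℤ.+ binom 0 (rest rationals ⊞ (+ 1 ∷ [])) n)               ≡⟨ cong (λ u → rational n ℤ.+ (+ 3 ℤ.* p ℤ.+ u)) (trailing n) ⟩
  rational n ℤ.+ (+ 3 ℤ.* p ℤ.+ binom 0 excess n)                                      ≡⟨ cong (λ u → rational n ℤ.+ u) (sym (at rep-split n)) ⟩
  rational n ℤ.+ + split# n                                                                ∎
  where
  p = + (2 ^ n)
  ring : ∀ p u v → + 3 ℤ.* (+ 2 ℤ.* p) ℤ.+ (u ℤ.+ v) ℤ.+ + 1 ≡ (+ 3 ℤ.* p ℤ.+ u) ℤ.+ (+ 3 ℤ.* p ℤ.+ (v ℤ.+ (+ 1 ℤ.* + 1 ℤ.+ + 0)))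
  ring = ℤ-solve-∀
  trailing : ∀ n → binom 0 (rest rationals ⊞ (+ 1 ∷ [])) n ≡ binom 0 excess n
  trailing n = trans (binom-⊞ 0 excess (+ 0 ∷ + 0 ∷ + 0 ∷ + 0 ∷ + 0 ∷ + 0 ∷ + 0 ∷ []) n) (ring₀ _)
    where
    ring₀ : ∀ u → u ℤ.+ + 0 ≡ u
    ring₀ = ℤ-solve-∀

class-series : ∀ n → + class# n ≡ rhsGF n
class-series zero = refl
-- Adding 1 to both sides turns `pred` of the Catalan number back into the Catalan number itself,
-- whose partial sums are the values of `K`.
class-series (suc n) = ∙-cancelʳ (+ 1) _ _ (begin
  + class# (suc n) ℤ.+ + 1                                                   ≡⟨ cong +_ (rearrange (class# n) (pred (ins# n 0)) (split# n)) ⟩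
  + (class# n ℕ.+ split# n ℕ.+ suc (pred (ins# n 0)))                            ≡⟨ cong (λ u → + (class# n ℕ.+ split# n ℕ.+ u)) (trans (sym (ClassStep.ins#-positive n)) (ins#-catalan n)) ⟩
  + class# n ℤ.+ + split# n ℤ.+ catalanGF (suc n)                                ≡⟨ cong (λ u → u ℤ.+ + split# n ℤ.+ catalanGF (suc n)) (class-series n) ⟩
  (rational n ℤ.+ K n) ℤ.+ + split# n ℤ.+ catalanGF (suc n)                      ≡⟨ ring₁ (rational n) (K n) (+ split# n) (catalanGF (suc n)) ⟩
  (rational n ℤ.+ + split# n) ℤ.+ (K n ℤ.+ catalanGF (suc n))                    ≡⟨ cong₂ ℤ._+_ (sym (rational-Δ n)) (sym (geom1-⊛ catalanGF-1 n)) ⟩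
  (rational (suc n) ℤ.+ + 1) ℤ.+ K (suc n)                                   ≡⟨ ring₂ (rational (suc n)) (K (suc n)) ⟩
  (rational (suc n) ℤ.+ K (suc n)) ℤ.+ + 1                                   ∎)
  where
  K : Series
  K = geom 1 ⊛ catalanGF-1
  rearrange : ∀ c p e → c ℕ.+ (p ℕ.+ e) ℕ.+ 1 ≡ c ℕ.+ e ℕ.+ (1 ℕ.+ p)
  rearrange = solve-∀
  ring₁ : ∀ r k e c → (r ℤ.+ k) ℤ.+ e ℤ.+ c ≡ (r ℤ.+ e) ℤ.+ (k ℤ.+ c)
  ring₁ = ℤ-solve-∀
  ring₂ : ∀ r k → (r ℤ.+ + 1) ℤ.+ k ≡ (r ℤ.+ k) ℤ.+ + 1
  ring₂ = ℤ-solve-∀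

theorem3p17 : ∀ (n : ℕ) → Σ ℕ λ m → CardSnT n m × (+ m ≡ rhsGF n)
theorem3p17 n = class# n , card n , class-series n
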